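{- Let $g\geq1$. Define $$m_2^g=\sum m_2^g(r),$$ the sum over integers $r\ge0$ with $\frac{2g+1-r}{4}\in\{0,1,2,\dots\}$; $$m_3^g=\sum m_3^g(s,t),$$ the sum over integers $s,t\ge0$ with $\frac{g+1-s-t}{3}\in\{0,1,2,\dots\}$ and $s\equiv 2g+1\pmod 3$; $$m_6^g=\sum m_6^g(3r;2s,2t),$$ the sum over integers $r,s,t\ge0$ with $\frac{2g+5-3r-4s-4t}{12}\in\{0,1,2,\dots\}$ and $2s\equiv 2g+1\pmod 3$. For a positive integer $d$, let $M_d^g$ be the number of equivalence classes of oriented maximal Wicks forms of genus $g$ whose automorphism group has order divisible by $d$. Then $$M_1^g=m_1^g+m_2^g+2m_3^g+2m_6^g,\qquad M_2^g=2m_2^g+4m_6^g,\qquad M_3^g=3m_3^g+3m_6^g,\qquad M_6^g=6m_6^g,$$ and $M_d^g=0$ whenever $d$ is not a divisor of $6$.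
   Context: An oriented Wicks form is a cyclic word $w=w_1w_2\cdots w_{2l}$ over an alphabet $a_1^{\pm1},a_2^{\pm1},\dots$ such that: (1) if $a_i^{\epsilon}$ ($\epsilon\in\{\pm1\}$) appears in $w$, then $a_i^{ -\epsilon}$ appears exactly once; (2) no cyclic factor is of the form $a_ia_i^{ -1}$ or $a_i^{ -1}a_i$; (3) if $a_i^{\epsilon}a_j^{\delta}$ is a cyclic factor, then $a_j^{ -\delta}a_i^{ -\epsilon}$ is not. Two forms are isomorphic (equivalent) if one is obtained from the other, as cyclic words, by a bijection of alphabets $\varphi$ with $\varphi(a^{ -1})=\varphi(a)^{ -1}$. Gluing a $2l$-gon labelled by $w$ gives a closed oriented surface $S$ with a graph $\Gamma\subset S$; the genus of $S$ is the genus of $w$. The edges of $\Gamma$ are the letter pairs, and the vertices are the classes of identified corners between consecutive letters. A form of genus $g$ is maximal if its length is $6(2g-1)$; then all vertices of $\Gamma$ have degree $3$. Sign of a vertex $V$ (edges $a,b,c$ oriented toward $V$): $V$ is positive if $w=ab^{ -1}\cdots bc^{ -1}\cdots ca^{ -1}\cdots$ or $w=ac^{ -1}\cdots cb^{ -1}\cdots ba^{ -1}\cdots$. It is negative if $w=ab^{ -1}\cdots ca^{ -1}\cdots bc^{ -1}\cdots$ or $w=ac^{ -1}\cdots ba^{ -1}\cdots cb^{ -1}\cdots$. $\mathrm{Aut}(w)$, for $w=w_1\cdots w_{2e}$, is the group of cyclic shifts $\mu$ of the linear word such that $\mu(w)$ is obtained from $w$ by a bijection $\varphi_\mu$ of the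 alphabet compatible with inverses. It acts on the edges and vertices of $\Gamma$. An edge $\{a,a^{ -1}\}$ is reversed if $\varphi_\mu(a)=a^{ -1}$. The sets of equivalence classes of oriented maximal Wicks forms of genus $g$ are: - $W_1^g$: all such forms; - $W_2^g(r)$: those with an automorphism of order $2$ reversing exactly $r$ edges; - $W_3^g(s,t)$: those with an automorphism of order $3$ fixing exactly $s$ positive and $t$ negative vertices; - $W_6^g(3r;2s,2t)=W_2^g(3r)\cap W_3^g(2s,2t)$. The mass of a finite set $W$ is $m(W)=\sum_{w\in W}1/|\mathrm{Aut}(w)|$. We write $m_1^g=m(W_1^g)$, $m_2^g(r)=m(W_2^g(r))$, $m_3^g(s,t)=m(W_3^g(s,t))$ and $m_6^g(3r;2s,2t)=m(W_6^g(3r;2s,2t))$. -}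

module Defs where

open import Data.Nat using (ℕ; zero; suc; _+_; _*_; _∸_; _≤ᵇ_; _<ᵇ_; _≡ᵇ_; _≤_)
open import Data.Nat.DivMod using (_mod_; _%_)
open import Data.Nat.Divisibility using (_∣?_)
open import Data.Fin using (Fin; toℕ)
import Data.Fin as F
open import Data.Bool using (Bool; true; false; _∧_; _∨_; not; if_then_else_; T)
open import Data.Product using (_×_; _,_; Σ; ∃)
open import Data.List using (List; []; _∷_; length; map; foldr; allFin; upTo; filterᵇ; lookup; concatMap)
open import Data.Bool.ListAction using (all; any)
open import Data.List.Relation.Unary.All using (All)
open import Data.List.Relation.Unary.Any using (Any)
open import Data.Integer using (+_)
open import Data.Rational using (ℚ; 0ℚ; _/_) renaming (_+_ to _+ℚ_)
open import Relation.Nullary using (does)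
open import Relation.Binary.PropositionalEquality using (_≡_)
open import Function.Bundles using (_↔_; Inverse)

-- A signed letter a_i^{±1}: (i , true) = a_i, (i , false) = a_i^{-1}.
Letter : ℕ → Set
Letter e = Fin e × Bool

inv : ∀ {e} → Letter e → Letter e
inv (a , s) = (a , not s)

eqBool : Bool → Bool → Bool
eqBool true  b = b
eqBool false b = not b

_==L_ : ∀ {e} → Letter e → Letter e → Bool
(a , s) ==L (b , t) = does (a F.≟ b) ∧ eqBool s t

allLetters : ∀ e → List (Letter e)
allLetters e = concatMap (λ a → (a , true) ∷ (a , false) ∷ []) (allFin e)

-- A (linear representative of a) cyclic word of length n over a_1..a_e.
Word : ℕ → ℕ → Set
Word n e = Fin n → Letter e

count : ∀ {A : Set} → (A → Bool) → List A → ℕ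
count p xs = length (filterᵇ p xs)

shift : ∀ {n} → ℕ → Fin n → Fin n
shift {suc m} k i = (toℕ i + k) mod suc m

next : ∀ {n} → Fin n → Fin n
next = shift 1

prev : ∀ {n} → Fin n → Fin n
prev {suc m} = shift m

module _ {n e : ℕ} (w : Word n e) where

  occ : Letter e → ℕ
  occ x = count (λ p → w p ==L x) (allFin n)

  appears : Letter e → Bool
  appears x = any (λ p → w p ==L x) (allFin n)

  cond1 : Bool
  cond1 = all (λ x → not (appears x) ∨ (occ (inv x) ≡ᵇ 1)) (allLetters e)

  -- normalisation of the alphabet: the letters used are exactly a_1..a_e
  usesAll : Bool
  usesAll = all (λ a → appears (a , true) ∨ appears (a , false)) (allFin e)

  cond2 : Bool
  cond2 = all (λ p → not (w (next p) ==L inv (w p))) (allFin n)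

  cond3 : Bool
  cond3 = all (λ p → all (λ q →
            not ((w q ==L inv (w (next p))) ∧ (w (next q) ==L inv (w p))))
            (allFin n)) (allFin n)

  isWicks : Bool
  isWicks = cond1 ∧ usesAll ∧ cond2 ∧ cond3

  firstOr : Fin n → (Fin n → Bool) → List (Fin n) → Fin n
  firstOr d p []       = d
  firstOr d p (i ∷ is) = if p i then i else firstOr d p is

  -- position of a letter in w (unique for Wicks forms)
  pos : Letter e → Fin n → Fin n
  pos x d = firstOr d (λ p → w p ==L x) (allFin n)

  -- Corner i is the corner between w_i and w_{i+1} (end of w_i, start of
  -- w_{i+1}).  Gluing identifies corner i with corner j - 1, where j is the
  -- position of the inverse of w_i.  Vertices of Γ = orbits of this map.
  corner-step : Fin n → Fin n
  corner-step i = prev (pos (inv (w i)) i)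

  iter : ℕ → Fin n → Fin n
  iter zero    i = i
  iter (suc k) i = corner-step (iter k i)

  sameVertex : Fin n → Fin n → Bool
  sameVertex i j = any (λ k → toℕ (iter k i) ≡ᵇ toℕ j) (upTo n)

  isVertexRep : Fin n → Bool
  isVertexRep i = all (λ j → not (sameVertex i j) ∨ (toℕ i ≤ᵇ toℕ j)) (allFin n)

  numVertices : ℕ
  numVertices = count isVertexRep (allFin n)

  -- genus of the glued surface (one face): V - E + 1 = 2 - 2g
  hasGenus : ℕ → Bool
  hasGenus g = (2 * g + numVertices) ≡ᵇ (e + 1)

  _<F_ : Fin n → Fin n → Bool
  i <F j = toℕ i <ᵇ toℕ j

  cycInc : Fin n → Fin n → Fin n → Bool
  cycInc p q r = ((p <F q) ∧ (q <F r)) ∨ ((q <F r) ∧ (r <F p)) ∨ ((r <F p) ∧ (p <F q))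

  triples : (Fin n → Fin n → Fin n → Bool) → Bool
  triples P = any (λ p → any (λ q → any (λ r → P p q r) (allFin n)) (allFin n)) (allFin n)

  -- V (represented by corner i) is positive iff w = a b^{-1} ⋯ b c^{-1} ⋯ c a^{-1} ⋯
  -- with these three factors at corners of V (the second pattern of the
  -- paper is the same one with b and c renamed).  The factor at corner p
  -- is w_p w_{p+1}.
  isPositive : Fin n → Bool
  isPositive i = triples (λ p q r →
      sameVertex i p ∧ sameVertex i q ∧ sameVertex i r ∧ cycInc p q r ∧
      -- p : a b^{-1},  q : b c^{-1},  r : c a^{-1}
      (w q ==L inv (w (next p))) ∧ (w r ==L inv (w (next q))) ∧ (w p ==L inv (w (next r))))

  -- V negative iff w = a b^{-1} ⋯ c a^{-1} ⋯ b c^{-1} ⋯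
  isNegative : Fin n → Bool
  isNegative i = triples (λ p q r →
      sameVertex i p ∧ sameVertex i q ∧ sameVertex i r ∧ cycInc p q r ∧
      -- p : a b^{-1},  q : c a^{-1},  r : b c^{-1}
      (w (next q) ==L inv (w p)) ∧ (w r ==L inv (w (next p))) ∧ (w q ==L inv (w (next r))))

  -- Automorphisms (cyclic shifts μ_k : w_p ↦ w_{p+k})

  -- the alphabet map φ_k with μ_k(w) = φ_k(w):  φ_k(w_p) = w_{p+k}
  φ : ℕ → Letter e → Fin n → Letter e
  φ k x d = w (shift k (pos x d))

  -- μ_k ∈ Aut(w) iff φ_k is compatible with inverses (it is a bijection of
  -- the alphabet with μ_k(w) = φ_k ∘ w since w is a bijection onto the letters)
  isAut : Fin n → Bool
  isAut k = all (λ x → φ (toℕ k) (inv x) k ==L inv (φ (toℕ k) x k)) (allLetters e)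

  autOrder : ℕ
  autOrder = suc (count (λ k → not (toℕ k ≡ᵇ 0) ∧ isAut k) (allFin n))

  hasOrder : Fin n → ℕ → Bool
  hasOrder k d = (1 ≤ᵇ d) ∧ does (n ∣? (d * toℕ k))
               ∧ all (λ d' → (d' ≡ᵇ 0) ∨ not (does (n ∣? (d' * toℕ k)))) (upTo d)

  reversedEdges : Fin n → ℕ
  reversedEdges k = count (λ a → φ (toℕ k) (a , true) k ==L (a , false)) (allFin e)

  -- μ_k maps corner i to corner i+k; vertex V fixed iff that corner lies on V
  fixedVertex : Fin n → Fin n → Bool
  fixedVertex k i = isVertexRep i ∧ sameVertex i (shift (toℕ k) i)

  fixedPositive : Fin n → ℕ
  fixedPositive k = count (λ i → fixedVertex k i ∧ isPositive i) (allFin n)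

  fixedNegative : Fin n → ℕ
  fixedNegative k = count (λ i → fixedVertex k i ∧ isNegative i) (allFin n)

  inW2 : ℕ → Bool
  inW2 r = any (λ k → isAut k ∧ hasOrder k 2 ∧ (reversedEdges k ≡ᵇ r)) (allFin n)

  inW3 : ℕ → ℕ → Bool
  inW3 s t = any (λ k → isAut k ∧ hasOrder k 3 ∧ (fixedPositive k ≡ᵇ s)
                        ∧ (fixedNegative k ≡ᵇ t)) (allFin n)

  inW6 : ℕ → ℕ → ℕ → Bool
  inW6 r s t = inW2 (3 * r) ∧ inW3 (2 * s) (2 * t)

edges : ℕ → ℕ
edges g = 3 * (2 * g ∸ 1)

len : ℕ → ℕ
len g = edges g + edges g

MWord : ℕ → Set
MWord g = Word (len g) (edges g)

IsMaxWicks : (g : ℕ) → MWord g → Set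
IsMaxWicks g w = T (isWicks w ∧ hasGenus w g)

Iso : ∀ {n e} → Word n e → Word n e → Set
Iso {n} {e} w w' = Σ ℕ λ k → Σ (Letter e ↔ Letter e) λ φ →
  (∀ x → Inverse.to φ (inv x) ≡ inv (Inverse.to φ x)) ×
  (∀ p → w' p ≡ Inverse.to φ (w (shift k p)))

IsTransversal : (g : ℕ) → List (MWord g) → Set
IsTransversal g L =
  All (IsMaxWicks g) L ×
  (∀ i j → Iso (lookup L i) (lookup L j) → i ≡ j) ×
  (∀ w → IsMaxWicks g w → Any (Iso w) L)

sumQ : List ℚ → ℚ
sumQ = foldr _+ℚ_ 0ℚ

ℕtoℚ : ℕ → ℚ
ℕtoℚ m = + m / 1

mass : (g : ℕ) → (MWord g → Bool) → List (MWord g) → ℚ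
mass g P L = sumQ (map (λ (w : MWord g) → + 1 / autOrder w) (filterᵇ P L))

m₁ : (g : ℕ) → List (MWord g) → ℚ
m₁ g L = mass g (λ _ → true) L

m₂ : (g : ℕ) → ℕ → List (MWord g) → ℚ
m₂ g r L = mass g (λ w → inW2 w r) L

m₃ : (g : ℕ) → ℕ → ℕ → List (MWord g) → ℚ
m₃ g s t L = mass g (λ w → inW3 w s t) L

m₆ : (g : ℕ) → ℕ → ℕ → ℕ → List (MWord g) → ℚ
m₆ g r s t L = mass g (λ w → inW6 w r s t) L

m₂tot : (g : ℕ) → List (MWord g) → ℚ
m₂tot g L = sumQ (map (λ r → m₂ g r L)
  (filterᵇ (λ r → (r ≤ᵇ 2 * g + 1) ∧ does (4 ∣? (2 * g + 1 ∸ r))) (upTo (2 * g + 2))))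

m₃tot : (g : ℕ) → List (MWord g) → ℚ
m₃tot g L = sumQ (concatMap (λ s → map (λ t → m₃ g s t L)
  (filterᵇ (λ t → (s + t ≤ᵇ g + 1) ∧ does (3 ∣? (g + 1 ∸ (s + t)))
                  ∧ (s % 3 ≡ᵇ (2 * g + 1) % 3)) (upTo (g + 2))))
  (upTo (g + 2)))

m₆tot : (g : ℕ) → List (MWord g) → ℚ
m₆tot g L = sumQ (concatMap (λ r → concatMap (λ s → map (λ t → m₆ g r s t L)
  (filterᵇ (λ t → (3 * r + 4 * s + 4 * t ≤ᵇ 2 * g + 5)
                  ∧ does (12 ∣? (2 * g + 5 ∸ (3 * r + 4 * s + 4 * t)))
                  ∧ ((2 * s) % 3 ≡ᵇ (2 * g + 1) % 3)) (upTo (2 * g + 6))))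
  (upTo (2 * g + 6))) (upTo (2 * g + 6)))

Mcount : (g : ℕ) → ℕ → List (MWord g) → ℕ
Mcount g d L = count (λ (w : MWord g) → does (d ∣? autOrder w)) L

{-# OPTIONS --safe #-}
-- Number the letters of a maximal form by ℤ/n, n = 6(2g-1).  Matching inverse letters is a
-- fixed-point-free involution τ, and ρ = prev ∘ τ permutes the corners, with the vertices as its
-- cycles.  Conditions (2) and (3) exclude cycles of length 1 and 2, so counting gives ρ³ = 1.
-- Automorphisms are the shifts commuting with τ; τ and ρ then descend to ℤ/m, where m = n/d.
-- Three facts about the quotient give everything.
--   * Σ (π i - i), i running over ℤ/m, is a homomorphism to ℤ/n on permutations commuting with
--     the shift by m.  It has order dividing 2 on τ and 3 on ρ, and is -m on prev: so d ∣ 6.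
--     For d = 3 it also counts the positive minus the negative fixed vertices modulo 3.
--   * A vertex other than that of corner 0 is first visited along an edge of its own.  This
--     bounds the number of vertices (nonnegativity of the genus of the quotient).
--   * For d = 2 the number m is odd, so the m-cycle prev and ρ are even permutations, hence so
--     is τ: this fixes the number of reversed edges modulo 4.
-- Finally, if |Aut w| = a, the coefficients in each formula add up to a times the indicator
-- of the divisibility, separately for a = 1, 2, 3, 6.

module Submission where

open import Defs
open import Algebra.Bundles using (CommutativeMonoid)
open import Data.Bool using (Bool; true; false; _∧_; _∨_; not; _xor_)
open import Data.Bool.ListAction using (all; any)
open import Data.Bool.Properties using (not-involutive; T-≡; T?)
open import Data.Empty using (⊥; ⊥-elim)
open import Data.Fin as Fin using (Fin; zero; suc; toℕ; inject≤; _↑ˡ_; _↑ʳ_; splitAt)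
open import Data.Fin.Permutation using (permutation)
open import Data.Fin.Properties using (toℕ-injective; toℕ<n; toℕ-fromℕ<; toℕ-inject≤; all?; pigeonhole; splitAt-↑ˡ; splitAt-↑ʳ; splitAt⁻¹-↑ˡ; splitAt⁻¹-↑ʳ)
open import Data.List using (List; []; _∷_; _++_; map; concatMap; filterᵇ; allFin; upTo; tabulate)
open import Data.List.Membership.Propositional using (_∈_)
open import Data.List.Membership.Propositional.Properties using (∈-allFin; ∈-upTo⁺; ∈-upTo⁻; ∈-concatMap⁺; ∈-filter⁺)
open import Data.List.Relation.Unary.All as All using (All; []; _∷_)
open import Data.List.Relation.Unary.AllPairs using (_∷_)
open import Data.List.Relation.Unary.Any as Any using (here; there)
open import Data.List.Relation.Unary.Unique.Propositional using (Unique)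
open import Data.List.Relation.Unary.Unique.Propositional.Properties using (upTo⁺; filter⁺)
open import Data.Product using (_×_; _,_; ∃; proj₁; proj₂; uncurry)
open import Data.Sum using (_⊎_; inj₁; inj₂; [_,_]′)
open import Function using (_∘_)
open import Function.Bundles using (Equivalence)
open import Level using (Level)
open import Relation.Binary.Definitions using (tri<; tri≈; tri>)
open import Relation.Binary.PropositionalEquality
open import Relation.Nullary using (¬_; Dec; yes; no; does)
open import Relation.Nullary.Decidable using (dec-true; dec-false; _×-dec_)

-- The quotient of the polygon by an automorphism is again a polygon with matched sides, but `τ̄`
-- may match a side with itself and `ρ̄` may fix a corner: it is a one-face map on an orbifold, to
-- which conditions (2) and (3) no longer apply. No Euler characteristic of orbifolds is invoked.
-- The branch points are the fixed points of `τ̄` and `ρ̄`, and all that is said about the quotient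
-- is an inequality or a congruence between m and their numbers. With M = 2g - 1 one has n = 6M, and
-- as d divides 6 every automorphism is a shift by a multiple of M. Hence two bits describe the
-- group: whether the shifts by 3M (order 2) and by 2M (order 3) are automorphisms. That M is odd
-- makes m = 3M odd in the case of order 2. The sums over r, s, t collapse for the following reason.
-- There is one shift of order 2, and the two shifts of order 3 are inverse to each other and fix
-- the same vertices. So a form has at most one value of each parameter, and the work lies in
-- showing that this value meets the conditions under the sum. Both sides of each formula are then
-- additive over forms.

module OneFaceMaps where

  open import Data.Nat
  open import Data.Nat.DivMod
  open import Data.Nat.Divisibility
  open import Data.Nat.Properties
  open import Data.Nat.Tactic.RingSolver using (solve-∀)

  -- Finite sums over `Fin m`.

  module Reindex {c : Level} (M : CommutativeMonoid c c) where
    open CommutativeMonoid M using (Carrier; _≈_)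
    open import Algebra.Properties.CommutativeMonoid.Sum M using (sum; sum-permute)

    sum-reindex : ∀ {m} (f f⁻¹ : Fin m → Fin m) → (∀ x → f (f⁻¹ x) ≡ x) → (∀ x → f⁻¹ (f x) ≡ x) →
                  (F : Fin m → Carrier) → sum F ≈ sum (λ x → F (f x))
    sum-reindex f f⁻¹ ff ff′ F = sum-permute F (permutation f f⁻¹ ff ff′)

  open import Algebra.Properties.CommutativeMonoid.Sum +-0-commutativeMonoid public
    using (sum; sum-cong-≗; ∑-distrib-+; ∑-comm; sum-replicate-zero; sum-permute)
  open Reindex +-0-commutativeMonoid public using (sum-reindex)

  𝟙 : Bool → ℕ
  𝟙 true  = 1
  𝟙 false = 0

  sum-const : ∀ m k → sum {m} (λ _ → k) ≡ m * k
  sum-const zero    k = refl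
  sum-const (suc m) k = cong (k +_) (sum-const m k)

  sum-*ˡ : ∀ {m} k (F : Fin m → ℕ) → sum (λ i → k * F i) ≡ k * sum F
  sum-*ˡ {zero}  k F = sym (*-zeroʳ k)
  sum-*ˡ {suc m} k F = trans (cong (k * F zero +_) (sum-*ˡ k (F ∘ suc))) (sym (*-distribˡ-+ k _ _))

  sum-mono : ∀ {m} {F G : Fin m → ℕ} → (∀ i → F i ≤ G i) → sum F ≤ sum G
  sum-mono {zero}  p = z≤n
  sum-mono {suc m} p = +-mono-≤ (p zero) (sum-mono (p ∘ suc))

  -- Turns a total into a local statement: in the proof that `ρ` has order 3, the number of vertices
  -- makes every termwise inequality sharp.
  sum-tight : ∀ {m} {F G : Fin m → ℕ} → (∀ i → F i ≤ G i) → sum F ≡ sum G → ∀ i → F i ≡ G i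
  sum-tight {suc m} {F} {G} p e zero = ≤-antisym (p zero) (+-cancelʳ-≤ (sum (G ∘ suc)) _ _
    (≤-trans (≤-reflexive (sym e)) (+-monoʳ-≤ (F zero) (sum-mono (p ∘ suc)))))
  sum-tight {suc m} {F} {G} p e (suc i) = sum-tight (p ∘ suc) (≤-antisym (sum-mono (p ∘ suc))
    (+-cancelˡ-≤ (G zero) _ _ (≤-trans (≤-reflexive (sym e)) (+-monoˡ-≤ _ (p zero))))) i

  sum-single : ∀ {m} (a : Fin m) (F : Fin m → ℕ) → (∀ i → i ≢ a → F i ≡ 0) → sum F ≡ F a
  sum-single {suc m} zero F z = trans (cong (F zero +_)
    (trans (sum-cong-≗ (λ i → z (suc i) λ ())) (sum-replicate-zero m))) (+-identityʳ _)
  sum-single {suc m} (suc a) F z = cong₂ _+_ (z zero λ ())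
    (sum-single a (F ∘ suc) (λ i i≢a → z (suc i) (λ { refl → i≢a refl })))

  sum-+ : ∀ a b (H : ℕ → ℕ) → sum {a + b} (H ∘ toℕ) ≡ sum {a} (H ∘ toℕ) + sum {b} (λ i → H (a + toℕ i))
  sum-+ zero    b H = refl
  sum-+ (suc a) b H = trans (cong (H 0 +_) (sum-+ a b (H ∘ suc))) (sym (+-assoc (H 0) _ _))

  sum-periodic : ∀ d m (H : ℕ → ℕ) → (∀ x → H (m + x) ≡ H x) →
                 sum {d * m} (H ∘ toℕ) ≡ d * sum {m} (H ∘ toℕ)
  sum-periodic zero    m H p = refl
  sum-periodic (suc d) m H p = trans (sum-+ m (d * m) H)
    (cong (sum {m} (H ∘ toℕ) +_) (trans (sum-cong-≗ {d * m} (λ i → p (toℕ i))) (sum-periodic d m H p)))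

  <ᵇ-true : ∀ {a b} → a < b → (a <ᵇ b) ≡ true
  <ᵇ-true = dec-true (_ <? _)

  <ᵇ-false : ∀ {a b} → b ≤ a → (a <ᵇ b) ≡ false
  <ᵇ-false b≤a = dec-false (_ <? _) (≤⇒≯ b≤a)

  ≤ᵇ-true : ∀ {a b} → a ≤ b → (a ≤ᵇ b) ≡ true
  ≤ᵇ-true = dec-true (_ ≤? _)

  ≤ᵇ-false : ∀ {a b} → b < a → (a ≤ᵇ b) ≡ false
  ≤ᵇ-false b<a = dec-false (_ ≤? _) (<⇒≱ b<a)

  -- Arithmetic of the shifts of ℤ/n.

  [m%n+o]%n≡[m+o]%n : ∀ m o n .{{_ : NonZero n}} → (m % n + o) % n ≡ (m + o) % n
  [m%n+o]%n≡[m+o]%n m o n = begin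
    (m % n + o) % n           ≡⟨ %-distribˡ-+ (m % n) o n ⟩
    (m % n % n + o % n) % n   ≡⟨ cong (λ z → (z + o % n) % n) (m%n%n≡m%n m n) ⟩
    (m % n + o % n) % n       ≡⟨ %-distribˡ-+ m o n ⟨
    (m + o) % n               ∎
    where open ≡-Reasoning

  toℕ-mod : ∀ a m .{{_ : NonZero m}} → toℕ (a mod m) ≡ a % m
  toℕ-mod a m = toℕ-fromℕ< (m%n<n a m)

  toℕ-% : ∀ {n} .{{_ : NonZero n}} (x : Fin n) → toℕ x % n ≡ toℕ x
  toℕ-% x = m<n⇒m%n≡m (toℕ<n x)

  module _ {n : ℕ} .{{_ : NonZero n}} where

    toℕ-shift : ∀ k (x : Fin n) → toℕ (shift k x) ≡ (toℕ x + k) % n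
    toℕ-shift = go n
      where
      go : ∀ n .{{_ : NonZero n}} k (x : Fin n) → toℕ (shift k x) ≡ (toℕ x + k) % n
      go (suc m) k x = toℕ-mod (toℕ x + k) (suc m)

    shift-∘ : ∀ a b (x : Fin n) → shift a (shift b x) ≡ shift (a + b) x
    shift-∘ a b x = toℕ-injective (begin
      toℕ (shift a (shift b x))      ≡⟨ toℕ-shift a _ ⟩
      (toℕ (shift b x) + a) % n      ≡⟨ cong (λ z → (z + a) % n) (toℕ-shift b x) ⟩
      ((toℕ x + b) % n + a) % n      ≡⟨ [m%n+o]%n≡[m+o]%n (toℕ x + b) a n ⟩
      (toℕ x + b + a) % n            ≡⟨ cong (_% n) (trans (+-assoc (toℕ x) b a) (cong (toℕ x +_) (+-comm b a))) ⟩
      (toℕ x + (a + b)) % n          ≡⟨ toℕ-shift (a + b) x ⟨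
      toℕ (shift (a + b) x)          ∎)
      where open ≡-Reasoning

    shift-comm : ∀ a b (x : Fin n) → shift a (shift b x) ≡ shift b (shift a x)
    shift-comm a b x = trans (shift-∘ a b x) (trans (cong (λ z → shift z x) (+-comm a b)) (sym (shift-∘ b a x)))

    shift-multiple : ∀ {a} → n ∣ a → (x : Fin n) → shift a x ≡ x
    shift-multiple n∣a x = toℕ-injective (trans (toℕ-shift _ x) (trans (%-remove-+ʳ (toℕ x) n∣a) (toℕ-% x)))

    shift-0 : (x : Fin n) → shift 0 x ≡ x
    shift-0 = shift-multiple (n ∣0)

    shift-fixed : ∀ {a} (x : Fin n) → shift a x ≡ x → n ∣ a
    shift-fixed {a} x e = divides ((toℕ x + a) / n) (+-cancelˡ-≡ (toℕ x) _ _ (begin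
      toℕ x + a                                  ≡⟨ m≡m%n+[m/n]*n (toℕ x + a) n ⟩
      (toℕ x + a) % n + (toℕ x + a) / n * n      ≡⟨ cong (_+ (toℕ x + a) / n * n) (trans (sym (toℕ-shift a x)) (cong toℕ e)) ⟩
      toℕ x + (toℕ x + a) / n * n                ∎))
      where open ≡-Reasoning

    prev-shift : (x : Fin n) → prev x ≡ shift (pred n) x
    prev-shift = go n
      where
      go : ∀ n .{{_ : NonZero n}} (x : Fin n) → prev x ≡ shift (pred n) x
      go (suc m) x = refl

    prev-next : (x : Fin n) → prev (next x) ≡ x
    prev-next x = trans (prev-shift _) (trans (shift-∘ (pred n) 1 x)
      (shift-multiple (∣-reflexive (sym (trans (+-comm (pred n) 1) (suc-pred n)))) x))

    next-prev : (x : Fin n) → next (prev x) ≡ x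
    next-prev x = trans (cong next (prev-shift x)) (trans (shift-∘ 1 (pred n) x)
      (shift-multiple (∣-reflexive (sym (suc-pred n))) x))

    shift-prev : ∀ k (x : Fin n) → shift k (prev x) ≡ prev (shift k x)
    shift-prev k x = trans (cong (shift k) (prev-shift x)) (trans (shift-comm k (pred n) x) (sym (prev-shift _)))

    toℕ-prev : (x : Fin n) → toℕ x ≢ 0 → suc (toℕ (prev x)) ≡ toℕ x
    toℕ-prev x x≢0 = trans (cong suc eq) (suc-pred (toℕ x) {{≢-nonZero x≢0}})
      where
      eq : toℕ (prev x) ≡ pred (toℕ x)
      eq = begin
        toℕ (prev x)               ≡⟨ trans (cong toℕ (prev-shift x)) (toℕ-shift (pred n) x) ⟩
        (toℕ x + pred n) % n       ≡⟨ cong (λ z → (z + pred n) % n) (suc-pred (toℕ x) {{≢-nonZero x≢0}}) ⟨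
        suc (pred (toℕ x) + pred n) % n ≡⟨ cong (_% n) (+-suc (pred (toℕ x)) (pred n)) ⟨
        (pred (toℕ x) + suc (pred n)) % n ≡⟨ cong (λ z → (pred (toℕ x) + z) % n) (suc-pred n) ⟩
        (pred (toℕ x) + n) % n     ≡⟨ [m+n]%n≡m%n (pred (toℕ x)) n ⟩
        pred (toℕ x) % n           ≡⟨ m<n⇒m%n≡m (≤-<-trans pred[n]≤n (toℕ<n x)) ⟩
        pred (toℕ x)               ∎
        where open ≡-Reasoning

    -- Shifting by a is subtracting b modulo n, and b ≤ x means that the subtraction does not wrap.
    -- It forces the least point of an orbit of such shifts to be less than b.
    shift-wraps : ∀ {a b} (x : Fin n) → n ≡ b + a → 0 < b → b ≤ toℕ x → toℕ (shift a x) < toℕ x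
    shift-wraps {a} {b} x n≡ 0<b b≤x = subst (_< toℕ x) (sym eq) decreases
      where
      decreases : toℕ x ∸ b < toℕ x
      decreases = subst (toℕ x ∸ b <_) (m∸n+n≡m b≤x) (m<m+n (toℕ x ∸ b) 0<b)
      eq : toℕ (shift a x) ≡ toℕ x ∸ b
      eq = begin
        toℕ (shift a x)              ≡⟨ toℕ-shift a x ⟩
        (toℕ x + a) % n              ≡⟨ cong (λ z → (z + a) % n) (m∸n+n≡m b≤x) ⟨
        (toℕ x ∸ b + b + a) % n      ≡⟨ cong (_% n) (trans (+-assoc (toℕ x ∸ b) b a) (cong (toℕ x ∸ b +_) (sym n≡))) ⟩
        (toℕ x ∸ b + n) % n          ≡⟨ [m+n]%n≡m%n (toℕ x ∸ b) n ⟩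
        (toℕ x ∸ b) % n              ≡⟨ m<n⇒m%n≡m (<-trans decreases (toℕ<n x)) ⟩
        toℕ x ∸ b                    ∎
        where open ≡-Reasoning

  -- The projection of ℤ/n onto ℤ/m and the induced maps.

  module Quotient {n : ℕ} (m d : ℕ) .{{_ : NonZero n}} .{{_ : NonZero m}} (n≡dm : n ≡ d * m) where

    m∣n : m ∣ n
    m∣n = divides d n≡dm

    q : Fin n → Fin m
    q x = toℕ x mod m

    emb : Fin m → Fin n
    emb i = inject≤ i (∣⇒≤ m∣n)

    q-emb : ∀ i → q (emb i) ≡ i
    q-emb i = toℕ-injective (trans (toℕ-mod _ m) (trans (cong (_% m) (toℕ-inject≤ i _)) (toℕ-% i)))

    q-shift : ∀ k x → q (shift k x) ≡ shift k (q x)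
    q-shift k x = toℕ-injective (begin
      toℕ (q (shift k x))         ≡⟨ trans (toℕ-mod _ m) (cong (_% m) (toℕ-shift k x)) ⟩
      (toℕ x + k) % n % m         ≡⟨ m∣n⇒o%n%m≡o%m m n _ m∣n ⟩
      (toℕ x + k) % m             ≡⟨ [m%n+o]%n≡[m+o]%n (toℕ x) k m ⟨
      (toℕ x % m + k) % m         ≡⟨ cong (λ z → (z + k) % m) (toℕ-mod (toℕ x) m) ⟨
      (toℕ (q x) + k) % m         ≡⟨ toℕ-shift k (q x) ⟨
      toℕ (shift k (q x))         ∎)
      where open ≡-Reasoning

    q-shift-multiple : ∀ j x → q (shift (j * m) x) ≡ q x
    q-shift-multiple j x = trans (q-shift (j * m) x) (shift-multiple (n∣m*n j) (q x))

    private
      -- Both shifts subtract 1 in ℤ/m. Inserting the identity `shift m`, written as `pred m + 1`,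
      -- completes `pred n` to a multiple of m and leaves `pred m`.
      m∣sum : m ∣ suc (pred n) → suc (pred m) ≡ m → ∀ y → shift {m} (pred n) y ≡ shift (pred m) y
      m∣sum m∣ sm y = begin
        shift (pred n) y                              ≡⟨ shift-multiple ∣-refl _ ⟨
        shift m (shift (pred n) y)                    ≡⟨ cong (λ z → shift z (shift (pred n) y)) (trans (+-comm (pred m) 1) sm) ⟨
        shift (pred m + 1) (shift (pred n) y)         ≡⟨ shift-∘ (pred m + 1) (pred n) y ⟩
        shift (pred m + 1 + pred n) y                 ≡⟨ cong (λ z → shift z y) (+-assoc (pred m) 1 (pred n)) ⟩
        shift (pred m + suc (pred n)) y               ≡⟨ shift-∘ (pred m) (suc (pred n)) y ⟨
        shift (pred m) (shift (suc (pred n)) y)       ≡⟨ cong (shift (pred m)) (shift-multiple m∣ y) ⟩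
        shift (pred m) y                              ∎
        where open ≡-Reasoning

    q-prev : ∀ x → q (prev x) ≡ prev (q x)
    q-prev x = trans (cong q (prev-shift x)) (trans (q-shift (pred n) x)
      (trans (m∣sum (subst (m ∣_) (sym (suc-pred n)) m∣n) (suc-pred m) (q x)) (sym (prev-shift (q x)))))

    abstract
      fibre : ∀ {x y} → q x ≡ q y → ∃ λ j → j < d × y ≡ shift (j * m) x
      fibre {x} {y} e = j % d , m%n<n j d , trans (sym y≡) (toℕ-injective (begin
          toℕ (shift (j * m) x)                        ≡⟨ toℕ-shift (j * m) x ⟩
          (toℕ x + j * m) % n                          ≡⟨ cong (λ z → (toℕ x + z * m) % n) (m≡m%n+[m/n]*n j d) ⟩
          (toℕ x + (j % d + j / d * d) * m) % n        ≡⟨ cong (_% n) (lem (toℕ x) (j % d) (j / d) d m) ⟩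
          (toℕ x + j % d * m + j / d * (d * m)) % n    ≡⟨ cong (λ z → (toℕ x + j % d * m + j / d * z) % n) n≡dm ⟨
          (toℕ x + j % d * m + j / d * n) % n          ≡⟨ [m+kn]%n≡m%n _ (j / d) n ⟩
          (toℕ x + j % d * m) % n                      ≡⟨ toℕ-shift (j % d * m) x ⟨
          toℕ (shift (j % d * m) x)                    ∎))
        where
        open ≡-Reasoning
        instance
          nz : NonZero d
          nz = ≢-nonZero (λ { refl → ≢-nonZero⁻¹ n n≡dm })
        lem : ∀ a b c d m → a + (b + c * d) * m ≡ a + b * m + c * (d * m)
        lem = solve-∀
        b c j : ℕ
        b = toℕ x / m
        c = toℕ y / m
        -- The difference c - b of the two block numbers, raised by d to stay a natural number; it
        -- is reduced modulo d at the end.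
        j = c + (d ∸ b)
        b≤d : b ≤ d
        b≤d = <⇒≤ (m<n*o⇒m/o<n (subst (toℕ x <_) n≡dm (toℕ<n x)))
        lem₂ : ∀ a b c d m → a + b * m + (c + d) * m ≡ a + c * m + (b + d) * m
        lem₂ = solve-∀
        y≡ : shift (j * m) x ≡ y
        y≡ = toℕ-injective (begin
          toℕ (shift (j * m) x)                        ≡⟨ toℕ-shift (j * m) x ⟩
          (toℕ x + j * m) % n                          ≡⟨ cong (λ z → (z + j * m) % n) (m≡m%n+[m/n]*n (toℕ x) m) ⟩
          (toℕ x % m + b * m + j * m) % n              ≡⟨ cong (_% n) (lem₂ (toℕ x % m) b c (d ∸ b) m) ⟩
          (toℕ x % m + c * m + (b + (d ∸ b)) * m) % n  ≡⟨ cong (λ z → (toℕ x % m + c * m + z * m) % n) (m+[n∸m]≡n b≤d) ⟩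
          (toℕ x % m + c * m + d * m) % n              ≡⟨ cong₂ (λ u v → (u + c * m + v) % n)
                                                           (trans (sym (toℕ-mod _ m)) (trans (cong toℕ e) (toℕ-mod _ m))) (sym n≡dm) ⟩
          (toℕ y % m + c * m + n) % n                  ≡⟨ cong (λ z → (z + n) % n) (m≡m%n+[m/n]*n (toℕ y) m) ⟨
          (toℕ y + n) % n                              ≡⟨ [m+n]%n≡m%n (toℕ y) n ⟩
          toℕ y % n                                    ≡⟨ toℕ-% y ⟩
          toℕ y                                        ∎)

    sum-quotient : (G : Fin m → ℕ) → sum (λ x → G (q x)) ≡ d * sum G
    sum-quotient G = trans (go n n≡dm) (cong (d *_) (sum-cong-≗ (λ i → cong G
        (toℕ-injective (trans (toℕ-mod (toℕ i) m) (toℕ-% i))))))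
      where
      go : ∀ n → n ≡ d * m → sum {n} (λ x → G (toℕ x mod m)) ≡ d * sum {m} (λ i → G (toℕ i mod m))
      go _ refl = sum-periodic d m (λ x → G (x mod m)) (λ x → cong G (toℕ-injective
        (trans (toℕ-mod (m + x) m) (trans (%-remove-+ˡ x ∣-refl) (sym (toℕ-mod x m))))))

    module Induced (π : Fin n → Fin n) (π-shift : ∀ x → π (shift m x) ≡ shift m (π x)) where

      π-shift* : ∀ j x → π (shift (j * m) x) ≡ shift (j * m) (π x)
      π-shift* zero    x = trans (cong π (shift-0 x)) (sym (shift-0 (π x)))
      π-shift* (suc j) x = begin
        π (shift (m + j * m) x)          ≡⟨ cong π (shift-∘ m (j * m) x) ⟨
        π (shift m (shift (j * m) x))    ≡⟨ π-shift _ ⟩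
        shift m (π (shift (j * m) x))    ≡⟨ cong (shift m) (π-shift* j x) ⟩
        shift m (shift (j * m) (π x))    ≡⟨ shift-∘ m (j * m) (π x) ⟩
        shift (m + j * m) (π x)          ∎
        where open ≡-Reasoning

      π̄ : Fin m → Fin m
      π̄ i = q (π (emb i))

      -- The chosen representative differs from x by a multiple of m, and π commutes with shifts by
      -- such multiples.
      π̄-q : ∀ x → π̄ (q x) ≡ q (π x)
      π̄-q x with fibre {x} {emb (q x)} (sym (q-emb (q x)))
      ... | j , _ , e = trans (cong (q ∘ π) e) (trans (cong q (π-shift* j x)) (q-shift-multiple j (π x)))

  -- Orbits of a permutation whose cube is the identity.

  module Reps {m : ℕ} (ρ : Fin m → Fin m) (ρ³ : ∀ x → ρ (ρ (ρ x)) ≡ x) where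

    fix : Fin m → Bool
    fix x = does (ρ x Fin.≟ x)

    rep : Fin m → Bool
    rep x = (toℕ x ≤ᵇ toℕ (ρ x)) ∧ (toℕ x ≤ᵇ toℕ (ρ (ρ x)))

    sum-ρ : (F : Fin m → ℕ) → sum F ≡ sum (λ x → F (ρ x))
    sum-ρ = sum-reindex ρ (ρ ∘ ρ) ρ³ ρ³

    private
      least : ∀ a b c → a ≢ b → b ≢ c → a ≢ c →
              𝟙 ((a ≤ᵇ b) ∧ (a ≤ᵇ c)) + (𝟙 ((b ≤ᵇ c) ∧ (b ≤ᵇ a)) + 𝟙 ((c ≤ᵇ a) ∧ (c ≤ᵇ b))) ≡ 1
      least a b c a≢b b≢c a≢c with <-cmp a b | <-cmp b c | <-cmp a c
      ... | tri≈ _ e _ | _ | _ = ⊥-elim (a≢b e)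
      ... | tri< _ _ _ | tri≈ _ e _ | _ = ⊥-elim (b≢c e)
      ... | tri> _ _ _ | tri≈ _ e _ | _ = ⊥-elim (b≢c e)
      ... | tri< _ _ _ | tri< _ _ _ | tri≈ _ e _ = ⊥-elim (a≢c e)
      ... | tri< _ _ _ | tri> _ _ _ | tri≈ _ e _ = ⊥-elim (a≢c e)
      ... | tri> _ _ _ | tri< _ _ _ | tri≈ _ e _ = ⊥-elim (a≢c e)
      ... | tri> _ _ _ | tri> _ _ _ | tri≈ _ e _ = ⊥-elim (a≢c e)
      ... | tri< p _ _ | tri< r _ _ | tri> _ _ s = ⊥-elim (<-asym (<-trans p r) s)
      ... | tri> _ _ p | tri> _ _ r | tri< s _ _ = ⊥-elim (<-asym (<-trans r p) s)
      ... | tri< p _ _ | tri< r _ _ | tri< s _ _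
        rewrite ≤ᵇ-true (<⇒≤ p) | ≤ᵇ-true (<⇒≤ s) | ≤ᵇ-true (<⇒≤ r) | ≤ᵇ-false p | ≤ᵇ-false s = refl
      ... | tri< p _ _ | tri> _ _ r | tri< s _ _
        rewrite ≤ᵇ-true (<⇒≤ p) | ≤ᵇ-true (<⇒≤ s) | ≤ᵇ-false r | ≤ᵇ-false s = refl
      ... | tri< p _ _ | tri> _ _ r | tri> _ _ s
        rewrite ≤ᵇ-true (<⇒≤ p) | ≤ᵇ-false s | ≤ᵇ-false r | ≤ᵇ-true (<⇒≤ s) | ≤ᵇ-true (<⇒≤ r) = refl
      ... | tri> _ _ p | tri< r _ _ | tri< s _ _
        rewrite ≤ᵇ-false p | ≤ᵇ-true (<⇒≤ r) | ≤ᵇ-true (<⇒≤ p) | ≤ᵇ-false s = refl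
      ... | tri> _ _ p | tri< r _ _ | tri> _ _ s
        rewrite ≤ᵇ-false p | ≤ᵇ-true (<⇒≤ r) | ≤ᵇ-true (<⇒≤ p) | ≤ᵇ-true (<⇒≤ s) | ≤ᵇ-false r = refl
      ... | tri> _ _ p | tri> _ _ r | tri> _ _ s
        rewrite ≤ᵇ-false p | ≤ᵇ-false r | ≤ᵇ-true (<⇒≤ s) | ≤ᵇ-true (<⇒≤ r) = refl

    rep-nonfixed : ∀ x → ρ x ≢ x → 𝟙 (rep x) + (𝟙 (rep (ρ x)) + 𝟙 (rep (ρ (ρ x)))) ≡ 1
    rep-nonfixed x ρx≢x rewrite ρ³ x = least (toℕ x) (toℕ (ρ x)) (toℕ (ρ (ρ x)))
      (λ e → ρx≢x (sym (toℕ-injective e)))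
      (λ e → ρx≢x (trans (sym (ρ³ (ρ x))) (trans (cong (ρ ∘ ρ) (sym (toℕ-injective e))) (ρ³ x))))
      (λ e → ρx≢x (trans (cong ρ (toℕ-injective e)) (ρ³ x)))

    rep-fixed : ∀ x → ρ x ≡ x → rep x ≡ true
    rep-fixed x e rewrite e | e | ≤ᵇ-true (≤-refl {toℕ x}) = refl

    rep-sum : ∀ x → 𝟙 (rep x) + (𝟙 (rep (ρ x)) + 𝟙 (rep (ρ (ρ x)))) ≡ 1 + 2 * 𝟙 (fix x)
    rep-sum x with ρ x Fin.≟ x
    ... | no ≢x = rep-nonfixed x ≢x
    ... | yes e = cong₂ (λ a b → 𝟙 a + b) (rep-fixed x e)
      (cong₂ (λ a b → 𝟙 a + 𝟙 b) (rep-fixed (ρ x) (cong ρ e)) (rep-fixed (ρ (ρ x)) (cong (ρ ∘ ρ) e)))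

    -- Burnside's count for a group of order 3: a 3-cycle has one representative among three points,
    -- while a fixed point represents itself. In a quotient, `rep` thus counts the vertices,
    -- branched ones included.
    rep-total : 3 * sum (𝟙 ∘ rep) ≡ m + 2 * sum (𝟙 ∘ fix)
    rep-total = begin
      3 * s                                                                  ≡⟨ lem s ⟩
      s + (s + s)                                                            ≡⟨ cong (s +_) (cong₂ _+_ (sum-ρ _) (trans (sum-ρ _) (sum-ρ _))) ⟩
      s + (sum (𝟙 ∘ rep ∘ ρ) + sum (𝟙 ∘ rep ∘ ρ ∘ ρ))                        ≡⟨ cong (s +_) (∑-distrib-+ (𝟙 ∘ rep ∘ ρ) (𝟙 ∘ rep ∘ ρ ∘ ρ)) ⟨
      s + sum (λ x → 𝟙 (rep (ρ x)) + 𝟙 (rep (ρ (ρ x))))                      ≡⟨ ∑-distrib-+ (𝟙 ∘ rep) _ ⟨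
      sum (λ x → 𝟙 (rep x) + (𝟙 (rep (ρ x)) + 𝟙 (rep (ρ (ρ x)))))            ≡⟨ sum-cong-≗ rep-sum ⟩
      sum {m} (λ x → 1 + 2 * 𝟙 (fix x))                                      ≡⟨ ∑-distrib-+ (λ _ → 1) (λ x → 2 * 𝟙 (fix x)) ⟩
      sum {m} (λ _ → 1) + sum (λ x → 2 * 𝟙 (fix x))                          ≡⟨ cong₂ _+_ (trans (sum-const m 1) (*-identityʳ m)) (sum-*ˡ 2 (𝟙 ∘ fix)) ⟩
      m + 2 * sum (𝟙 ∘ fix)                                                  ∎
      where
      open ≡-Reasoning
      s = sum (𝟙 ∘ rep)
      lem : ∀ s → 3 * s ≡ s + (s + s)
      lem = solve-∀

  -- The genus bound for a one-face map.

  module OneFace {m : ℕ} .{{_ : NonZero m}} (τ ρ : Fin m → Fin m)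
    (τ² : ∀ x → τ (τ x) ≡ x) (ρ³ : ∀ x → ρ (ρ (ρ x)) ≡ x) (ρ≡ : ∀ x → ρ x ≡ prev (τ x)) where

    open Reps ρ ρ³

    τ-fix : Fin m → Bool
    τ-fix x = does (τ x Fin.≟ x)

    private
      o : Fin m
      o = Fin.fromℕ< (>-nonZero⁻¹ m)

      -- Corner 0 is set aside because `prev` wraps around there, so that no earlier corner exists
      -- to compare with.
      rep⁺ : Fin m → Bool
      rep⁺ x = rep x ∧ not (does (x Fin.≟ o))

      rep≤ : ∀ x → rep x ≡ true → toℕ x ≤ toℕ (ρ x) × toℕ x ≤ toℕ (ρ (ρ x))
      rep≤ x e with toℕ x ≤? toℕ (ρ x) | toℕ x ≤? toℕ (ρ (ρ x))
      ... | yes p | yes r = p , r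
      ... | no p  | _ with () ← trans (sym e) (cong (_∧ (toℕ x ≤ᵇ toℕ (ρ (ρ x)))) (≤ᵇ-false (≰⇒> p)))
      ... | yes p | no r with () ← trans (sym e) (cong₂ _∧_ (≤ᵇ-true p) (≤ᵇ-false (≰⇒> r)))

      rep⁺≤ : ∀ x → rep⁺ x ≡ true → toℕ x ≢ 0 × toℕ x ≤ toℕ (ρ x) × toℕ x ≤ toℕ (ρ (ρ x))
      rep⁺≤ x e with rep x in r | x Fin.≟ o
      ... | true | no x≢o = (λ z → x≢o (toℕ-injective (trans z (sym (toℕ-fromℕ< _))))) , rep≤ x r

      ρτ : ∀ x → ρ (τ x) ≡ prev x
      ρτ x = trans (ρ≡ (τ x)) (cong prev (τ² x))

      prev< : ∀ x → toℕ x ≢ 0 → toℕ (prev x) < toℕ x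
      prev< x x≢0 = ≤-reflexive (toℕ-prev x x≢0)

      -- Corners x - 1 and τ x lie at the same vertex, so a least corner x ≢ 0 is where
      -- its vertex is first visited, along the edge {x , τ x}: different vertices use different edges.
      disjoint : ∀ x → 𝟙 (rep⁺ x) + (𝟙 (rep⁺ (τ x)) + 𝟙 (τ-fix x)) ≤ 1
      disjoint x with τ x Fin.≟ x
      disjoint x | yes e rewrite e with rep⁺ x in r
      ... | false = ≤-refl
      ... | true with rep⁺≤ x r
      ...   | x≢0 , p , _ = ⊥-elim (<⇒≱ (prev< x x≢0) (subst (λ z → toℕ x ≤ toℕ z) (trans (ρ≡ x) (cong prev e)) p))
      disjoint x | no _ with rep⁺ x in r | rep⁺ (τ x) in r′
      ... | false | false = z≤n
      ... | false | true  = ≤-refl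
      ... | true  | false = ≤-refl
      ... | true  | true with rep⁺≤ x r | rep⁺≤ (τ x) r′
      ...   | x≢0 , p , _ | τx≢0 , p′ , _ = ⊥-elim (<-asym
              (≤-<-trans (subst (λ z → toℕ (τ x) ≤ toℕ z) (ρτ x) p′) (prev< x x≢0))
              (≤-<-trans (subst (λ z → toℕ x ≤ toℕ z) (ρ≡ x) p) (prev< (τ x) τx≢0)))

      rep⁺-total : sum (𝟙 ∘ rep) ≤ sum (𝟙 ∘ rep⁺) + 1
      rep⁺-total = begin
        sum (𝟙 ∘ rep)                                                   ≤⟨ sum-mono split ⟩
        sum (λ x → 𝟙 (rep⁺ x) + 𝟙 (does (x Fin.≟ o)))                   ≡⟨ ∑-distrib-+ (𝟙 ∘ rep⁺) _ ⟩
        sum (𝟙 ∘ rep⁺) + sum (λ x → 𝟙 (does (x Fin.≟ o)))               ≡⟨ cong (sum (𝟙 ∘ rep⁺) +_) (sum-single o _ (λ i i≢o → cong 𝟙 (dec-false (i Fin.≟ o) i≢o))) ⟩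
        sum (𝟙 ∘ rep⁺) + 𝟙 (does (o Fin.≟ o))                           ≡⟨ cong (λ z → sum (𝟙 ∘ rep⁺) + 𝟙 z) (dec-true (o Fin.≟ o) refl) ⟩
        sum (𝟙 ∘ rep⁺) + 1                                              ∎
        where
        open ≤-Reasoning
        split : ∀ x → 𝟙 (rep x) ≤ 𝟙 (rep⁺ x) + 𝟙 (does (x Fin.≟ o))
        split x with rep x | does (x Fin.≟ o)
        ... | false | _     = z≤n
        ... | true  | false = ≤-refl
        ... | true  | true  = ≤-refl

      edges-bound : 2 * sum (𝟙 ∘ rep⁺) + sum (𝟙 ∘ τ-fix) ≤ m
      edges-bound = begin
        2 * s + t                                                           ≡⟨ lem s t ⟩
        s + (s + t)                                                         ≡⟨ cong (λ z → s + (z + t)) (sum-reindex τ τ τ² τ² (𝟙 ∘ rep⁺)) ⟩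
        s + (sum (𝟙 ∘ rep⁺ ∘ τ) + t)                                        ≡⟨ cong (s +_) (∑-distrib-+ (𝟙 ∘ rep⁺ ∘ τ) (𝟙 ∘ τ-fix)) ⟨
        s + sum (λ x → 𝟙 (rep⁺ (τ x)) + 𝟙 (τ-fix x))                        ≡⟨ ∑-distrib-+ (𝟙 ∘ rep⁺) _ ⟨
        sum (λ x → 𝟙 (rep⁺ x) + (𝟙 (rep⁺ (τ x)) + 𝟙 (τ-fix x)))             ≤⟨ sum-mono disjoint ⟩
        sum {m} (λ _ → 1)                                                   ≡⟨ trans (sum-const m 1) (*-identityʳ m) ⟩
        m                                                                   ∎
        where
        open ≤-Reasoning
        s = sum (𝟙 ∘ rep⁺)
        t = sum (𝟙 ∘ τ-fix)
        lem : ∀ s t → 2 * s + t ≡ s + (s + t)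
        lem = solve-∀

    -- Let f and t be the two numbers of fixed points. There are (m + 2f)/3 vertices and (m - t)/2
    -- edges with two distinct letters. Each vertex except that of corner 0 owns one of these edges,
    -- so (m + 2f)/3 - 1 ≤ (m - t)/2; this is the bound after multiplication by 6.
    genus-bound : 4 * sum (𝟙 ∘ fix) + 3 * sum (𝟙 ∘ τ-fix) ≤ m + 6
    genus-bound = +-cancelˡ-≤ (2 * m) _ _ (begin
      2 * m + (4 * f + 3 * t)             ≡⟨ lem₁ m f t ⟩
      2 * (m + 2 * f) + 3 * t             ≡⟨ cong (λ z → 2 * z + 3 * t) rep-total ⟨
      2 * (3 * r) + 3 * t                 ≤⟨ +-monoˡ-≤ (3 * t) (*-monoʳ-≤ 2 (*-monoʳ-≤ 3 rep⁺-total)) ⟩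
      2 * (3 * (r⁺ + 1)) + 3 * t          ≡⟨ lem₂ r⁺ t ⟩
      3 * (2 * r⁺ + t) + 6                ≤⟨ +-monoˡ-≤ 6 (*-monoʳ-≤ 3 edges-bound) ⟩
      3 * m + 6                           ≡⟨ lem₃ m ⟩
      2 * m + (m + 6)                     ∎)
      where
      open ≤-Reasoning
      f = sum (𝟙 ∘ fix)
      t = sum (𝟙 ∘ τ-fix)
      r = sum (𝟙 ∘ rep)
      r⁺ = sum (𝟙 ∘ rep⁺)
      lem₁ : ∀ m f t → 2 * m + (4 * f + 3 * t) ≡ 2 * (m + 2 * f) + 3 * t
      lem₁ = solve-∀
      lem₂ : ∀ r t → 2 * (3 * (r + 1)) + 3 * t ≡ 3 * (2 * r + t) + 6
      lem₂ = solve-∀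
      lem₃ : ∀ m → 3 * m + 6 ≡ 2 * m + (m + 6)
      lem₃ = solve-∀

  -- Inversions and the parity of permutations.

  module Parity {m : ℕ} where

    private
      lt : Fin m → Fin m → Bool
      lt i j = toℕ i <ᵇ toℕ j

    -- The exclusive or makes this symmetric in i and j for an injective π. It can then be summed
    -- over all pairs, where a permutation may reindex freely, as well as over i < j by `half`.
    disordered : (Fin m → Fin m) → Fin m → Fin m → ℕ
    disordered π i j = 𝟙 (lt i j xor lt (π i) (π j))

    half : (Fin m → Fin m → ℕ) → ℕ
    half S = sum (λ i → sum (λ j → 𝟙 (lt i j) * S i j))

    inversions : (Fin m → Fin m) → ℕ
    inversions π = half (disordered π)

    sum₂-cong : {S S′ : Fin m → Fin m → ℕ} → (∀ i j → S i j ≡ S′ i j) →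
                sum (λ i → sum (S i)) ≡ sum (λ i → sum (S′ i))
    sum₂-cong e = sum-cong-≗ (λ i → sum-cong-≗ (e i))

    sum₂-+ : (S S′ : Fin m → Fin m → ℕ) →
             sum (λ i → sum (λ j → S i j + S′ i j)) ≡ sum (λ i → sum (S i)) + sum (λ i → sum (S′ i))
    sum₂-+ S S′ = trans (sum-cong-≗ (λ i → ∑-distrib-+ (S i) (S′ i))) (∑-distrib-+ (λ i → sum (S i)) _)

    half-+ : (S S′ : Fin m → Fin m → ℕ) → half (λ i j → S i j + S′ i j) ≡ half S + half S′
    half-+ S S′ = trans (sum₂-cong (λ i j → *-distribˡ-+ (𝟙 (lt i j)) (S i j) (S′ i j))) (sum₂-+ _ _)

    half-double : (S : Fin m → Fin m → ℕ) → (∀ i j → S i j ≡ S j i) → (∀ i → S i i ≡ 0) →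
                  sum (λ i → sum (S i)) ≡ half S + half S
    half-double S S-sym S-diag = begin
      sum (λ i → sum (S i))                                                ≡⟨ sum₂-cong split ⟩
      sum (λ i → sum (λ j → 𝟙 (lt i j) * S i j + 𝟙 (lt j i) * S i j))      ≡⟨ sum₂-+ _ _ ⟩
      half S + sum (λ i → sum (λ j → 𝟙 (lt j i) * S i j))                  ≡⟨ cong (half S +_) (∑-comm (λ i j → 𝟙 (lt j i) * S i j)) ⟩
      half S + sum (λ j → sum (λ i → 𝟙 (lt j i) * S i j))                  ≡⟨ cong (half S +_) (sum₂-cong (λ j i → cong (𝟙 (lt j i) *_) (S-sym i j))) ⟩
      half S + half S                                                      ∎
      where
      open ≡-Reasoning
      split : ∀ i j → S i j ≡ 𝟙 (lt i j) * S i j + 𝟙 (lt j i) * S i j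
      split i j with <-cmp (toℕ i) (toℕ j)
      ... | tri< p _ _ rewrite <ᵇ-true p | <ᵇ-false (<⇒≤ p) = sym (trans (+-identityʳ _) (+-identityʳ _))
      ... | tri> _ _ p rewrite <ᵇ-true p | <ᵇ-false (<⇒≤ p) = sym (+-identityʳ _)
      ... | tri≈ _ e _ with refl ← toℕ-injective e | eq ← S-diag i rewrite eq | *-zeroʳ (𝟙 (lt i i)) = refl

    module _ (π : Fin m → Fin m) (π-inj : ∀ {i j} → π i ≡ π j → i ≡ j) where

      disordered-sym : ∀ i j → disordered π i j ≡ disordered π j i
      disordered-sym i j with <-cmp (toℕ i) (toℕ j) | <-cmp (toℕ (π i)) (toℕ (π j))
      ... | tri< p _ _ | tri< r _ _ rewrite <ᵇ-true p | <ᵇ-false (<⇒≤ p) | <ᵇ-true r | <ᵇ-false (<⇒≤ r) = refl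
      ... | tri< p _ _ | tri> _ _ r rewrite <ᵇ-true p | <ᵇ-false (<⇒≤ p) | <ᵇ-true r | <ᵇ-false (<⇒≤ r) = refl
      ... | tri> _ _ p | tri< r _ _ rewrite <ᵇ-true p | <ᵇ-false (<⇒≤ p) | <ᵇ-true r | <ᵇ-false (<⇒≤ r) = refl
      ... | tri> _ _ p | tri> _ _ r rewrite <ᵇ-true p | <ᵇ-false (<⇒≤ p) | <ᵇ-true r | <ᵇ-false (<⇒≤ r) = refl
      ... | tri≈ _ e _ | _ with refl ← toℕ-injective e = refl
      ... | tri< _ ≢ _ | tri≈ _ e _ = ⊥-elim (≢ (cong toℕ (π-inj (toℕ-injective e))))
      ... | tri> _ ≢ _ | tri≈ _ e _ = ⊥-elim (≢ (cong toℕ (π-inj (toℕ-injective e))))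

      disordered-diag : ∀ i → disordered π i i ≡ 0
      disordered-diag i rewrite <ᵇ-false (≤-refl {toℕ i}) | <ᵇ-false (≤-refl {toℕ (π i)}) = refl

      -- The disorder of π ∘ κ at {i , j} is the exclusive or of the disorders of κ at {i , j}
      -- and of π at {κ i , κ j}.
      inversions-∘ : (κ κ⁻¹ : Fin m → Fin m) → (∀ x → κ (κ⁻¹ x) ≡ x) → (∀ x → κ⁻¹ (κ x) ≡ x) →
                     ∃ λ k → inversions (π ∘ κ) + 2 * k ≡ inversions π + inversions κ
      inversions-∘ κ κ⁻¹ κκ⁻¹ κ⁻¹κ = half common , (begin
        inversions (π ∘ κ) + 2 * half common                 ≡⟨ cong (λ z → inversions (π ∘ κ) + (half common + z)) (+-identityʳ (half common)) ⟩
        inversions (π ∘ κ) + (half common + half common)     ≡⟨ cong (inversions (π ∘ κ) +_) (half-+ common common) ⟨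
        inversions (π ∘ κ) + half (λ i j → common i j + common i j) ≡⟨ half-+ _ _ ⟨
        half (λ i j → disordered (π ∘ κ) i j + (common i j + common i j))
          ≡⟨ sum₂-cong (λ i j → cong (𝟙 (lt i j) *_) (xor-sum (lt i j) (lt (κ i) (κ j)) (lt (π (κ i)) (π (κ j))))) ⟩
        half (λ i j → pulled i j + disordered κ i j)         ≡⟨ half-+ pulled (disordered κ) ⟩
        half pulled + inversions κ                           ≡⟨ cong (_+ inversions κ) pulled≡ ⟩
        inversions π + inversions κ                          ∎)
        where
        open ≡-Reasoning
        -- `common` marks the pairs that κ disorders and π puts back in order: both summands on the
        -- right count them, the composite does not.
        pulled common : Fin m → Fin m → ℕ
        pulled i j = disordered π (κ i) (κ j)
        common i j = 𝟙 ((lt i j xor lt (κ i) (κ j)) ∧ (lt (κ i) (κ j) xor lt (π (κ i)) (π (κ j))))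
        xor-sum : ∀ a b c → 𝟙 (a xor c) + (𝟙 ((a xor b) ∧ (b xor c)) + 𝟙 ((a xor b) ∧ (b xor c))) ≡ 𝟙 (b xor c) + 𝟙 (a xor b)
        xor-sum true  true  true  = refl
        xor-sum true  true  false = refl
        xor-sum true  false true  = refl
        xor-sum true  false false = refl
        xor-sum false true  true  = refl
        xor-sum false true  false = refl
        xor-sum false false true  = refl
        xor-sum false false false = refl
        pulled≡ : half pulled ≡ inversions π
        -- κ does not preserve i < j, so the reindexing takes place in the sum over all ordered
        -- pairs, which is twice the sum over i < j.
        pulled≡ = *-cancelˡ-≡ _ _ 2 (begin
          2 * half pulled                                    ≡⟨ cong (half pulled +_) (+-identityʳ _) ⟩
          half pulled + half pulled                          ≡⟨ half-double pulled (λ i j → disordered-sym (κ i) (κ j)) (disordered-diag ∘ κ) ⟨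
          sum (λ i → sum (λ j → disordered π (κ i) (κ j)))   ≡⟨ sum-cong-≗ (λ i → sum-reindex κ κ⁻¹ κκ⁻¹ κ⁻¹κ (disordered π (κ i))) ⟨
          sum (λ i → sum (disordered π (κ i)))               ≡⟨ sum-reindex κ κ⁻¹ κκ⁻¹ κ⁻¹κ (λ i → sum (disordered π i)) ⟨
          sum (λ i → sum (disordered π i))                   ≡⟨ half-double (disordered π) disordered-sym disordered-diag ⟩
          inversions π + inversions π                        ≡⟨ cong (inversions π +_) (+-identityʳ _) ⟨
          2 * inversions π                                   ∎)

    inversions-cong : {π κ : Fin m → Fin m} → (∀ x → π x ≡ κ x) → inversions π ≡ inversions κ
    inversions-cong e = sum₂-cong (λ i j → cong₂ (λ u v → 𝟙 (lt i j) * 𝟙 (lt i j xor lt u v)) (e i) (e j))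

    inversions-id : inversions (λ x → x) ≡ 0
    inversions-id = trans (sum₂-cong (λ i j → zero-at (lt i j))) (trans (sum-cong-≗ {m} (λ _ → sum-replicate-zero m)) (sum-replicate-zero m))
      where
      zero-at : ∀ b → 𝟙 b * 𝟙 (b xor b) ≡ 0
      zero-at true  = refl
      zero-at false = refl

    -- (i , j) ↦ (τ j , τ i) is an involution on the inversions of τ whose fixed points are i = τ j.
    inversions-involution : (τ : Fin m → Fin m) → (∀ x → τ (τ x) ≡ x) →
      ∃ λ k → inversions τ ≡ 2 * k + sum (λ j → 𝟙 (lt (τ j) j))
    inversions-involution τ τ² = sum (λ i → sum (below i)) , (begin
      inversions τ                                                          ≡⟨ sum₂-cong (λ i j → trans (E-def i j) (split i j)) ⟩
      sum (λ i → sum (λ j → below i j + (above i j + at i j)))              ≡⟨ trans (sum₂-+ below _) (cong (sum (λ i → sum (below i)) +_) (sum₂-+ above at)) ⟩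
      B + (A + sum (λ i → sum (at i)))                                      ≡⟨ cong₂ (λ u v → B + (u + v)) above≡below at≡ ⟩
      B + (B + sum (λ j → 𝟙 (lt (τ j) j)))                                  ≡⟨ +-assoc B B _ ⟨
      B + B + sum (λ j → 𝟙 (lt (τ j) j))                                    ≡⟨ cong (λ z → B + z + sum (λ j → 𝟙 (lt (τ j) j))) (+-identityʳ B) ⟨
      2 * B + sum (λ j → 𝟙 (lt (τ j) j))                                    ∎)
      where
      open ≡-Reasoning
      τ-inj : ∀ {i j} → τ i ≡ τ j → i ≡ j
      τ-inj {i} {j} e = trans (sym (τ² i)) (trans (cong τ e) (τ² j))
      -- `E` marks the inversions of τ. Comparing i with τ j sorts them into three kinds, and the
      -- involution exchanges `below` with `above`.
      E below above at : Fin m → Fin m → ℕ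
      E i j = 𝟙 (lt i j ∧ lt (τ j) (τ i))
      below i j = E i j * 𝟙 (lt i (τ j))
      above i j = E i j * 𝟙 (lt (τ j) i)
      at i j = E i j * 𝟙 (does (i Fin.≟ τ j))
      A = sum (λ i → sum (above i))
      B = sum (λ i → sum (below i))
      E-def : ∀ i j → 𝟙 (lt i j) * disordered τ i j ≡ E i j
      E-def i j with <-cmp (toℕ i) (toℕ j) | <-cmp (toℕ (τ i)) (toℕ (τ j))
      ... | tri< p _ _ | tri< r _ _ rewrite <ᵇ-true p | <ᵇ-true r | <ᵇ-false (<⇒≤ r) = refl
      ... | tri< p _ _ | tri> _ _ r rewrite <ᵇ-true p | <ᵇ-true r | <ᵇ-false (<⇒≤ r) = refl
      ... | tri< _ ≢ _ | tri≈ _ e _ = ⊥-elim (≢ (cong toℕ (τ-inj (toℕ-injective e))))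
      ... | tri≈ _ e _ | _ rewrite <ᵇ-false (≤-reflexive (sym e)) = refl
      ... | tri> _ _ p | _ rewrite <ᵇ-false (<⇒≤ p) = refl
      split : ∀ i j → E i j ≡ below i j + (above i j + at i j)
      split i j = trans (sym (*-identityʳ (E i j))) (trans (cong (E i j *_) (tri i (τ j)))
        (trans (*-distribˡ-+ (E i j) (𝟙 (lt i (τ j))) _) (cong (below i j +_) (*-distribˡ-+ (E i j) _ _))))
        where
        tri : ∀ x y → 1 ≡ 𝟙 (lt x y) + (𝟙 (lt y x) + 𝟙 (does (x Fin.≟ y)))
        tri x y with <-cmp (toℕ x) (toℕ y)
        ... | tri< p ≢ _ rewrite <ᵇ-true p | <ᵇ-false (<⇒≤ p) | dec-false (x Fin.≟ y) (≢ ∘ cong toℕ) = refl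
        ... | tri> _ ≢ p rewrite <ᵇ-true p | <ᵇ-false (<⇒≤ p) | dec-false (x Fin.≟ y) (≢ ∘ cong toℕ) = refl
        ... | tri≈ _ e _ with refl ← toℕ-injective {i = x} {y} e
                         rewrite <ᵇ-false (≤-refl {toℕ x}) | dec-true (x Fin.≟ x) refl = refl
      above≡below : A ≡ B
      above≡below = begin
        sum (λ i → sum (λ j → above i j))                ≡⟨ sum-reindex τ τ τ² τ² (λ i → sum (above i)) ⟩
        sum (λ i → sum (λ j → above (τ i) j))            ≡⟨ sum-cong-≗ (λ i → sum-reindex τ τ τ² τ² (above (τ i))) ⟩
        sum (λ i → sum (λ j → above (τ i) (τ j)))        ≡⟨ ∑-comm (λ i j → above (τ i) (τ j)) ⟩
        sum (λ j → sum (λ i → above (τ i) (τ j)))        ≡⟨ sum₂-cong flip ⟩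
        sum (λ j → sum (λ i → below j i))                ∎
        where
        ∧-swap : ∀ a b → 𝟙 (a ∧ b) ≡ 𝟙 (b ∧ a)
        ∧-swap true  true  = refl
        ∧-swap true  false = refl
        ∧-swap false true  = refl
        ∧-swap false false = refl
        flip : ∀ j i → above (τ i) (τ j) ≡ below j i
        flip j i rewrite τ² i | τ² j = cong (_* 𝟙 (lt j (τ i))) (∧-swap (lt (τ i) (τ j)) (lt j i))
      at≡ : sum (λ i → sum (at i)) ≡ sum (λ j → 𝟙 (lt (τ j) j))
      at≡ = trans (∑-comm at) (sum-cong-≗ (λ j → trans
        (sum-single (τ j) (λ i → at i j) (λ i i≢ → trans (cong (λ z → E i j * 𝟙 z) (dec-false (i Fin.≟ τ j) i≢)) (*-zeroʳ (E i j))))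
        (diag j)))
        where
        diag : ∀ j → at (τ j) j ≡ 𝟙 (lt (τ j) j)
        diag j rewrite τ² j | dec-true (τ j Fin.≟ τ j) refl with lt (τ j) j
        ... | true  = refl
        ... | false = refl

  ∣m+n∣n⇒∣m : ∀ {i m n} → i ∣ m + n → i ∣ n → i ∣ m
  ∣m+n∣n⇒∣m {i} {m} {n} p = ∣m+n∣m⇒∣n (subst (i ∣_) (+-comm m n) p)

  -- Fixed points of the matching of an odd polygon.

  module OddFace {m : ℕ} .{{_ : NonZero m}} (τ ρ : Fin m → Fin m)
    (τ² : ∀ x → τ (τ x) ≡ x) (ρ³ : ∀ x → ρ (ρ (ρ x)) ≡ x) (ρ≡ : ∀ x → ρ x ≡ prev (τ x))
    (h : ℕ) (m≡ : m ≡ 2 * h + 1) where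

    open OneFace τ ρ τ² ρ³ ρ≡ using (τ-fix)
    open Parity {m}

    private
      2∣2* : ∀ k → 2 ∣ 2 * k
      2∣2* k = m∣m*n k

      -- Inversions add modulo 2 under composition, so `ρ³`, the identity, has the parity of three
      -- times those of ρ.
      even-ρ : 2 ∣ inversions ρ
      even-ρ with inversions-∘ ρ ρ-inj ρ (ρ ∘ ρ) ρ³ ρ³ | inversions-∘ (ρ ∘ ρ) (ρ-inj ∘ ρ-inj) ρ (ρ ∘ ρ) ρ³ ρ³
        where
        ρ-inj : ∀ {i j} → ρ i ≡ ρ j → i ≡ j
        ρ-inj {i} {j} e = trans (sym (ρ³ i)) (trans (cong (ρ ∘ ρ) e) (ρ³ j))
      ... | a , e₁ | b , e₂ = ∣m+n∣m⇒∣n (subst (2 ∣_) eq (2∣2* (a + b))) (2∣2* (inversions ρ))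
        where
        open ≡-Reasoning
        lem : ∀ i a j → i + j + 2 * a ≡ (i + 2 * a) + j
        lem = solve-∀
        lem₂ : ∀ i → i + i + i ≡ 2 * i + i
        lem₂ = solve-∀
        eq : 2 * (a + b) ≡ 2 * inversions ρ + inversions ρ
        eq = begin
          2 * (a + b)                                       ≡⟨ trans (*-distribˡ-+ 2 a b) (+-comm (2 * a) (2 * b)) ⟩
          2 * b + 2 * a                                     ≡⟨ cong (λ z → z + 2 * b + 2 * a) (trans (inversions-cong ρ³) inversions-id) ⟨
          inversions (ρ ∘ ρ ∘ ρ) + 2 * b + 2 * a            ≡⟨ cong (_+ 2 * a) e₂ ⟩
          inversions (ρ ∘ ρ) + inversions ρ + 2 * a         ≡⟨ lem (inversions (ρ ∘ ρ)) a (inversions ρ) ⟩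
          (inversions (ρ ∘ ρ) + 2 * a) + inversions ρ       ≡⟨ cong (_+ inversions ρ) e₁ ⟩
          inversions ρ + inversions ρ + inversions ρ        ≡⟨ lem₂ (inversions ρ) ⟩
          2 * inversions ρ + inversions ρ                   ∎

      next-inj : ∀ {i j : Fin m} → next i ≡ next j → i ≡ j
      next-inj {i} {j} e = trans (sym (prev-next i)) (trans (cong prev e) (prev-next j))

      -- `k * pred m` represents -k modulo m, so this is the inverse that `inversions-∘` asks for.
      unshift : ∀ k (x : Fin m) → shift k (shift (k * pred m) x) ≡ x
      unshift k x = trans (shift-∘ k (k * pred m) x) (shift-multiple
        (divides k (trans (sym (*-suc k (pred m))) (cong (k *_) (suc-pred m)))) x)

      -- Proved for all k in order to reach k = m: there the shift is the identity, and since m is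
      -- odd the parity of `next` itself remains.
      even-shift : ∀ k → 2 ∣ inversions (shift k) + k * inversions next
      even-shift zero    = subst (2 ∣_) (sym (trans (+-identityʳ _) (trans (inversions-cong shift-0) inversions-id))) (2 ∣0)
      even-shift (suc k) with inversions-∘ next next-inj (shift k) (shift (k * pred m)) (unshift k)
                                (λ x → trans (shift-comm (k * pred m) k x) (unshift k x))
      ... | a , e = ∣m+n∣n⇒∣m (subst (2 ∣_) eq (∣m∣n⇒∣m+n (2∣2* (inversions next)) (even-shift k))) (2∣2* a)
        where
        open ≡-Reasoning
        lem : ∀ i s k → 2 * i + (s + k * i) ≡ i + s + (i + k * i)
        lem = solve-∀
        lem₂ : ∀ s a t → s + 2 * a + t ≡ s + t + 2 * a
        lem₂ = solve-∀
        i = inversions next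
        eq : 2 * i + (inversions (shift k) + k * i) ≡ inversions (shift (suc k)) + (i + k * i) + 2 * a
        eq = begin
          2 * i + (inversions (shift k) + k * i)                  ≡⟨ lem i (inversions (shift k)) k ⟩
          i + inversions (shift k) + (i + k * i)                  ≡⟨ cong (_+ (i + k * i)) e ⟨
          inversions (next ∘ shift k) + 2 * a + (i + k * i)       ≡⟨ cong (λ z → z + 2 * a + (i + k * i)) (inversions-cong (shift-∘ 1 k)) ⟩
          inversions (shift (suc k)) + 2 * a + (i + k * i)        ≡⟨ lem₂ (inversions (shift (suc k))) a (i + k * i) ⟩
          inversions (shift (suc k)) + (i + k * i) + 2 * a        ∎

      even-next : 2 ∣ inversions next
      even-next = ∣m+n∣m⇒∣n (subst (2 ∣_) eq (even-shift m)) (2∣2* (h * inversions next))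
        where
        lem : ∀ h i → (2 * h + 1) * i ≡ 2 * (h * i) + i
        lem = solve-∀
        eq : inversions (shift m) + m * inversions next ≡ 2 * (h * inversions next) + inversions next
        eq = trans (cong₂ _+_ (trans (inversions-cong (shift-multiple ∣-refl)) inversions-id)
                              (cong (_* inversions next) m≡)) (lem h (inversions next))

      -- τ is `next` after ρ, a product of two even permutations.
      even-τ : 2 ∣ inversions τ
      even-τ with inversions-∘ next next-inj ρ (ρ ∘ ρ) ρ³ ρ³
      ... | a , e = subst (2 ∣_) (inversions-cong (λ x → trans (cong next (ρ≡ x)) (next-prev (τ x))))
                      (∣m+n∣n⇒∣m (subst (2 ∣_) (sym e) (∣m∣n⇒∣m+n even-next even-ρ)) (2∣2* a))

      descents : ℕ
      descents = sum (λ j → 𝟙 (toℕ (τ j) <ᵇ toℕ j))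

      split : m ≡ 2 * descents + sum (𝟙 ∘ τ-fix)
      split = begin
        m                                                               ≡⟨ trans (sum-const m 1) (*-identityʳ m) ⟨
        sum {m} (λ _ → 1)                                               ≡⟨ sum-cong-≗ tri ⟩
        sum (λ j → (down j + up j) + 𝟙 (τ-fix j))                       ≡⟨ ∑-distrib-+ (λ j → down j + up j) (𝟙 ∘ τ-fix) ⟩
        sum (λ j → down j + up j) + sum (𝟙 ∘ τ-fix)                     ≡⟨ cong (_+ sum (𝟙 ∘ τ-fix)) (∑-distrib-+ down up) ⟩
        (descents + sum up) + sum (𝟙 ∘ τ-fix)                           ≡⟨ cong (λ z → (descents + z) + sum (𝟙 ∘ τ-fix)) up≡ ⟩
        2 * descents + sum (𝟙 ∘ τ-fix)                                  ∎
        where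
        open ≡-Reasoning
        down up : Fin m → ℕ
        down j = 𝟙 (toℕ (τ j) <ᵇ toℕ j)
        up j = 𝟙 (toℕ j <ᵇ toℕ (τ j))
        up≡ : sum up ≡ descents + 0
        up≡ = trans (sum-reindex τ τ τ² τ² up) (trans (sum-cong-≗ (λ j → cong (λ z → 𝟙 (toℕ (τ j) <ᵇ toℕ z)) (τ² j))) (sym (+-identityʳ _)))
        tri : ∀ j → 1 ≡ (down j + up j) + 𝟙 (τ-fix j)
        tri j with <-cmp (toℕ (τ j)) (toℕ j)
        ... | tri< p ≢ _ rewrite <ᵇ-true p | <ᵇ-false (<⇒≤ p) | dec-false (τ j Fin.≟ j) (≢ ∘ cong toℕ) = refl
        ... | tri> _ ≢ p rewrite <ᵇ-true p | <ᵇ-false (<⇒≤ p) | dec-false (τ j Fin.≟ j) (≢ ∘ cong toℕ) = refl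
        ... | tri≈ _ e _ rewrite <ᵇ-false (≤-reflexive e) | <ᵇ-false (≤-reflexive (sym e)) | dec-true (τ j Fin.≟ j) (toℕ-injective e) = refl

    -- By `inversions-involution` the parity of τ is that of `descents`, its number of 2-cycles. So
    -- this number is even, and the 2-cycles together cover a multiple of 4 points.
    fixed-mod-4 : ∃ λ k → m ≡ 4 * k + sum (𝟙 ∘ τ-fix)
    fixed-mod-4 with inversions-involution τ τ²
    ... | a , e with ∣m+n∣m⇒∣n (subst (2 ∣_) e even-τ) (2∣2* a)
    ...   | divides c e′ = c , trans split (cong (_+ sum (𝟙 ∘ τ-fix)) (trans (cong (2 *_) e′) (lem c)))
      where
      lem : ∀ c → 2 * (c * 2) ≡ 4 * c
      lem = solve-∀

module Coverings where

  open import Data.Nat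
  open import Data.Nat.DivMod
  open import Data.Nat.Divisibility
  open import Data.Nat.Properties
  open import Data.Nat.Tactic.RingSolver using (solve-∀)
  open import Data.Nat.GCD using (gcd; gcd-GCD; module Bézout; gcd[m,n]∣m; gcd[m,n]∣n)
  open import Data.Integer as ℤ using (ℤ; +_; 0ℤ; 1ℤ)
  import Data.Integer.Properties as ℤ
  import Data.Integer.Divisibility.Signed as ℤ
  import Data.Integer.Tactic.RingSolver as ℤ
  open OneFaceMaps

  open import Algebra.Properties.CommutativeMonoid.Sum ℤ.+-0-commutativeMonoid using ()
    renaming (sum to sumℤ; sum-cong-≗ to sumℤ-cong; ∑-distrib-+ to sumℤ-+)
  open Reindex ℤ.+-0-commutativeMonoid using () renaming (sum-reindex to sumℤ-reindex)

  -- Integer sums and the displacement homomorphism.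

  sumℤ-+₃ : ∀ {m} (F G H : Fin m → ℤ) →
            sumℤ (λ i → F i ℤ.+ (G i ℤ.+ H i)) ≡ sumℤ F ℤ.+ (sumℤ G ℤ.+ sumℤ H)
  sumℤ-+₃ F G H = trans (sumℤ-+ F (λ i → G i ℤ.+ H i)) (cong (λ z → sumℤ F ℤ.+ z) (sumℤ-+ G H))

  sumℤ-neg : ∀ {m} (F : Fin m → ℤ) → sumℤ (λ i → ℤ.- F i) ≡ ℤ.- sumℤ F
  sumℤ-neg {zero}  F = refl
  sumℤ-neg {suc m} F = trans (cong (λ z → ℤ.- F zero ℤ.+ z) (sumℤ-neg (F ∘ suc))) (sym (ℤ.neg-distrib-+ (F zero) _))

  sumℤ-- : ∀ {m} (F G : Fin m → ℤ) → sumℤ (λ i → F i ℤ.- G i) ≡ sumℤ F ℤ.- sumℤ G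
  sumℤ-- F G = trans (sumℤ-+ F (λ i → ℤ.- G i)) (cong (λ z → sumℤ F ℤ.+ z) (sumℤ-neg G))

  sumℤ-∣ : ∀ {m} {k} (F : Fin m → ℤ) → (∀ i → k ℤ.∣ F i) → k ℤ.∣ sumℤ F
  sumℤ-∣ {zero}  F p = ℤ.divides 0ℤ refl
  sumℤ-∣ {suc m} F p = ℤ.∣m∣n⇒∣m+n (p zero) (sumℤ-∣ (F ∘ suc) (p ∘ suc))

  sumℤ-const : ∀ m k → sumℤ {m} (λ _ → k) ≡ + m ℤ.* k
  sumℤ-const zero    k = sym (ℤ.*-zeroˡ k)
  sumℤ-const (suc m) k = trans (cong (λ z → k ℤ.+ z) (sumℤ-const m k)) (lem (+ m) k)
    where
    lem : ∀ m k → k ℤ.+ m ℤ.* k ≡ (1ℤ ℤ.+ m) ℤ.* k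
    lem = ℤ.solve-∀

  sumℤ-*ˡ : ∀ {m} k (F : Fin m → ℤ) → sumℤ (λ i → k ℤ.* F i) ≡ k ℤ.* sumℤ F
  sumℤ-*ˡ {zero}  k F = sym (ℤ.*-zeroʳ k)
  sumℤ-*ˡ {suc m} k F = trans (cong (λ z → k ℤ.* F zero ℤ.+ z) (sumℤ-*ˡ k (F ∘ suc))) (sym (ℤ.*-distribˡ-+ k _ _))

  sumℤ-+ℕ : ∀ {m} (F : Fin m → ℕ) → sumℤ (λ i → + F i) ≡ + sum F
  sumℤ-+ℕ {zero}  F = refl
  sumℤ-+ℕ {suc m} F = cong (λ z → + F zero ℤ.+ z) (sumℤ-+ℕ (F ∘ suc))

  -- Σ (π i - i) over representatives i of ℤ/m is, modulo n = dm, a homomorphism on the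
  -- permutations of ℤ/n commuting with the shift by m.
  module Displacement {n : ℕ} (m d : ℕ) .{{_ : NonZero n}} .{{_ : NonZero m}} (n≡dm : n ≡ d * m) where

    open Quotient m d n≡dm

    infix 4 _≋_
    -- A record, so that unification can recover a and b; from the bare difference `a ℤ.- b` it
    -- could not.
    record _≋_ (a b : ℤ) : Set where
      constructor congruent
      field n∣a-b : + n ℤ.∣ a ℤ.- b
    open _≋_

    ≋-reflexive : ∀ {a b} → a ≡ b → a ≋ b
    ≋-reflexive {a} refl = congruent (subst (+ n ℤ.∣_) (sym (ℤ.+-inverseʳ a)) (ℤ.divides 0ℤ refl))

    ≋-sym : ∀ {a b} → a ≋ b → b ≋ a
    ≋-sym {a} {b} (congruent p) = congruent (subst (+ n ℤ.∣_) (lem a b) (ℤ.∣m⇒∣-m p))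
      where
      lem : ∀ a b → ℤ.- (a ℤ.- b) ≡ b ℤ.- a
      lem = ℤ.solve-∀

    ≋-trans : ∀ {a b c} → a ≋ b → b ≋ c → a ≋ c
    ≋-trans {a} {b} {c} (congruent p) (congruent r) = congruent (subst (+ n ℤ.∣_) (lem a b c) (ℤ.∣m∣n⇒∣m+n p r))
      where
      lem : ∀ a b c → (a ℤ.- b) ℤ.+ (b ℤ.- c) ≡ a ℤ.- c
      lem = ℤ.solve-∀

    ≋-+ : ∀ {a b c e} → a ≋ b → c ≋ e → a ℤ.+ c ≋ b ℤ.+ e
    ≋-+ {a} {b} {c} {e} (congruent p) (congruent r) = congruent (subst (+ n ℤ.∣_) (lem a b c e) (ℤ.∣m∣n⇒∣m+n p r))
      where
      lem : ∀ a b c e → (a ℤ.- b) ℤ.+ (c ℤ.- e) ≡ (a ℤ.+ c) ℤ.- (b ℤ.+ e)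
      lem = ℤ.solve-∀

    ≋-*ˡ : ∀ k {a b} → a ≋ b → k ℤ.* a ≋ k ℤ.* b
    ≋-*ˡ k {a} {b} (congruent p) = congruent (subst (+ n ℤ.∣_) (lem k a b) (ℤ.∣n⇒∣m*n k p))
      where
      lem : ∀ k a b → k ℤ.* (a ℤ.- b) ≡ k ℤ.* a ℤ.- k ℤ.* b
      lem = ℤ.solve-∀

    ≋-sum : ∀ {k} {F G : Fin k → ℤ} → (∀ i → F i ≋ G i) → sumℤ F ≋ sumℤ G
    ≋-sum {F = F} {G} p = congruent (subst (+ n ℤ.∣_) (sumℤ-- F G) (sumℤ-∣ (λ i → F i ℤ.- G i) (λ i → n∣a-b (p i))))

    ⟦_⟧ : Fin n → ℤ
    ⟦ x ⟧ = + toℕ x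

    shift-≋ : ∀ k x → ⟦ shift k x ⟧ ≋ ⟦ x ⟧ ℤ.+ + k
    shift-≋ k x = ≋-sym (congruent (ℤ.divides (+ ((toℕ x + k) / n)) (begin
      ⟦ x ⟧ ℤ.+ + k ℤ.- ⟦ shift k x ⟧                                          ≡⟨ cong₂ (λ u v → + u ℤ.- + v) (m≡m%n+[m/n]*n (toℕ x + k) n) (toℕ-shift k x) ⟩
      + ((toℕ x + k) % n + (toℕ x + k) / n * n) ℤ.- + ((toℕ x + k) % n)        ≡⟨ cong (λ z → z ℤ.- + ((toℕ x + k) % n)) (cong (λ z → + ((toℕ x + k) % n) ℤ.+ z) (ℤ.pos-* ((toℕ x + k) / n) n)) ⟩
      (+ ((toℕ x + k) % n) ℤ.+ + ((toℕ x + k) / n) ℤ.* + n) ℤ.- + ((toℕ x + k) % n) ≡⟨ lem (+ ((toℕ x + k) % n)) _ ⟩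
      + ((toℕ x + k) / n) ℤ.* + n                                              ∎)))
      where
      open ≡-Reasoning
      lem : ∀ a b → (a ℤ.+ b) ℤ.- a ≡ b
      lem = ℤ.solve-∀

    δ : (Fin n → Fin n) → Fin n → ℤ
    δ π x = ⟦ π x ⟧ ℤ.- ⟦ x ⟧

    -- If π takes i to π̄ i + c m with c depending on i, then modulo n this is m times the sum of
    -- the c. It is the map from the wreath product of ℤ/d with the symmetric group on m points to
    -- ℤ/d that adds up the coordinates.
    T : (Fin n → Fin n) → ℤ
    T π = sumℤ (λ i → δ π (emb i))

    T-cong : {π κ : Fin n → Fin n} → (∀ x → π x ≡ κ x) → T π ≡ T κ
    T-cong e = sumℤ-cong (λ i → cong (λ z → ⟦ z ⟧ ℤ.- ⟦ emb i ⟧) (e (emb i)))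

    T-id : T (λ x → x) ≡ 0ℤ
    T-id = trans (sumℤ-cong (λ i → ℤ.+-inverseʳ ⟦ emb i ⟧)) (trans (sumℤ-const m 0ℤ) (ℤ.*-zeroʳ (+ m)))

    -- Modulo n each of the m representatives moves by -1, including 0, where `prev` wraps around.
    T-prev : T prev ≋ ℤ.- (+ m)
    T-prev = ≋-trans (≋-sum step) (≋-reflexive (trans (sumℤ-const m (ℤ.- 1ℤ)) (lem (+ m))))
      where
      lem : ∀ m → m ℤ.* (ℤ.- 1ℤ) ≡ ℤ.- m
      lem = ℤ.solve-∀
      lem₂ : ∀ a b → ℤ.- (a ℤ.- (b ℤ.+ 1ℤ)) ≡ b ℤ.- a ℤ.- (ℤ.- 1ℤ)
      lem₂ = ℤ.solve-∀
      step : ∀ i → δ prev (emb i) ≋ ℤ.- 1ℤ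
      step i = congruent (subst (+ n ℤ.∣_) (lem₂ ⟦ emb i ⟧ ⟦ prev (emb i) ⟧) (ℤ.∣m⇒∣-m (n∣a-b
        (subst (λ z → ⟦ z ⟧ ≋ ⟦ prev (emb i) ⟧ ℤ.+ 1ℤ) (next-prev (emb i)) (shift-≋ 1 (prev (emb i)))))))

    module Equivariant (π : Fin n → Fin n) (π-shift : ∀ x → π (shift m x) ≡ shift m (π x)) where

      open Induced π π-shift public

      -- Moving x by j m moves π x by j m too, and the two changes cancel in the difference.
      δ-periodic : ∀ {x y} → q x ≡ q y → δ π x ≋ δ π y
      δ-periodic {x} {y} e with fibre {x} {y} e
      ... | j , _ , refl = ≋-sym (congruent (subst (+ n ℤ.∣_)
          (trans (lem ⟦ shift k (π x) ⟧ ⟦ shift k x ⟧ ⟦ x ⟧ ⟦ π x ⟧ (+ k))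
                 (cong (λ z → ⟦ z ⟧ ℤ.- ⟦ shift k x ⟧ ℤ.- δ π x) (sym (π-shift* j x))))
          (ℤ.∣m∣n⇒∣m-n (n∣a-b (shift-≋ k (π x))) (n∣a-b (shift-≋ k x)))))
        where
        k = j * m
        lem : ∀ a b x y k → (a ℤ.- (y ℤ.+ k)) ℤ.- (b ℤ.- (x ℤ.+ k)) ≡ (a ℤ.- b) ℤ.- (y ℤ.- x)
        lem = ℤ.solve-∀

    -- Insert κ i between π (κ i) and i. The point κ i need not be one of the chosen
    -- representatives, but by `δ-periodic` only its class matters, and κ permutes the classes.
    T-∘ : (π κ κ⁻¹ : Fin n → Fin n) → (∀ x → π (shift m x) ≡ shift m (π x)) → (∀ x → κ (shift m x) ≡ shift m (κ x)) →
          (∀ x → κ⁻¹ (shift m x) ≡ shift m (κ⁻¹ x)) → (∀ x → κ (κ⁻¹ x) ≡ x) → (∀ x → κ⁻¹ (κ x) ≡ x) →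
          T (π ∘ κ) ≋ T π ℤ.+ T κ
    T-∘ π κ κ⁻¹ π-s κ-s κ⁻¹-s κκ⁻¹ κ⁻¹κ = ≋-trans
      (≋-reflexive (trans (sumℤ-cong (λ i → lem ⟦ π (κ (emb i)) ⟧ ⟦ κ (emb i) ⟧ ⟦ emb i ⟧)) (sumℤ-+ (λ i → δ π (κ (emb i))) (λ i → δ κ (emb i)))))
      (≋-+ (≋-trans (≋-sum {m} (λ i → P.δ-periodic {κ (emb i)} {emb (K.π̄ i)} (sym (q-emb _)))) (≋-reflexive (sym (sumℤ-reindex K.π̄ K⁻¹.π̄ K̄K̄⁻¹ K̄⁻¹K̄ (δ π ∘ emb))))) (≋-reflexive refl))
      where
      module P = Equivariant π π-s
      module K = Equivariant κ κ-s
      module K⁻¹ = Equivariant κ⁻¹ κ⁻¹-s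
      lem : ∀ a b c → a ℤ.- c ≡ (a ℤ.- b) ℤ.+ (b ℤ.- c)
      lem = ℤ.solve-∀
      K̄K̄⁻¹ : ∀ i → K.π̄ (K⁻¹.π̄ i) ≡ i
      K̄K̄⁻¹ i = trans (K.π̄-q _) (trans (cong q (κκ⁻¹ (emb i))) (q-emb i))
      K̄⁻¹K̄ : ∀ i → K⁻¹.π̄ (K.π̄ i) ≡ i
      K̄⁻¹K̄ i = trans (K⁻¹.π̄-q _) (trans (cong q (κ⁻¹κ (emb i))) (q-emb i))

    module Cubic (τ ρ : Fin n → Fin n) (τ² : ∀ x → τ (τ x) ≡ x) (ρ³ : ∀ x → ρ (ρ (ρ x)) ≡ x)
      (ρ≡ : ∀ x → ρ x ≡ prev (τ x)) (τ-shift : ∀ x → τ (shift m x) ≡ shift m (τ x)) where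

      ρ-shift : ∀ x → ρ (shift m x) ≡ shift m (ρ x)
      ρ-shift x = trans (ρ≡ _) (trans (cong prev (τ-shift x)) (trans (sym (shift-prev m (τ x))) (cong (shift m) (sym (ρ≡ x)))))

      private
        ρ²-shift : ∀ x → ρ (ρ (shift m x)) ≡ shift m (ρ (ρ x))
        ρ²-shift x = trans (cong ρ (ρ-shift x)) (ρ-shift (ρ x))

        2Tτ : + 2 ℤ.* T τ ≋ 0ℤ
        2Tτ = ≋-trans (≋-reflexive (lem (T τ))) (≋-trans (≋-sym (T-∘ τ τ τ τ-shift τ-shift τ-shift τ² τ²))
                (≋-reflexive (trans (T-cong τ²) T-id)))
          where
          lem : ∀ t → + 2 ℤ.* t ≡ t ℤ.+ t
          lem = ℤ.solve-∀

        3Tρ : + 3 ℤ.* T ρ ≋ 0ℤ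
        3Tρ = ≋-trans (≋-reflexive (lem (T ρ))) (≋-trans
                (≋-+ (≋-sym (T-∘ ρ ρ (ρ ∘ ρ) ρ-shift ρ-shift ρ²-shift ρ³ ρ³)) (≋-reflexive refl))
                (≋-trans (≋-sym (T-∘ (ρ ∘ ρ) ρ (ρ ∘ ρ) ρ²-shift ρ-shift ρ²-shift ρ³ ρ³))
                (≋-reflexive (trans (T-cong ρ³) T-id))))
          where
          lem : ∀ t → + 3 ℤ.* t ≡ (t ℤ.+ t) ℤ.+ t
          lem = ℤ.solve-∀

        Tρ : T ρ ≋ ℤ.- (+ m) ℤ.+ T τ
        Tρ = ≋-trans (≋-reflexive (T-cong ρ≡)) (≋-trans
          (T-∘ prev τ τ (λ x → sym (shift-prev m x)) τ-shift τ-shift τ² τ²) (≋-+ T-prev (≋-reflexive refl)))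

      -- From ρ = `prev` after τ one gets T ρ ≋ - m + T τ, and doubling kills T τ.
      2Tρ : + 2 ℤ.* T ρ ≋ ℤ.- (+ 2 ℤ.* + m)
      2Tρ = ≋-trans (≋-*ˡ (+ 2) Tρ) (≋-trans (≋-reflexive (lem (+ m) (T τ)))
              (≋-trans (≋-+ (≋-reflexive {a = ℤ.- (+ 2 ℤ.* + m)} refl) 2Tτ) (≋-reflexive (ℤ.+-identityʳ _))))
        where
        lem : ∀ m t → + 2 ℤ.* (ℤ.- m ℤ.+ t) ≡ ℤ.- (+ 2 ℤ.* m) ℤ.+ + 2 ℤ.* t
        lem = ℤ.solve-∀

      -- Tripling `2Tρ` kills its left-hand side and leaves 6m ≋ 0 modulo n = d m.
      d∣6 : d ∣ 6
      d∣6 = *-cancelʳ-∣ m (subst (_∣ 6 * m) n≡dm (ℤ.∣⇒∣ᵤ (subst (+ n ℤ.∣_) (trans (ℤ.+-identityʳ _) (sym (ℤ.pos-* 6 m))) (n∣a-b 6m))))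
        where
        lem : ∀ t → + 3 ℤ.* (+ 2 ℤ.* t) ≡ + 2 ℤ.* (+ 3 ℤ.* t)
        lem = ℤ.solve-∀
        lem₂ : ∀ m → + 6 ℤ.* m ≡ (ℤ.- + 1) ℤ.* (+ 3 ℤ.* (ℤ.- (+ 2 ℤ.* m)))
        lem₂ = ℤ.solve-∀
        6m : + 6 ℤ.* + m ≋ 0ℤ
        6m = ≋-trans (≋-reflexive (lem₂ (+ m))) (≋-*ˡ (ℤ.- + 1) (≋-trans (≋-sym (≋-*ˡ (+ 3) 2Tρ))
               (≋-trans (≋-reflexive (lem (T ρ))) (≋-*ˡ (+ 2) 3Tρ))))

      open Equivariant τ τ-shift public using () renaming (π̄ to τ̄; π̄-q to τ̄-q; π-shift* to τ-shift*)
      open Equivariant ρ ρ-shift public using () renaming (π̄ to ρ̄; π̄-q to ρ̄-q; π-shift* to ρ-shift*; δ-periodic to ρ-periodic)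

      τ̄² : ∀ i → τ̄ (τ̄ i) ≡ i
      τ̄² i = trans (τ̄-q _) (trans (cong q (τ² (emb i))) (q-emb i))

      ρ̄²-q : ∀ x → ρ̄ (ρ̄ (q x)) ≡ q (ρ (ρ x))
      ρ̄²-q x = trans (cong ρ̄ (ρ̄-q x)) (ρ̄-q (ρ x))

      ρ̄³ : ∀ i → ρ̄ (ρ̄ (ρ̄ i)) ≡ i
      ρ̄³ i = trans (ρ̄²-q _) (trans (cong q (ρ³ (emb i))) (q-emb i))

      ρ̄≡ : ∀ i → ρ̄ i ≡ prev (τ̄ i)
      ρ̄≡ i = trans (cong q (ρ≡ (emb i))) (q-prev _)

      open Reps ρ̄ ρ̄³ public using (fix)
      open Reps ρ̄ ρ̄³ using (rep; rep-nonfixed)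

      -- On a 3-cycle of ρ̄ the displacements of ρ add up to 0.
      T-fixed : T ρ ≋ sumℤ (λ i → + 𝟙 (fix i) ℤ.* δ ρ (emb i))
      T-fixed = ≋-trans (≋-reflexive (trans (sumℤ-cong split)
          (trans (sumℤ-+ (λ i → + 𝟙 (fix i) ℤ.* D i) (λ i → c i ℤ.* D i ℤ.+ (c (ρ̄ i) ℤ.* D i ℤ.+ c (ρ̄ (ρ̄ i)) ℤ.* D i)))
          (cong (λ z → F ℤ.+ z) collect))))
          (≋-trans (≋-+ {F} (≋-reflexive refl) (≋-trans (≋-sum cycle) (≋-reflexive (trans (sumℤ-const m 0ℤ) (ℤ.*-zeroʳ (+ m)))))) (≋-reflexive (ℤ.+-identityʳ F)))
        where
        open ≡-Reasoning
        -- `c` is 1 exactly at the representatives of the 3-cycles of ρ̄, so that its values at i,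
        -- ρ̄ i and ρ̄² i add up to 1 on a 3-cycle and to 0 at a fixed point.
        D c : Fin m → ℤ
        D i = δ ρ (emb i)
        c i = + 𝟙 (rep i ∧ not (fix i))
        F : ℤ
        F = sumℤ (λ i → + 𝟙 (fix i) ℤ.* D i)
        c-fix : ∀ i → fix i ≡ true → c i ≡ 0ℤ
        c-fix i e rewrite e with rep i
        ... | true  = refl
        ... | false = refl
        c-rep : ∀ i → fix i ≡ false → c i ≡ + 𝟙 (rep i)
        c-rep i e rewrite e with rep i
        ... | true  = refl
        ... | false = refl
        lem₀ : ∀ x → x ≡ 1ℤ ℤ.* x ℤ.+ (0ℤ ℤ.* x ℤ.+ (0ℤ ℤ.* x ℤ.+ 0ℤ ℤ.* x))
        lem₀ = ℤ.solve-∀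
        lem₁ : ∀ x a b c → (a ℤ.+ (b ℤ.+ c)) ℤ.* x ≡ 0ℤ ℤ.* x ℤ.+ (a ℤ.* x ℤ.+ (b ℤ.* x ℤ.+ c ℤ.* x))
        lem₁ = ℤ.solve-∀
        back : ∀ {x y} → ρ̄ x ≡ ρ̄ y → x ≡ y
        back {x} {y} e = trans (sym (ρ̄³ x)) (trans (cong (ρ̄ ∘ ρ̄) e) (ρ̄³ y))
        split : ∀ i → D i ≡ + 𝟙 (fix i) ℤ.* D i ℤ.+ (c i ℤ.* D i ℤ.+ (c (ρ̄ i) ℤ.* D i ℤ.+ c (ρ̄ (ρ̄ i)) ℤ.* D i))
        split i = go (ρ̄ i Fin.≟ i)
          where
          expand : ∀ {f f′ a a′ b b′ e e′} x → f ≡ f′ → a ≡ a′ → b ≡ b′ → e ≡ e′ →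
                   f ℤ.* x ℤ.+ (a ℤ.* x ℤ.+ (b ℤ.* x ℤ.+ e ℤ.* x)) ≡ f′ ℤ.* x ℤ.+ (a′ ℤ.* x ℤ.+ (b′ ℤ.* x ℤ.+ e′ ℤ.* x))
          expand x refl refl refl refl = refl
          go : Dec (ρ̄ i ≡ i) → D i ≡ + 𝟙 (fix i) ℤ.* D i ℤ.+ (c i ℤ.* D i ℤ.+ (c (ρ̄ i) ℤ.* D i ℤ.+ c (ρ̄ (ρ̄ i)) ℤ.* D i))
          go (yes e) = trans (lem₀ (D i)) (sym (expand (D i) (cong (λ b → + 𝟙 b) (dec-true (_ Fin.≟ _) e))
            (c-fix i (dec-true (_ Fin.≟ _) e)) (c-fix (ρ̄ i) (dec-true (_ Fin.≟ _) (cong ρ̄ e)))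
            (c-fix (ρ̄ (ρ̄ i)) (dec-true (_ Fin.≟ _) (cong (ρ̄ ∘ ρ̄) e)))))
          go (no ne) = trans (sym (ℤ.*-identityˡ (D i))) (trans (cong (λ z → + z ℤ.* D i) (sym (rep-nonfixed i ne)))
            (trans (lem₁ (D i) (+ 𝟙 (rep i)) (+ 𝟙 (rep (ρ̄ i))) (+ 𝟙 (rep (ρ̄ (ρ̄ i)))))
            (sym (expand (D i) (cong (λ b → + 𝟙 b) (dec-false (_ Fin.≟ _) ne))
              (c-rep i (dec-false (_ Fin.≟ _) ne)) (c-rep (ρ̄ i) (dec-false (_ Fin.≟ _) (λ e → ne (back e))))
              (c-rep (ρ̄ (ρ̄ i)) (dec-false (_ Fin.≟ _) (λ e → ne (back (back e)))))))))
        -- Reindexing by ρ̄ and its square gathers the three displacements of a 3-cycle at its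
        -- representative.
        collect : sumℤ (λ i → c i ℤ.* D i ℤ.+ (c (ρ̄ i) ℤ.* D i ℤ.+ c (ρ̄ (ρ̄ i)) ℤ.* D i)) ≡
                  sumℤ (λ i → c i ℤ.* (D i ℤ.+ (D (ρ̄ (ρ̄ i)) ℤ.+ D (ρ̄ i))))
        collect = begin
          sumℤ (λ i → c i ℤ.* D i ℤ.+ (c (ρ̄ i) ℤ.* D i ℤ.+ c (ρ̄ (ρ̄ i)) ℤ.* D i))
            ≡⟨ sumℤ-+₃ (λ i → c i ℤ.* D i) (λ i → c (ρ̄ i) ℤ.* D i) (λ i → c (ρ̄ (ρ̄ i)) ℤ.* D i) ⟩
          sumℤ (λ i → c i ℤ.* D i) ℤ.+ (sumℤ (λ i → c (ρ̄ i) ℤ.* D i) ℤ.+ sumℤ (λ i → c (ρ̄ (ρ̄ i)) ℤ.* D i))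
            ≡⟨ cong (λ z → sumℤ (λ i → c i ℤ.* D i) ℤ.+ z) (cong₂ ℤ._+_
                 (trans (sumℤ-reindex (ρ̄ ∘ ρ̄) ρ̄ ρ̄³ ρ̄³ (λ i → c (ρ̄ i) ℤ.* D i)) (sumℤ-cong (λ i → cong (λ z → c z ℤ.* D (ρ̄ (ρ̄ i))) (ρ̄³ i))))
                 (trans (sumℤ-reindex ρ̄ (ρ̄ ∘ ρ̄) ρ̄³ ρ̄³ (λ i → c (ρ̄ (ρ̄ i)) ℤ.* D i)) (sumℤ-cong (λ i → cong (λ z → c z ℤ.* D (ρ̄ i)) (ρ̄³ i))))) ⟩
          sumℤ (λ i → c i ℤ.* D i) ℤ.+ (sumℤ (λ i → c i ℤ.* D (ρ̄ (ρ̄ i))) ℤ.+ sumℤ (λ i → c i ℤ.* D (ρ̄ i)))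
            ≡⟨ sumℤ-+₃ (λ i → c i ℤ.* D i) (λ i → c i ℤ.* D (ρ̄ (ρ̄ i))) (λ i → c i ℤ.* D (ρ̄ i)) ⟨
          sumℤ (λ i → c i ℤ.* D i ℤ.+ (c i ℤ.* D (ρ̄ (ρ̄ i)) ℤ.+ c i ℤ.* D (ρ̄ i)))
            ≡⟨ sumℤ-cong (λ i → dist (c i) (D i) (D (ρ̄ (ρ̄ i))) (D (ρ̄ i))) ⟩
          sumℤ (λ i → c i ℤ.* (D i ℤ.+ (D (ρ̄ (ρ̄ i)) ℤ.+ D (ρ̄ i)))) ∎
          where
          dist : ∀ c x y z → c ℤ.* x ℤ.+ (c ℤ.* y ℤ.+ c ℤ.* z) ≡ c ℤ.* (x ℤ.+ (y ℤ.+ z))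
          dist = ℤ.solve-∀
        -- The representative of ρ̄ i need not be ρ (`emb i`); `δ-periodic` replaces it, after which
        -- the three displacements telescope around an honest cycle of ρ.
        cycle : ∀ i → c i ℤ.* (D i ℤ.+ (D (ρ̄ (ρ̄ i)) ℤ.+ D (ρ̄ i))) ≋ 0ℤ
        cycle i = ≋-trans (≋-*ˡ (c i) (≋-trans (≋-+ {D i} (≋-reflexive refl)
            (≋-+ (ρ-periodic {emb (ρ̄ (ρ̄ i))} {ρ (ρ (emb i))} (trans (q-emb _) (trans (cong (ρ̄ ∘ ρ̄) (sym (q-emb i))) (ρ̄²-q (emb i)))))
                 (ρ-periodic {emb (ρ̄ i)} {ρ (emb i)} (q-emb _))))
            (≋-reflexive telescope))) (≋-reflexive (ℤ.*-zeroʳ (c i)))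
          where
          x = emb i
          lem : ∀ a b c → (b ℤ.- a) ℤ.+ ((a ℤ.- c) ℤ.+ (c ℤ.- b)) ≡ 0ℤ
          lem = ℤ.solve-∀
          telescope : δ ρ x ℤ.+ (δ ρ (ρ (ρ x)) ℤ.+ δ ρ (ρ x)) ≡ 0ℤ
          telescope rewrite ρ³ x = lem ⟦ x ⟧ ⟦ ρ x ⟧ ⟦ ρ (ρ x) ⟧

  does-⇔ : ∀ {A B : Set} (a? : Dec A) (b? : Dec B) → (A → B) → (B → A) → does a? ≡ does b?
  does-⇔ (yes a) b? f g = sym (dec-true b? (f a))
  does-⇔ (no ¬a) b? f g = sym (dec-false b? (¬a ∘ g))

  -- Automorphisms of a cubic one-face map and the quotients by them.

  module CubicMap {n : ℕ} .{{_ : NonZero n}} (τ ρ : Fin n → Fin n)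
    (τ² : ∀ x → τ (τ x) ≡ x) (ρ³ : ∀ x → ρ (ρ (ρ x)) ≡ x) (ρ≡ : ∀ x → ρ x ≡ prev (τ x))
    (τ≢ : ∀ x → τ x ≢ x) (ρ≢ : ∀ x → ρ x ≢ x) (M : ℕ) .{{_ : NonZero M}} (n≡6M : n ≡ 6 * M) where

    Aut : ℕ → Set
    Aut k = ∀ x → τ (shift k x) ≡ shift k (τ x)

    aut-+ : ∀ {a b} → Aut a → Aut b → Aut (a + b)
    aut-+ {a} {b} p r x = begin
      τ (shift (a + b) x)          ≡⟨ cong τ (shift-∘ a b x) ⟨
      τ (shift a (shift b x))      ≡⟨ p _ ⟩
      shift a (τ (shift b x))      ≡⟨ cong (shift a) (r x) ⟩
      shift a (shift b (τ x))      ≡⟨ shift-∘ a b (τ x) ⟩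
      shift (a + b) (τ x)          ∎
      where open ≡-Reasoning

    aut-multiple : ∀ {a} → n ∣ a → Aut a
    aut-multiple n∣a x = trans (cong τ (shift-multiple n∣a x)) (sym (shift-multiple n∣a (τ x)))

    aut-* : ∀ j {a} → Aut a → Aut (j * a)
    aut-* zero    p = aut-multiple (n ∣0)
    aut-* (suc j) p = aut-+ p (aut-* j p)

    -- The automorphisms form a group: the shift by `b * pred n` is inverse to the shift by b.
    aut-cancel : ∀ {a b} → Aut b → Aut (a + b) → Aut a
    aut-cancel {a} {b} p r x = begin
      τ (shift a x)                                   ≡⟨ cong τ (shift-multiple n∣ _) ⟨
      τ (shift (b + b * pred n) (shift a x))          ≡⟨ cong τ (trans (shift-comm (b + b * pred n) a x) (cong (shift a) (sym (shift-∘ b (b * pred n) x)))) ⟩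
      τ (shift a (shift b (shift (b * pred n) x)))    ≡⟨ cong τ (shift-∘ a b _) ⟩
      τ (shift (a + b) (shift (b * pred n) x))        ≡⟨ r _ ⟩
      shift (a + b) (τ (shift (b * pred n) x))        ≡⟨ cong (shift (a + b)) (subst Aut (*-comm (pred n) b) (aut-* (pred n) p) x) ⟩
      shift (a + b) (shift (b * pred n) (τ x))        ≡⟨ shift-∘ a b _ ⟨
      shift a (shift b (shift (b * pred n) (τ x)))    ≡⟨ cong (shift a) (shift-∘ b (b * pred n) (τ x)) ⟩
      shift a (shift (b + b * pred n) (τ x))          ≡⟨ cong (shift a) (shift-multiple n∣ (τ x)) ⟩
      shift a (τ x)                                   ∎
      where
      open ≡-Reasoning
      n∣ : n ∣ b + b * pred n
      n∣ = divides b (trans (sym (*-suc b (pred n))) (cong (b *_) (suc-pred n)))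

    -- Only a divisor of n has a quotient of the form ℤ/m. By Bézout, gcd(k, n) is a combination of
    -- k and n, so it generates the same subgroup as k.
    aut-gcd : ∀ {k} → Aut k → Aut (gcd k n)
    aut-gcd {k} p with Bézout.identity (gcd-GCD k n)
    ... | Bézout.+- x y eq = aut-cancel {b = y * n} (aut-multiple (n∣m*n y)) (subst Aut (sym eq) (aut-* x p))
    ... | Bézout.-+ x y eq = aut-cancel {b = x * k} (aut-* x p) (subst Aut (sym eq) (aut-multiple (n∣m*n y)))

    -- The order d of the shift by m divides 6, and d m = n = 6M; so m is M times the cofactor of d
    -- in 6.
    divisor⇒M∣ : ∀ m d → .{{NonZero m}} → n ≡ d * m → Aut m → M ∣ m
    divisor⇒M∣ m d n≡ p = go (Displacement.Cubic.d∣6 m d n≡ τ ρ τ² ρ³ ρ≡ p)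
      where
      d≢0 : NonZero d
      d≢0 = ≢-nonZero (λ { refl → ≢-nonZero⁻¹ n n≡ })
      go : d ∣ 6 → M ∣ m
      go (divides c 6≡cd) = divides c (*-cancelˡ-≡ _ _ d {{d≢0}}
        (trans (sym n≡) (trans n≡6M (trans (cong (_* M) (trans 6≡cd (*-comm c d))) (*-assoc d c M)))))

    aut⇒M∣ : ∀ {k} → Aut k → M ∣ k
    aut⇒M∣ {k} p = ∣-trans (go (gcd[m,n]∣n k n)) (gcd[m,n]∣m k n)
      where
      go : gcd k n ∣ n → M ∣ gcd k n
      go (divides d n≡) = divisor⇒M∣ (gcd k n) d
        {{≢-nonZero (λ m≡0 → ≢-nonZero⁻¹ n (trans n≡ (trans (cong (d *_) m≡0) (*-zeroʳ d))))}} n≡ (aut-gcd p)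

    -- One predicate for both kinds of branching: for τ and k = 3M it says that the half turn
    -- reverses the edge of the letter at x, for ρ and k = 2M or 4M that a rotation of order 3
    -- permutes the corners at the vertex of x cyclically.
    like : (Fin n → Fin n) → ℕ → Fin n → Bool
    like π k x = does (π x Fin.≟ shift k x)

    module Cover (m d : ℕ) .{{_ : NonZero m}} (n≡dm : n ≡ d * m) (aut : Aut m) where

      open Quotient m d n≡dm public
      open Displacement m d n≡dm public
      open Cubic τ ρ τ² ρ³ ρ≡ aut public
      open OneFace τ̄ ρ̄ τ̄² ρ̄³ ρ̄≡ public using (τ-fix; genus-bound)
      open Reps ρ̄ ρ̄³ public using (rep; rep-total)

      -- The condition is invariant under the shift by m, with which π commutes, so each point of
      -- the quotient counts d times.
      like-sum : ∀ π → (∀ x → π (shift m x) ≡ shift m (π x)) → ∀ k →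
                 sum (𝟙 ∘ like π k) ≡ d * sum (λ i → 𝟙 (like π k (emb i)))
      like-sum π π-shift k = trans (sum-cong-≗ (λ x → cong 𝟙 (periodic x))) (sum-quotient (λ i → 𝟙 (like π k (emb i))))
        where
        open Equivariant π π-shift using (π-shift*)
        move : ∀ j x → π x ≡ shift k x → π (shift (j * m) x) ≡ shift k (shift (j * m) x)
        move j x e = trans (π-shift* j x) (trans (cong (shift (j * m)) e) (shift-comm (j * m) k x))
        periodic : ∀ x → like π k x ≡ like π k (emb (q x))
        periodic x with fibre {x} {emb (q x)} (sym (q-emb (q x))) | fibre {emb (q x)} {x} (q-emb (q x))
        ... | j , _ , e | j′ , _ , e′ = does-⇔ (_ Fin.≟ _) (_ Fin.≟ _)
          (λ p → subst (λ z → π z ≡ shift k z) (sym e) (move j x p))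
          (λ p → subst (λ z → π z ≡ shift k z) (sym e′) (move j′ (emb (q x)) p))

      -- Over a fixed point of τ̄ the map τ acts as a shift by j m. From τ² = 1 follows d ∣ 2j, and
      -- j ≢ 0 because τ moves every letter.
      τ-fixed : ∀ i → τ̄ i ≡ i → ∃ λ j → j < d × d ∣ 2 * j × j ≢ 0 × τ (emb i) ≡ shift (j * m) (emb i)
      τ-fixed i e with fibre {emb i} {τ (emb i)} (trans (q-emb i) (sym e))
      ... | j , j<d , τx≡ = j , j<d , *-cancelʳ-∣ m (subst₂ _∣_ n≡dm (sym (*-assoc 2 j m)) n∣) ,
          (λ { refl → τ≢ (emb i) (trans τx≡ (shift-0 _)) }) , τx≡
        where
        x = emb i
        open ≡-Reasoning
        n∣ : n ∣ 2 * (j * m)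
        n∣ = shift-fixed x (begin
          shift (2 * (j * m)) x                   ≡⟨ cong (λ z → shift (j * m + z) x) (+-identityʳ (j * m)) ⟩
          shift (j * m + j * m) x                 ≡⟨ shift-∘ (j * m) (j * m) x ⟨
          shift (j * m) (shift (j * m) x)         ≡⟨ cong (shift (j * m)) τx≡ ⟨
          shift (j * m) (τ x)                     ≡⟨ τ-shift* j x ⟨
          τ (shift (j * m) x)                     ≡⟨ cong τ τx≡ ⟨
          τ (τ x)                                 ≡⟨ τ² x ⟩
          x                                       ∎)

      ρ-fixed : ∀ i → ρ̄ i ≡ i → ∃ λ j → j < d × d ∣ 3 * j × j ≢ 0 × ρ (emb i) ≡ shift (j * m) (emb i)
      ρ-fixed i e with fibre {emb i} {ρ (emb i)} (trans (q-emb i) (sym e))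
      ... | j , j<d , ρx≡ = j , j<d , *-cancelʳ-∣ m (subst₂ _∣_ n≡dm (sym (*-assoc 3 j m)) n∣) ,
          (λ { refl → ρ≢ (emb i) (trans ρx≡ (shift-0 _)) }) , ρx≡
        where
        x = emb i
        k = j * m
        open ≡-Reasoning
        n∣ : n ∣ 3 * k
        n∣ = shift-fixed x (begin
          shift (3 * k) x                         ≡⟨ cong (λ z → shift (k + (k + z)) x) (+-identityʳ k) ⟩
          shift (k + (k + k)) x                   ≡⟨ trans (sym (shift-∘ k (k + k) x)) (cong (shift k) (sym (shift-∘ k k x))) ⟩
          shift k (shift k (shift k x))           ≡⟨ cong (shift k ∘ shift k) ρx≡ ⟨
          shift k (shift k (ρ x))                 ≡⟨ cong (shift k) (ρ-shift* j x) ⟨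
          shift k (ρ (shift k x))                 ≡⟨ ρ-shift* j (shift k x) ⟨
          ρ (shift k (shift k x))                 ≡⟨ cong (ρ ∘ shift k) ρx≡ ⟨
          ρ (shift k (ρ x))                       ≡⟨ cong ρ (ρ-shift* j x) ⟨
          ρ (ρ (shift k x))                       ≡⟨ cong (ρ ∘ ρ) ρx≡ ⟨
          ρ (ρ (ρ x))                             ≡⟨ ρ³ x ⟩
          x                                       ∎)

      like⇒fixed : ∀ (π : Fin n → Fin n) j i → π (emb i) ≡ shift (j * m) (emb i) → q (π (emb i)) ≡ i
      like⇒fixed π j i e = trans (cong q e) (trans (q-shift-multiple j (emb i)) (q-emb i))

      τ-fix-like : ∀ j → (∀ j′ → j′ < d → d ∣ 2 * j′ → j′ ≢ 0 → j′ ≡ j) →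
                   sum (𝟙 ∘ τ-fix) ≡ sum (λ i → 𝟙 (like τ (j * m) (emb i)))
      τ-fix-like j only = sum-cong-≗ (λ i → cong 𝟙 (does-⇔ (τ̄ i Fin.≟ i) (_ Fin.≟ _) (to i) (like⇒fixed τ j i)))
        where
        to : ∀ i → τ̄ i ≡ i → τ (emb i) ≡ shift (j * m) (emb i)
        to i e with τ-fixed i e
        ... | j′ , a , b , c , e′ with refl ← only j′ a b c = e′

      -- The group has two shifts of order 3, and ρ agrees with one of them over each fixed point of
      -- ρ̄. This dichotomy becomes the sign of the vertex.
      fix-split : ∀ j k → (∀ j′ → j′ < d → d ∣ 3 * j′ → j′ ≢ 0 → j′ ≡ j ⊎ j′ ≡ k) →
                  (∀ x → shift {n} (j * m) x ≢ shift (k * m) x) → ∀ i →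
                  𝟙 (fix i) ≡ 𝟙 (like ρ (j * m) (emb i)) + 𝟙 (like ρ (k * m) (emb i))
      fix-split j k only distinct i with ρ̄ i Fin.≟ i
      ... | no ne = sym (cong₂ (λ a b → 𝟙 a + 𝟙 b)
          (dec-false (_ Fin.≟ _) (ne ∘ like⇒fixed ρ j i)) (dec-false (_ Fin.≟ _) (ne ∘ like⇒fixed ρ k i)))
      ... | yes e with ρ-fixed i e
      ...   | j′ , a , b , c , e′ with only j′ a b c
      ...     | inj₁ refl = sym (cong₂ (λ a b → 𝟙 a + 𝟙 b) (dec-true (_ Fin.≟ _) e′)
                  (dec-false (_ Fin.≟ _) (λ e″ → distinct (emb i) (trans (sym e′) e″))))
      ...     | inj₂ refl = sym (cong₂ (λ a b → 𝟙 a + 𝟙 b)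
                  (dec-false (_ Fin.≟ _) (λ e″ → distinct (emb i) (trans (sym e″) e′))) (dec-true (_ Fin.≟ _) e′))

      shifts-distinct : ∀ j l → .{{NonZero l}} → l < d → ∀ x → shift {n} (j * m) x ≢ shift ((l + j) * m) x
      shifts-distinct j l l<d x e = <⇒≱ l<d (∣⇒≤ (*-cancelʳ-∣ m (subst (_∣ l * m) n≡dm (shift-fixed (shift (j * m) x)
        (trans (shift-∘ (l * m) (j * m) x) (trans (cong (λ z → shift z x) (sym (*-distribʳ-+ m l j))) (sym e)))))))

    -- A reversed edge is counted at both of its letters.  A vertex fixed by an automorphism of
    -- order 3 is counted at its three corners, in rising if it is negative (ρ moves its corners
    -- by n/3) and in falling if it is positive (by 2n/3).
    reversed : ℕ
    reversed = sum (𝟙 ∘ like τ (3 * M))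

    rising falling : ℕ
    rising  = sum (𝟙 ∘ like ρ (2 * M))
    falling = sum (𝟙 ∘ like ρ (4 * M))

    module _ (h : ℕ) (M≡ : M ≡ 2 * h + 1) (aut : Aut (3 * M)) where
      private
        instance
          nz : NonZero (3 * M)
          nz = m*n≢0 3 M
        n≡ : n ≡ 2 * (3 * M)
        n≡ = trans n≡6M (*-assoc 2 3 M)
        module C = Cover (3 * M) 2 n≡ aut

        only : ∀ j → j < 2 → 2 ∣ 2 * j → j ≢ 0 → j ≡ 1
        only 0 _ _ ≢0 = ⊥-elim (≢0 refl)
        only 1 _ _ _  = refl
        only (suc (suc _)) (s≤s (s≤s ())) _ _

        fixes : sum (𝟙 ∘ C.τ-fix) ≡ sum (λ i → 𝟙 (like τ (3 * M) (C.emb i)))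
        fixes = trans (C.τ-fix-like 1 only) (cong (λ z → sum (λ i → 𝟙 (like τ z (C.emb i)))) (+-identityʳ (3 * M)))

      abstract
        order-2 : ∃ λ r → reversed ≡ 2 * r × r ≤ M + 2 × (∃ λ k → 3 * M ≡ 4 * k + r)
        order-2 = sum (𝟙 ∘ C.τ-fix)
          , trans (C.like-sum τ aut (3 * M)) (cong (2 *_) (sym fixes))
          -- With m = 3M the genus bound reads 4f + 3r ≤ 3M + 6; the term 4f is dropped and 3
          -- cancelled.
          , *-cancelˡ-≤ 3 (≤-trans (m≤n+m _ (4 * sum (𝟙 ∘ C.fix))) (≤-trans C.genus-bound (≤-reflexive (sym (*-distribˡ-+ 3 M 2)))))
          , OddFace.fixed-mod-4 C.τ̄ C.ρ̄ C.τ̄² C.ρ̄³ C.ρ̄≡ (3 * h + 1) (trans (cong (3 *_) M≡) (lem h))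
          where
          lem : ∀ h → 3 * (2 * h + 1) ≡ 2 * (3 * h + 1) + 1
          lem = solve-∀

    module _ (aut : Aut (2 * M)) where
      private
        instance
          nz : NonZero (2 * M)
          nz = m*n≢0 2 M
        m = 2 * M
        n≡ : n ≡ 3 * m
        n≡ = trans n≡6M (*-assoc 3 2 M)
        module C = Cover m 3 n≡ aut
        open C using (emb; fix; δ; T; _≋_; congruent; ≋-trans; ≋-reflexive; ≋-sum; ≋-sym; ≋-*ˡ; shift-≋; ⟦_⟧)

        only : ∀ j → j < 3 → 3 ∣ 3 * j → j ≢ 0 → j ≡ 1 ⊎ j ≡ 2
        only 0 _ _ ≢0 = ⊥-elim (≢0 refl)
        only 1 _ _ _  = inj₁ refl
        only 2 _ _ _  = inj₂ refl
        only (suc (suc (suc _))) (s≤s (s≤s (s≤s ()))) _ _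

        up down : Fin m → ℕ
        up i = 𝟙 (like ρ m (emb i))
        down i = 𝟙 (like ρ (4 * M) (emb i))

        fix≡ : ∀ i → 𝟙 (fix i) ≡ up i + down i
        fix≡ i = trans (C.fix-split 1 2 only (C.shifts-distinct 1 1 (s≤s (s≤s z≤n))) i)
          (cong₂ (λ a b → 𝟙 (like ρ a (emb i)) + 𝟙 (like ρ b (emb i))) (+-identityʳ m) (sym (*-assoc 2 2 M)))

        rising-moves : ∀ i k → like ρ k (emb i) ≡ true → δ ρ (emb i) ≋ + k
        rising-moves i k e with ρ (emb i) Fin.≟ shift k (emb i)
        ... | yes p = ≋-trans (≋-reflexive (cong (λ z → ⟦ z ⟧ ℤ.- ⟦ emb i ⟧) p))
                        (≋-trans (C.≋-+ (shift-≋ k (emb i)) (≋-reflexive {a = ℤ.- ⟦ emb i ⟧} refl)) (≋-reflexive (lem ⟦ emb i ⟧ (+ k))))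
          where
          lem : ∀ x k → (x ℤ.+ k) ℤ.+ ℤ.- x ≡ k
          lem = ℤ.solve-∀

        -- 4M and m = 2M add up to n.
        4M≋-m : + (4 * M) ≋ ℤ.- (+ m)
        4M≋-m = congruent (ℤ.divides 1ℤ (trans (cong (λ z → + z ℤ.- (ℤ.- (+ m))) (*-assoc 2 2 M))
          (trans (cong (λ z → z ℤ.- (ℤ.- (+ m))) (ℤ.pos-* 2 m))
          (trans (lem (+ m)) (cong (λ z → 1ℤ ℤ.* z) (trans (sym (ℤ.pos-* 3 m)) (cong +_ (sym n≡))))))))
          where
          lem : ∀ m → + 2 ℤ.* m ℤ.- (ℤ.- m) ≡ 1ℤ ℤ.* (+ 3 ℤ.* m)
          lem = ℤ.solve-∀

        -- A fixed class is counted in exactly one of `up` and `down`; ρ moves its representative by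
        -- m in the first case and by 4M ≋ - m in the second.
        local : ∀ i → + 𝟙 (fix i) ℤ.* δ ρ (emb i) ≋ + m ℤ.* (+ up i ℤ.- + down i)
        local i = ≋-trans (≋-reflexive (cong (λ z → + z ℤ.* δ ρ (emb i)) (fix≡ i)))
          (case (rising-moves i m) (rising-moves i (4 * M)) (subst (_≤ 1) (fix≡ i) (𝟙≤1 (fix i))))
          where
          𝟙≤1 : ∀ b → 𝟙 b ≤ 1
          𝟙≤1 true  = ≤-refl
          𝟙≤1 false = z≤n
          lem₁ : ∀ m → m ≡ m ℤ.* (1ℤ ℤ.- 0ℤ)
          lem₁ = ℤ.solve-∀
          lem₂ : ∀ m → ℤ.- m ≡ m ℤ.* (0ℤ ℤ.- 1ℤ)
          lem₂ = ℤ.solve-∀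
          case : ∀ {a b x} → (a ≡ true → x ≋ + m) → (b ≡ true → x ≋ + (4 * M)) → 𝟙 a + 𝟙 b ≤ 1 →
                 + (𝟙 a + 𝟙 b) ℤ.* x ≋ + m ℤ.* (+ 𝟙 a ℤ.- + 𝟙 b)
          case {true}  {true}  f g (s≤s ())
          case {true}  {false} {x} f g _ = ≋-trans (≋-reflexive (ℤ.*-identityˡ x)) (≋-trans (f refl) (≋-reflexive (lem₁ (+ m))))
          case {false} {true}  {x} f g _ = ≋-trans (≋-reflexive (ℤ.*-identityˡ x)) (≋-trans (g refl) (≋-trans 4M≋-m (≋-reflexive (lem₂ (+ m)))))
          case {false} {false} {x} f g _ = ≋-reflexive (trans (ℤ.*-zeroˡ x) (sym (ℤ.*-zeroʳ (+ m))))

        U S : ℕ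
        U = sum up
        S = sum down

        Tρ≋ : T ρ ≋ + m ℤ.* (+ U ℤ.- + S)
        Tρ≋ = ≋-trans C.T-fixed (≋-trans (≋-sum {m} local) (≋-reflexive (trans (sumℤ-*ˡ (+ m) (λ i → + up i ℤ.- + down i))
          (cong (λ z → + m ℤ.* z) (trans (sumℤ-- (λ i → + up i) (λ i → + down i)) (cong₂ ℤ._-_ (sumℤ-+ℕ up) (sumℤ-+ℕ down)))))))

        -- Two values of 2 T ρ are compared: 2m (U - S) from the fixed points and -2m from `2Tρ`.
        -- Cancelling m turns the congruence modulo n = 3m into one modulo 3.
        3∣2* : + 3 ℤ.∣ + 2 ℤ.* (+ U ℤ.- + S ℤ.+ 1ℤ)
        3∣2* = go (≋-trans (≋-sym (≋-*ˡ (+ 2) Tρ≋)) C.2Tρ)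
          where
          lem : ∀ m u s → + 2 ℤ.* (m ℤ.* (u ℤ.- s)) ℤ.- (ℤ.- (+ 2 ℤ.* m)) ≡ + 2 ℤ.* (u ℤ.- s ℤ.+ 1ℤ) ℤ.* m
          lem = ℤ.solve-∀
          go : + 2 ℤ.* (+ m ℤ.* (+ U ℤ.- + S)) ≋ ℤ.- (+ 2 ℤ.* + m) → + 3 ℤ.∣ + 2 ℤ.* (+ U ℤ.- + S ℤ.+ 1ℤ)
          go (congruent p) = ℤ.*-cancelʳ-∣ (+ m) (subst₂ ℤ._∣_ (trans (cong +_ n≡) (ℤ.pos-* 3 m)) (lem (+ m) (+ U) (+ S)) p)

        fix-total : sum (𝟙 ∘ fix) ≡ S + U
        fix-total = trans (sum-cong-≗ fix≡) (trans (∑-distrib-+ up down) (+-comm U S))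

        bound : 4 * (S + U) ≤ 2 * M + 6
        bound = ≤-trans (≤-reflexive (cong (4 *_) (sym fix-total))) (≤-trans (m≤m+n _ _) C.genus-bound)

        -- The quotient has an integral number of vertices: this is `rep-total` for m = 2M.
        3∣2M : + 3 ℤ.∣ + 2 ℤ.* (+ M ℤ.+ (+ S ℤ.+ + U))
        3∣2M = ℤ.divides (+ sum (𝟙 ∘ C.rep)) (begin
          + 2 ℤ.* (+ (M + (S + U)))         ≡⟨ ℤ.pos-* 2 (M + (S + U)) ⟨
          + (2 * (M + (S + U)))             ≡⟨ cong +_ (trans (*-distribˡ-+ 2 M (S + U)) (cong (λ z → 2 * M + 2 * z) (sym fix-total))) ⟩
          + (2 * M + 2 * sum (𝟙 ∘ fix))     ≡⟨ cong +_ C.rep-total ⟨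
          + (3 * sum (𝟙 ∘ C.rep))           ≡⟨ cong +_ (*-comm 3 (sum (𝟙 ∘ C.rep))) ⟩
          + (sum (𝟙 ∘ C.rep) * 3)           ≡⟨ ℤ.pos-* (sum (𝟙 ∘ C.rep)) 3 ⟩
          + sum (𝟙 ∘ C.rep) ℤ.* + 3         ∎)
          where open ≡-Reasoning

      abstract
        order-3 : ∃ λ s → ∃ λ u → falling ≡ 3 * s × rising ≡ 3 * u × 4 * (s + u) ≤ 2 * M + 6
                  × + 3 ℤ.∣ + 2 ℤ.* (+ M ℤ.+ (+ s ℤ.+ + u)) × + 3 ℤ.∣ + 2 ℤ.* (+ u ℤ.- + s ℤ.+ 1ℤ)
        order-3 = S , U , C.like-sum ρ C.ρ-shift (4 * M) , C.like-sum ρ C.ρ-shift (2 * M) , bound , 3∣2M , 3∣2*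

    module _ (aut : Aut M) where
      private
        module C = Cover M 6 n≡6M aut

        only₂ : ∀ j → j < 6 → 6 ∣ 2 * j → j ≢ 0 → j ≡ 3
        only₂ 0 _ _ ≢0 = ⊥-elim (≢0 refl)
        only₂ 1 _ p _ with () ← n∣m⇒m%n≡0 2 6 p
        only₂ 2 _ p _ with () ← n∣m⇒m%n≡0 4 6 p
        only₂ 3 _ _ _ = refl
        only₂ 4 _ p _ with () ← n∣m⇒m%n≡0 8 6 p
        only₂ 5 _ p _ with () ← n∣m⇒m%n≡0 10 6 p
        only₂ (suc (suc (suc (suc (suc (suc _)))))) (s≤s (s≤s (s≤s (s≤s (s≤s (s≤s ())))))) _ _

        only₃ : ∀ j → j < 6 → 6 ∣ 3 * j → j ≢ 0 → j ≡ 2 ⊎ j ≡ 4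
        only₃ 0 _ _ ≢0 = ⊥-elim (≢0 refl)
        only₃ 1 _ p _ with () ← n∣m⇒m%n≡0 3 6 p
        only₃ 2 _ _ _ = inj₁ refl
        only₃ 3 _ p _ with () ← n∣m⇒m%n≡0 9 6 p
        only₃ 4 _ _ _ = inj₂ refl
        only₃ 5 _ p _ with () ← n∣m⇒m%n≡0 15 6 p
        only₃ (suc (suc (suc (suc (suc (suc _)))))) (s≤s (s≤s (s≤s (s≤s (s≤s (s≤s ())))))) _ _

        R S U : ℕ
        R = sum (λ i → 𝟙 (like τ (3 * M) (C.emb i)))
        U = sum (λ i → 𝟙 (like ρ (2 * M) (C.emb i)))
        S = sum (λ i → 𝟙 (like ρ (4 * M) (C.emb i)))

        fix-total : sum (𝟙 ∘ C.fix) ≡ S + U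
        fix-total = trans (sum-cong-≗ (C.fix-split 2 4 only₃ (C.shifts-distinct 2 2 (s≤s (s≤s (s≤s z≤n))))))
          (trans (∑-distrib-+ (λ i → 𝟙 (like ρ (2 * M) (C.emb i))) (λ i → 𝟙 (like ρ (4 * M) (C.emb i)))) (+-comm U S))

      abstract
        -- All three counts are multiples of 6. An edge has two letters and a vertex three corners,
        -- so 3r edges are reversed and 2s positive and 2t negative vertices are fixed, with t = u
        -- here: the origin of the parameters of `inW6`.
        order-6 : ∃ λ r → ∃ λ s → ∃ λ u → reversed ≡ 6 * r × falling ≡ 6 * s × rising ≡ 6 * u
                  × 4 * (s + u) + 3 * r ≤ M + 6
        order-6 = R , S , U , C.like-sum τ aut (3 * M) , C.like-sum ρ C.ρ-shift (4 * M) , C.like-sum ρ C.ρ-shift (2 * M)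
          , subst₂ (λ a b → 4 * a + 3 * b ≤ M + 6) fix-total (C.τ-fix-like 3 only₂) C.genus-bound

module WicksForms where

  open import Data.Nat
  open import Data.Nat.DivMod
  open import Data.Nat.Divisibility
  open import Data.Nat.Properties
  open import Data.Nat.Tactic.RingSolver using (solve-∀)
  open OneFaceMaps
  open Coverings

  -- The number of automorphisms.

  sum-multiples : ∀ d m .{{_ : NonZero m}} (H : ℕ → ℕ) → (∀ k → ¬ (m ∣ k) → H k ≡ 0) →
                  sum {d * m} (H ∘ toℕ) ≡ sum {d} (λ j → H (toℕ j * m))
  sum-multiples zero    m H z = refl
  sum-multiples (suc d) m H z = trans (sum-+ m (d * m) H) (cong₂ _+_ first
      (sum-multiples d m (λ x → H (m + x)) (λ k m∤k → z (m + k) (λ p → m∤k (∣m+n∣m⇒∣n p ∣-refl)))))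
    where
    o : Fin m
    o = Fin.fromℕ< (>-nonZero⁻¹ m)
    first : sum {m} (H ∘ toℕ) ≡ H 0
    first = trans (sum-single o (H ∘ toℕ) (λ i i≢o → z (toℕ i) (λ m∣i → <⇒≱ (toℕ<n i)
        (∣⇒≤ {{≢-nonZero (λ i≡0 → i≢o (toℕ-injective (trans i≡0 (sym (toℕ-fromℕ< _)))))}} m∣i))))
      (cong H (toℕ-fromℕ< _))

  module AutCount {n : ℕ} .{{_ : NonZero n}} (τ ρ : Fin n → Fin n)
    (τ² : ∀ x → τ (τ x) ≡ x) (ρ³ : ∀ x → ρ (ρ (ρ x)) ≡ x) (ρ≡ : ∀ x → ρ x ≡ prev (τ x))
    (τ≢ : ∀ x → τ x ≢ x) (ρ≢ : ∀ x → ρ x ≢ x) (M : ℕ) .{{_ : NonZero M}} (n≡6M : n ≡ 6 * M) where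

    open CubicMap τ ρ τ² ρ³ ρ≡ τ≢ ρ≢ M n≡6M

    aut? : ∀ k → Dec (Aut k)
    aut? k = all? (λ x → τ (shift k x) Fin.≟ shift k (τ x))

    -- `3 * M` unfolds to `M + 2 * M`, so M is the difference of the two shifts.
    aut-M : Aut (2 * M) → Aut (3 * M) → Aut M
    aut-M p r = aut-cancel {M} p r

    -- Twice 4M is 2M + n.
    4M⇒2M : Aut (4 * M) → Aut (2 * M)
    4M⇒2M p = aut-cancel {b = n} (aut-multiple ∣-refl) (subst Aut (trans (lem M) (cong (2 * M +_) (sym n≡6M))) (aut-* 2 p))
      where
      lem : ∀ M → 2 * (4 * M) ≡ 2 * M + 6 * M
      lem = solve-∀

    private
      -- The indices are multiples of M, not orders: `a₂` belongs to the shift of order 3 and `a₃`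
      -- to the shift of order 2.
      a₂ a₃ : Bool
      a₂ = does (aut? (2 * M))
      a₃ = does (aut? (3 * M))

      is : ℕ → ℕ
      is k = 𝟙 (does (aut? k))

      5M⇒M : Aut (5 * M) → Aut M
      5M⇒M p = aut-cancel {b = 4 * n} (aut-multiple (n∣m*n 4)) (subst Aut (trans (lem M) (cong (λ z → M + 4 * z) (sym n≡6M))) (aut-* 5 p))
        where
        lem : ∀ M → 5 * (5 * M) ≡ M + 4 * (6 * M)
        lem = solve-∀

      is-M : ∀ {k} → (Aut k → Aut M) → (Aut M → Aut k) → does (aut? k) ≡ a₂ ∧ a₃
      is-M {k} f g = does-⇔ (aut? k) (aut? (2 * M) ×-dec aut? (3 * M))
        (λ p → aut-* 2 (f p) , aut-* 3 (f p)) (λ (p , r) → g (aut-M p r))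

    -- By `aut⇒M∣` only 0, M, ..., 5M can contribute. M and 5M generate the whole group of order 6,
    -- and 2M and 4M the same subgroup, whence the coefficients 2.
    automorphisms : sum {n} (λ k → 𝟙 (does (aut? (toℕ k)))) ≡ 1 + 2 * 𝟙 a₂ + 𝟙 a₃ + 2 * 𝟙 (a₂ ∧ a₃)
    automorphisms = begin
      sum {n} (is ∘ toℕ)                       ≡⟨ cong (λ n → sum {n} (is ∘ toℕ)) n≡6M ⟩
      sum {6 * M} (is ∘ toℕ)                   ≡⟨ sum-multiples 6 M is (λ k M∤k → cong 𝟙 (dec-false (aut? k) (λ p → M∤k (aut⇒M∣ p)))) ⟩
      is 0 + (is (1 * M) + (is (2 * M) + (is (3 * M) + (is (4 * M) + (is (5 * M) + 0)))))
        ≡⟨ cong₂ (λ a r → a + r) (cong 𝟙 (dec-true (aut? 0) (aut-multiple (n ∣0))))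
            (cong₂ (λ a r → 𝟙 a + (𝟙 a₂ + (𝟙 a₃ + r))) (is-M (subst Aut (+-identityʳ M)) (subst Aut (sym (+-identityʳ M))))
            (cong₂ (λ a r → 𝟙 a + (𝟙 r + 0)) (does-⇔ (aut? (4 * M)) (aut? (2 * M)) 4M⇒2M (λ p → subst Aut (sym (*-assoc 2 2 M)) (aut-* 2 p)))
              (is-M 5M⇒M (aut-* 5)))) ⟩
      1 + (𝟙 (a₂ ∧ a₃) + (𝟙 a₂ + (𝟙 a₃ + (𝟙 a₂ + (𝟙 (a₂ ∧ a₃) + 0)))))   ≡⟨ lem (𝟙 a₂) (𝟙 a₃) (𝟙 (a₂ ∧ a₃)) ⟩
      1 + 2 * 𝟙 a₂ + 𝟙 a₃ + 2 * 𝟙 (a₂ ∧ a₃)    ∎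
      where
      open ≡-Reasoning
      lem : ∀ a b c → 1 + (c + (a + (b + (a + (c + 0))))) ≡ 1 + 2 * a + b + 2 * c
      lem = solve-∀

  -- Boolean reflection and counting.

  ∧-true : ∀ {a b} → a ∧ b ≡ true → a ≡ true × b ≡ true
  ∧-true {true} {true} _ = refl , refl

  true-∧ : ∀ {a b} → a ≡ true → b ≡ true → a ∧ b ≡ true
  true-∧ refl refl = refl

  ∨-true : ∀ {a b} → a ∨ b ≡ true → a ≡ true ⊎ b ≡ true
  ∨-true {true}  _ = inj₁ refl
  ∨-true {false} e = inj₂ e

  not-true : ∀ {a} → not a ≡ true → a ≢ true
  not-true {false} _ ()

  ≡-by-true : ∀ {a b} → (a ≡ true → b ≡ true) → (b ≡ true → a ≡ true) → a ≡ b
  ≡-by-true {true}  {b}     f g = sym (f refl)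
  ≡-by-true {false} {false} f g = refl
  ≡-by-true {false} {true}  f g = g refl

  module _ {A : Set} {p : A → Bool} where

    all-true : ∀ {xs} → all p xs ≡ true → ∀ {x} → x ∈ xs → p x ≡ true
    all-true e (here refl) = proj₁ (∧-true e)
    all-true {y ∷ _} e (there x∈) = all-true (proj₂ (∧-true {p y} e)) x∈

    true-all : ∀ {xs} → (∀ {x} → x ∈ xs → p x ≡ true) → all p xs ≡ true
    true-all {[]}     f = refl
    true-all {x ∷ xs} f = true-∧ (f (here refl)) (true-all (f ∘ there))

    any-true : ∀ {xs} → any p xs ≡ true → ∃ λ x → x ∈ xs × p x ≡ true
    any-true {x ∷ xs} e with ∨-true {p x} e
    ... | inj₁ px = x , here refl , px
    ... | inj₂ e′ with any-true e′
    ...   | y , y∈ , py = y , there y∈ , py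

    true-any : ∀ {xs x} → x ∈ xs → p x ≡ true → any p xs ≡ true
    true-any (here refl) px rewrite px = refl
    true-any {y ∷ _} (there x∈) px with p y
    ... | true  = refl
    ... | false = true-any x∈ px

  count-tabulate : ∀ {A : Set} {n} (p : A → Bool) (f : Fin n → A) → count p (tabulate f) ≡ sum (λ i → 𝟙 (p (f i)))
  count-tabulate {n = zero}  p f = refl
  count-tabulate {n = suc n} p f with p (f zero)
  ... | true  = cong suc (count-tabulate p (f ∘ suc))
  ... | false = count-tabulate p (f ∘ suc)

  count-allFin : ∀ {n} (p : Fin n → Bool) → count p (allFin n) ≡ sum (𝟙 ∘ p)
  count-allFin p = count-tabulate p (λ i → i)

  sum-splitAt : ∀ a {b} (F : Fin (a + b) → ℕ) → sum F ≡ sum (λ i → F (i ↑ˡ b)) + sum (λ j → F (a ↑ʳ j))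
  sum-splitAt zero    F = refl
  sum-splitAt (suc a) F = trans (cong (F zero +_) (sum-splitAt a (F ∘ suc))) (sym (+-assoc (F zero) _ _))

  sum≡1⇒unique : ∀ {n} {P : Fin n → Bool} → sum (𝟙 ∘ P) ≡ 1 → ∀ {i j} → P i ≡ true → P j ≡ true → i ≡ j
  sum≡1⇒unique {n} {P} e {i} {j} pi pj with i Fin.≟ j
  ... | yes i≡j = i≡j
  ... | no i≢j = ⊥-elim (<⇒≱ (≤-reflexive (sym two)) (≤-trans (sum-mono below) (≤-reflexive e)))
    where
    at : Fin n → Fin n → ℕ
    at a x = 𝟙 (does (x Fin.≟ a))
    one : ∀ a → sum (at a) ≡ 1
    one a = trans (sum-single a (at a) (λ x x≢a → cong 𝟙 (dec-false (x Fin.≟ a) x≢a))) (cong 𝟙 (dec-true (a Fin.≟ a) refl))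
    two : sum (λ x → at i x + at j x) ≡ 2
    two = trans (∑-distrib-+ (at i) (at j)) (cong₂ _+_ (one i) (one j))
    below : ∀ x → at i x + at j x ≤ 𝟙 (P x)
    below x with x Fin.≟ i | x Fin.≟ j
    ... | yes refl | yes x≡j = ⊥-elim (i≢j x≡j)
    ... | yes refl | no _ rewrite pi = ≤-refl
    ... | no _ | yes refl rewrite pj = ≤-refl
    ... | no _ | no _ = z≤n

  sum≢0⇒∃ : ∀ {n} {P : Fin n → Bool} → sum (𝟙 ∘ P) ≢ 0 → ∃ λ i → P i ≡ true
  sum≢0⇒∃ {zero}  ne = ⊥-elim (ne refl)
  sum≢0⇒∃ {suc n} {P} ne with P zero in e
  ... | true  = zero , e
  ... | false with sum≢0⇒∃ {n} {P ∘ suc} ne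
  ...   | i , pi = suc i , pi

  module _ {e : ℕ} where

    inv-involutive : (x : Letter e) → inv (inv x) ≡ x
    inv-involutive (a , s) = cong (a ,_) (not-involutive s)

    inv≢ : (x : Letter e) → inv x ≢ x
    inv≢ (a , true)  ()
    inv≢ (a , false) ()

    ==L-sound : {x y : Letter e} → (x ==L y) ≡ true → x ≡ y
    ==L-sound {a , s} {b , t} p with a Fin.≟ b | s | t
    ... | yes refl | true  | true  = refl
    ... | yes refl | false | false = refl

    ==L-complete : {x y : Letter e} → x ≡ y → (x ==L y) ≡ true
    ==L-complete {a , true}  refl rewrite dec-true (a Fin.≟ a) refl = refl
    ==L-complete {a , false} refl rewrite dec-true (a Fin.≟ a) refl = refl

    ∈-allLetters : (x : Letter e) → x ∈ allLetters e
    ∈-allLetters (a , s) = ∈-concatMap⁺ (λ a → (a , true) ∷ (a , false) ∷ []) (Any.map (λ { refl → at s }) (∈-allFin a))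
      where
      at : ∀ s → (a , s) ∈ (a , true) ∷ (a , false) ∷ []
      at true  = here refl
      at false = there (here refl)

  -- The matching and the corner permutation of a Wicks form.

  module WicksForm {n e : ℕ} .{{_ : NonZero n}} (w : Word n e) (wicks : isWicks w ≡ true) where

    private
      c₁ : cond1 w ≡ true
      c₁ = proj₁ (∧-true wicks)
      rest₁ : usesAll w ∧ cond2 w ∧ cond3 w ≡ true
      rest₁ = proj₂ (∧-true {cond1 w} wicks)
      rest₂ : cond2 w ∧ cond3 w ≡ true
      rest₂ = proj₂ (∧-true {usesAll w} rest₁)

      occ-sum : ∀ x → occ w x ≡ sum (λ p → 𝟙 (w p ==L x))
      occ-sum x = count-allFin (λ p → w p ==L x)

      appears⇒occ : ∀ x → appears w x ≡ true → occ w (inv x) ≡ 1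
      appears⇒occ x e with ∨-true {not (appears w x)} (all-true c₁ (∈-allLetters x))
      ... | inj₁ ne = ⊥-elim (not-true ne e)
      ... | inj₂ eq = ≡ᵇ⇒≡ _ 1 (Equivalence.from T-≡ eq)

      occ⇒appears : ∀ x → occ w x ≡ 1 → appears w x ≡ true
      occ⇒appears x e with sum≢0⇒∃ {P = λ p → w p ==L x} (λ z → 1+n≢0 {0} (trans (sym e) (trans (occ-sum x) z)))
      ... | p , eq = true-any (∈-allFin p) eq

      appears-inv : ∀ x → appears w x ≡ true → appears w (inv x) ≡ true
      appears-inv x e = occ⇒appears (inv x) (appears⇒occ x e)

      all-appear : ∀ x → appears w x ≡ true
      all-appear (a , s) with ∨-true (all-true (proj₁ (∧-true rest₁)) (∈-allFin a)) | s
      ... | inj₁ e | true  = e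
      ... | inj₁ e | false = appears-inv (a , true) e
      ... | inj₂ e | true  = appears-inv (a , false) e
      ... | inj₂ e | false = e

      occ≡1 : ∀ x → occ w x ≡ 1
      occ≡1 x = subst (λ y → occ w y ≡ 1) (inv-involutive x) (appears⇒occ (inv x) (all-appear (inv x)))

      firstOr-true : ∀ d (p : Fin n → Bool) xs → any p xs ≡ true → p (firstOr w d p xs) ≡ true
      firstOr-true d p (x ∷ xs) e with p x in px
      ... | true  = px
      ... | false = firstOr-true d p xs e

    w-injective : ∀ {p q} → w p ≡ w q → p ≡ q
    w-injective {p} {q} e = sum≡1⇒unique (trans (sym (occ-sum (w q))) (occ≡1 (w q))) (==L-complete e) (==L-complete {x = w q} refl)

    -- Every letter occurs, so the default d is never returned. Hence `τ` and `φ`, which pass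
    -- different defaults, speak of the same positions.
    w-pos : ∀ x d → w (pos w x d) ≡ x
    w-pos x d = ==L-sound (firstOr-true d (λ p → w p ==L x) (allFin n) (all-appear x))

    pos-w : ∀ p d → pos w (w p) d ≡ p
    pos-w p d = w-injective (w-pos (w p) d)

    τ : Fin n → Fin n
    τ x = pos w (inv (w x)) x

    ρ : Fin n → Fin n
    ρ = corner-step w

    w-τ : ∀ x → w (τ x) ≡ inv (w x)
    w-τ x = w-pos (inv (w x)) x

    τ-unique : ∀ {x y} → w y ≡ inv (w x) → τ x ≡ y
    τ-unique {x} e = w-injective (trans (w-τ x) (sym e))

    τ² : ∀ x → τ (τ x) ≡ x
    τ² x = τ-unique (trans (sym (inv-involutive (w x))) (cong inv (sym (w-τ x))))

    τ≢ : ∀ x → τ x ≢ x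
    τ≢ x e = inv≢ (w x) (trans (sym (w-τ x)) (cong w e))

    ρ⁻¹ : Fin n → Fin n
    ρ⁻¹ x = τ (next x)

    ρρ⁻¹ : ∀ x → ρ (ρ⁻¹ x) ≡ x
    ρρ⁻¹ x = trans (cong prev (τ² (next x))) (prev-next x)

    ρ⁻¹ρ : ∀ x → ρ⁻¹ (ρ x) ≡ x
    ρ⁻¹ρ x = trans (cong τ (next-prev (τ x))) (τ² x)

    ρ-injective : ∀ {x y} → ρ x ≡ ρ y → x ≡ y
    ρ-injective {x} {y} e = trans (sym (ρ⁻¹ρ x)) (trans (cong ρ⁻¹ e) (ρ⁻¹ρ y))

    w-next-ρ : ∀ x → w (next (ρ x)) ≡ inv (w x)
    w-next-ρ x = trans (cong w (next-prev (τ x))) (w-τ x)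

    w-ρ⁻¹ : ∀ x → w (ρ⁻¹ x) ≡ inv (w (next x))
    w-ρ⁻¹ x = w-τ (next x)

    -- A corner fixed by ρ would be a vertex of degree 1, where w reads a a⁻¹ against condition (2).
    ρ≢ : ∀ x → ρ x ≢ x
    ρ≢ x e = not-true (all-true (proj₁ (∧-true rest₂)) (∈-allFin x))
      (==L-complete (trans (cong (w ∘ next) (sym e)) (w-next-ρ x)))

    -- A vertex of degree 2 would have the corners a b and b⁻¹ a⁻¹, against condition (3) with p = x
    -- and q = ρ x.
    ρ²≢ : ∀ x → ρ (ρ x) ≢ x
    ρ²≢ x e = not-true (all-true (all-true (proj₂ (∧-true {cond2 w} rest₂)) (∈-allFin x)) (∈-allFin (ρ x)))
      (true-∧ (==L-complete (trans (cong w (trans (sym (ρ⁻¹ρ (ρ x))) (cong ρ⁻¹ e))) (w-ρ⁻¹ x))) (==L-complete (w-next-ρ x)))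

    -- w is a bijection from the positions to the signed letters, here coded by `Fin (e + e)` with
    -- the positive ones first. It links counts over positions to `reversedEdges`, which counts over
    -- letter pairs.
    sum-letters : (F : Fin n → ℕ) → ∀ d → sum F ≡ sum (λ a → F (pos w (a , true) d)) + sum (λ a → F (pos w (a , false) d))
    sum-letters F d = trans (sum-permute F (permutation f f⁻¹ ff⁻¹ f⁻¹f)) (trans (sum-splitAt e (F ∘ f))
      (cong₂ _+_ (sum-cong-≗ (λ a → cong (λ z → F ([ place true , place false ]′ z)) (splitAt-↑ˡ e a e)))
                 (sum-cong-≗ (λ a → cong (λ z → F ([ place true , place false ]′ z)) (splitAt-↑ʳ e e a)))))
      where
      place : Bool → Fin e → Fin n
      place s a = pos w (a , s) d
      f : Fin (e + e) → Fin n
      f i = [ place true , place false ]′ (splitAt e i)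
      code : Letter e → Fin (e + e)
      code (a , true)  = a ↑ˡ e
      code (a , false) = e ↑ʳ a
      f⁻¹ : Fin n → Fin (e + e)
      f⁻¹ x = code (w x)
      f-code : ∀ y → f (code y) ≡ pos w y d
      f-code (a , true)  = cong [ place true , place false ]′ (splitAt-↑ˡ e a e)
      f-code (a , false) = cong [ place true , place false ]′ (splitAt-↑ʳ e e a)
      ff⁻¹ : ∀ x → f (f⁻¹ x) ≡ x
      ff⁻¹ x = trans (f-code (w x)) (pos-w x d)
      f⁻¹f : ∀ i → f⁻¹ (f i) ≡ i
      f⁻¹f i with splitAt e i in eq
      ... | inj₁ a = trans (cong code (w-pos (a , true) d)) (splitAt⁻¹-↑ˡ eq)
      ... | inj₂ a = trans (cong code (w-pos (a , false) d)) (splitAt⁻¹-↑ʳ eq)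

    iter-+ : ∀ a b x → iter w (a + b) x ≡ iter w a (iter w b x)
    iter-+ zero    b x = refl
    iter-+ (suc a) b x = cong ρ (iter-+ a b x)

    iter-injective : ∀ k {x y} → iter w k x ≡ iter w k y → x ≡ y
    iter-injective zero    e = e
    iter-injective (suc k) e = iter-injective k (ρ-injective e)

    sameVertex⇒ : ∀ {i j} → sameVertex w i j ≡ true → ∃ λ k → iter w k i ≡ j
    sameVertex⇒ {i} {j} e with any-true {xs = upTo n} e
    ... | k , _ , eq = k , toℕ-injective (≡ᵇ⇒≡ _ _ (Equivalence.from T-≡ eq))

    ⇒sameVertex : ∀ {i j} k → k < n → iter w k i ≡ j → sameVertex w i j ≡ true
    ⇒sameVertex {i} {j} k k<n e = true-any {xs = upTo n} (∈-upTo⁺ k<n) (Equivalence.to T-≡ (≡⇒≡ᵇ (toℕ (iter w k i)) _ (cong toℕ e)))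

    private
      -- Two of n + 1 iterates coincide, and ρ is injective. The bound c ≤ n matters because
      -- `sameVertex` searches fewer than n iterates.
      period : ∀ x → ∃ λ c → 3 ≤ c × c ≤ n × iter w c x ≡ x
      period x with pigeonhole (n<1+n n) (λ k → iter w (toℕ k) x)
      ... | i , j , i<j , e = c , 3≤c c (m<n⇒0<n∸m i<j) back , ≤-trans (m∸n≤m (toℕ j) (toℕ i)) (≤-pred (toℕ<n j)) , back
        where
        c = toℕ j ∸ toℕ i
        back : iter w c x ≡ x
        back = iter-injective (toℕ i) (trans (sym (iter-+ (toℕ i) c x))
          (trans (cong (λ k → iter w k x) (m+[n∸m]≡n (<⇒≤ i<j))) (sym e)))
        3≤c : ∀ c → 0 < c → iter w c x ≡ x → 3 ≤ c
        3≤c 1 _ e = ⊥-elim (ρ≢ x e)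
        3≤c 2 _ e = ⊥-elim (ρ²≢ x e)
        3≤c (suc (suc (suc _))) _ _ = s≤s (s≤s (s≤s z≤n))

      rep≤ : ∀ {x y} → isVertexRep w x ≡ true → sameVertex w x y ≡ true → toℕ x ≤ toℕ y
      rep≤ {x} {y} r s with ∨-true (all-true r (∈-allFin y))
      ... | inj₁ ns = ⊥-elim (not-true ns s)
      ... | inj₂ le = ≤ᵇ⇒≤ _ _ (Equivalence.from T-≡ le)

      rep-unique : ∀ {x} k → 1 ≤ k → k ≤ 3 → k < n → isVertexRep w x ≡ true → isVertexRep w (iter w k x) ≡ true → iter w k x ≡ x
      rep-unique {x} k 1≤k k≤3 k<n r r′ with period x
      ... | c , 3≤c , c≤n , e = toℕ-injective (≤-antisym
        -- From the k-th iterate, c - k further steps lead back to x; 1 ≤ k keeps this number within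
        -- the range of `sameVertex`.
        (rep≤ r′ (⇒sameVertex (c ∸ k) (<-≤-trans (m∸n<c 1≤k (≤-trans (s≤s z≤n) 3≤c)) c≤n)
          (trans (sym (iter-+ (c ∸ k) k x)) (trans (cong (λ z → iter w z x) (m∸n+n≡m (≤-trans k≤3 3≤c))) e))))
        (rep≤ r (⇒sameVertex k k<n refl)))
        where
        m∸n<c : ∀ {k c} → 1 ≤ k → 1 ≤ c → c ∸ k < c
        m∸n<c {suc k} {suc c} _ _ = s≤s (m∸n≤m c k)

    -- Every cycle of ρ has length at least 3; as there are n / 3 of them, each has length exactly 3.
    ρ³ : 3 < n → 3 * numVertices w ≡ n → ∀ x → ρ (ρ (ρ x)) ≡ x
    ρ³ 3<n 3V≡n x = at-rep (find x)
      where
      V : Fin n → ℕ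
      V x = 𝟙 (isVertexRep w x)
      here≤1 : ∀ x → V x + (V (ρ x) + V (ρ (ρ x))) ≤ 1
      here≤1 x with isVertexRep w x in r₀ | isVertexRep w (ρ x) in r₁ | isVertexRep w (ρ (ρ x)) in r₂
      ... | true  | true  | _     = ⊥-elim (ρ≢ x (rep-unique 1 ≤-refl (s≤s z≤n) (<-trans (s≤s (s≤s z≤n)) 3<n) r₀ r₁))
      ... | true  | false | true  = ⊥-elim (ρ²≢ x (rep-unique 2 (s≤s z≤n) (s≤s (s≤s z≤n)) (<-trans (s≤s (s≤s (s≤s z≤n))) 3<n) r₀ r₂))
      ... | true  | false | false = ≤-refl
      ... | false | true  | true  = ⊥-elim (ρ≢ (ρ x) (rep-unique 1 ≤-refl (s≤s z≤n) (<-trans (s≤s (s≤s z≤n)) 3<n) r₁ r₂))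
      ... | false | true  | false = ≤-refl
      ... | false | false | true  = ≤-refl
      ... | false | false | false = z≤n
      total : sum (λ x → V x + (V (ρ x) + V (ρ (ρ x)))) ≡ sum {n} (λ _ → 1)
      total = begin
        sum (λ x → V x + (V (ρ x) + V (ρ (ρ x))))      ≡⟨ trans (∑-distrib-+ V _) (cong (sum V +_) (∑-distrib-+ (V ∘ ρ) (V ∘ ρ ∘ ρ))) ⟩
        sum V + (sum (V ∘ ρ) + sum (V ∘ ρ ∘ ρ))        ≡⟨ cong (sum V +_) (cong₂ _+_ (sum-reindex ρ ρ⁻¹ ρρ⁻¹ ρ⁻¹ρ V)
                                                            (trans (sum-reindex ρ ρ⁻¹ ρρ⁻¹ ρ⁻¹ρ V) (sum-reindex ρ ρ⁻¹ ρρ⁻¹ ρ⁻¹ρ (V ∘ ρ)))) ⟨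
        sum V + (sum V + sum V)                        ≡⟨ cong (λ z → sum V + (sum V + z)) (+-identityʳ (sum V)) ⟨
        3 * sum V                                      ≡⟨ cong (3 *_) (count-allFin (isVertexRep w)) ⟨
        3 * numVertices w                              ≡⟨ 3V≡n ⟩
        n                                              ≡⟨ trans (sum-const n 1) (*-identityʳ n) ⟨
        sum {n} (λ _ → 1)                              ∎
        where open ≡-Reasoning
      find : ∀ x → isVertexRep w x ≡ true ⊎ isVertexRep w (ρ x) ≡ true ⊎ isVertexRep w (ρ (ρ x)) ≡ true
      find x with isVertexRep w x | isVertexRep w (ρ x) | isVertexRep w (ρ (ρ x)) | sum-tight here≤1 total x
      ... | true  | _     | _     | _ = inj₁ refl
      ... | false | true  | _     | _ = inj₂ (inj₁ refl)
      ... | false | false | true  | _ = inj₂ (inj₂ refl)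
      cycle : ∀ {x} → isVertexRep w x ≡ true → ρ (ρ (ρ x)) ≡ x
      cycle {x} r with find (ρ x)
      ... | inj₁ r₁        = ⊥-elim (ρ≢ x (rep-unique 1 ≤-refl (s≤s z≤n) (<-trans (s≤s (s≤s z≤n)) 3<n) r r₁))
      ... | inj₂ (inj₁ r₂) = ⊥-elim (ρ²≢ x (rep-unique 2 (s≤s z≤n) (s≤s (s≤s z≤n)) (<-trans (s≤s (s≤s (s≤s z≤n))) 3<n) r r₂))
      ... | inj₂ (inj₂ r₃) = rep-unique 3 (s≤s z≤n) ≤-refl 3<n r r₃
      at-rep : isVertexRep w x ≡ true ⊎ isVertexRep w (ρ x) ≡ true ⊎ isVertexRep w (ρ (ρ x)) ≡ true → ρ (ρ (ρ x)) ≡ x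
      at-rep (inj₁ r)        = cycle r
      at-rep (inj₂ (inj₁ r)) = ρ-injective (cycle r)
      at-rep (inj₂ (inj₂ r)) = ρ-injective (ρ-injective (cycle r))

  clash : ∀ {b} → b ≡ true → b ≡ false → ⊥
  clash refl ()

  does⇒ : ∀ {A : Set} (a? : Dec A) → does a? ≡ true → A
  does⇒ (yes a) _ = a

  ≡ᵇ-sound : ∀ {a b} → (a ≡ᵇ b) ≡ true → a ≡ b
  ≡ᵇ-sound e = ≡ᵇ⇒≡ _ _ (Equivalence.from T-≡ e)

  ≡ᵇ-complete : ∀ {a b} → a ≡ b → (a ≡ᵇ b) ≡ true
  ≡ᵇ-complete {a} {b} e = Equivalence.to T-≡ (≡⇒≡ᵇ a b e)

  ≤ᵇ-sound : ∀ {a b} → (a ≤ᵇ b) ≡ true → a ≤ b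
  ≤ᵇ-sound {a} {b} e = ≤ᵇ⇒≤ a b (Equivalence.from T-≡ e)

  module _ {n e : ℕ} (w : Word n e) where

    triples-true : ∀ {P} → triples w P ≡ true → ∃ λ p → ∃ λ q → ∃ λ r → P p q r ≡ true
    triples-true e with any-true {xs = allFin n} e
    ... | p , _ , e₁ with any-true {xs = allFin n} e₁
    ...   | q , _ , e₂ with any-true {xs = allFin n} e₂
    ...     | r , _ , e₃ = p , q , r , e₃

    true-triples : ∀ {P} p q r → P p q r ≡ true → triples w P ≡ true
    true-triples p q r e = true-any {xs = allFin n} (∈-allFin p) (true-any {xs = allFin n} (∈-allFin q) (true-any {xs = allFin n} (∈-allFin r) e))

    cycInc-rotate : ∀ p q r → cycInc w p q r ≡ cycInc w q r p
    cycInc-rotate p q r = go (_<F_ w p q) (_<F_ w q r) (_<F_ w r p)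
      where
      go : ∀ a b c → (a ∧ b) ∨ (b ∧ c) ∨ (c ∧ a) ≡ (b ∧ c) ∨ (c ∧ a) ∨ (a ∧ b)
      go true  true  true  = refl
      go true  true  false = refl
      go true  false true  = refl
      go true  false false = refl
      go false true  true  = refl
      go false true  false = refl
      go false false true  = refl
      go false false false = refl

    cycInc-< : ∀ {p q r} → toℕ p < toℕ q → toℕ q < toℕ r → cycInc w p q r ≡ true × cycInc w p r q ≡ false
    cycInc-< {p} {q} {r} p<q q<r rewrite <ᵇ-true p<q | <ᵇ-true q<r | <ᵇ-false (<⇒≤ q<r) | <ᵇ-false (<⇒≤ p<q)
                                       | <ᵇ-true (<-trans p<q q<r) = refl , refl

    -- Of the excluded exponents only 1 is kept; since the orders in question, 2 and 3, are prime, a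
    -- nontrivial shift whose d-th power is trivial has order d.
    hasOrder-true : ∀ {k d} → 2 ≤ d → hasOrder w k d ≡ true → n ∣ d * toℕ k × ¬ (n ∣ toℕ k)
    hasOrder-true {k} {d} 2≤d e = does⇒ (n ∣? d * toℕ k) (proj₁ (∧-true e₁)) , λ n∣k →
        [ (λ ()) , (λ ne → not-true ne (dec-true (n ∣? 1 * toℕ k) (subst (n ∣_) (sym (+-identityʳ _)) n∣k))) ]′
        (∨-true {1 ≡ᵇ 0} (all-true {xs = upTo d} (proj₂ (∧-true {does (n ∣? d * toℕ k)} e₁)) (∈-upTo⁺ 2≤d)))
      where
      e₁ = proj₂ (∧-true {1 ≤ᵇ d} e)

    true-hasOrder : ∀ {k d} → 1 ≤ d → n ∣ d * toℕ k → (∀ c → 1 ≤ c → c < d → ¬ (n ∣ c * toℕ k)) → hasOrder w k d ≡ true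
    true-hasOrder {k} {d} 1≤d n∣ n∤ = true-∧ (≤ᵇ-true 1≤d) (true-∧ (dec-true (n ∣? d * toℕ k) n∣)
        (true-all {xs = upTo d} (λ {c} c∈ → go c (∈-upTo⁻ c∈))))
      where
      go : ∀ c → c < d → (c ≡ᵇ 0) ∨ not (does (n ∣? c * toℕ k)) ≡ true
      go zero    _   = refl
      go (suc c) c<d = cong not (dec-false (n ∣? suc c * toℕ k) (n∤ (suc c) (s≤s z≤n) c<d))

  -- Vertices, signs and automorphisms of a maximal form.

  module MaximalForm {n e : ℕ} .{{_ : NonZero n}} (w : Word n e) (wicks : isWicks w ≡ true)
    (M : ℕ) .{{_ : NonZero M}} (n≡6M : n ≡ 6 * M) (3V≡n : 3 * numVertices w ≡ n) where

    open WicksForm w wicks hiding (ρ³)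

    private
      3<n : 3 < n
      3<n = subst (3 <_) (sym n≡6M) (≤-trans (s≤s (s≤s (s≤s (s≤s z≤n)))) (*-monoʳ-≤ 6 (>-nonZero⁻¹ M)))

      ρ³ : ∀ x → ρ (ρ (ρ x)) ≡ x
      ρ³ = WicksForm.ρ³ w wicks 3<n 3V≡n

      ρ≡ : ∀ x → ρ x ≡ prev (τ x)
      ρ≡ x = refl

    open CubicMap τ ρ τ² ρ³ ρ≡ τ≢ ρ≢ M n≡6M public
    open AutCount τ ρ τ² ρ³ ρ≡ τ≢ ρ≢ M n≡6M public
    open Reps ρ ρ³ using (rep; sum-ρ; rep-nonfixed)

    -- `φ` takes the letter at p to the letter at p + k. Compatibility with inverses at that letter
    -- says that the letter at τ p + k is inverse to the letter at p + k, that is, τ (p + k) = τ p +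
    -- k.
    isAut≡ : ∀ k → isAut w k ≡ does (aut? (toℕ k))
    isAut≡ k = ≡-by-true
      (λ h → dec-true (aut? K) (λ p → τ-unique (subst₂ (λ u v → w (shift K u) ≡ inv (w (shift K v))) (τ-pos p) (pos-w p k)
        (==L-sound (all-true {xs = allLetters e} h (∈-allLetters (w p)))))))
      (λ h → true-all {xs = allLetters e} (λ {x} _ → ==L-complete (begin
        w (shift K (pos w (inv x) k))              ≡⟨ cong (λ z → w (shift K (pos w (inv z) k))) (w-pos x k) ⟨
        w (shift K (pos w (inv (w (pos w x k))) k)) ≡⟨ cong (w ∘ shift K) (τ-pos (pos w x k)) ⟩
        w (shift K (τ (pos w x k)))                ≡⟨ cong w (does⇒ (aut? K) h (pos w x k)) ⟨
        w (τ (shift K (pos w x k)))                ≡⟨ w-τ _ ⟩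
        inv (w (shift K (pos w x k)))              ∎)))
      where
      open ≡-Reasoning
      K = toℕ k
      τ-pos : ∀ p → pos w (inv (w p)) k ≡ τ p
      τ-pos p = w-injective (trans (w-pos (inv (w p)) k) (sym (w-τ p)))

    autOrder≡ : autOrder w ≡ 1 + 2 * 𝟙 (does (aut? (2 * M))) + 𝟙 (does (aut? (3 * M))) + 2 * 𝟙 (does (aut? (2 * M)) ∧ does (aut? (3 * M)))
    autOrder≡ = begin
      suc (count nontrivial (allFin n))                           ≡⟨ cong suc (count-allFin nontrivial) ⟩
      1 + sum (𝟙 ∘ nontrivial)                                    ≡⟨ cong (_+ sum (𝟙 ∘ nontrivial)) one ⟨
      sum {n} (λ k → 𝟙 (toℕ k ≡ᵇ 0)) + sum (𝟙 ∘ nontrivial)           ≡⟨ ∑-distrib-+ {n} (λ k → 𝟙 (toℕ k ≡ᵇ 0)) (𝟙 ∘ nontrivial) ⟨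
      sum {n} (λ k → 𝟙 (toℕ k ≡ᵇ 0) + 𝟙 (nontrivial k))               ≡⟨ sum-cong-≗ split ⟨
      sum {n} (λ k → 𝟙 (does (aut? (toℕ k))))                     ≡⟨ automorphisms ⟩
      1 + 2 * 𝟙 (does (aut? (2 * M))) + 𝟙 (does (aut? (3 * M))) + 2 * 𝟙 (does (aut? (2 * M)) ∧ does (aut? (3 * M))) ∎
      where
      open ≡-Reasoning
      nontrivial : Fin n → Bool
      nontrivial k = not (toℕ k ≡ᵇ 0) ∧ isAut w k
      o : Fin n
      o = Fin.fromℕ< (>-nonZero⁻¹ n)
      one : sum {n} (λ k → 𝟙 (toℕ k ≡ᵇ 0)) ≡ 1
      one = trans (sum-single o _ (λ k k≢o → nonzero (toℕ k) (λ e → k≢o (toℕ-injective (trans e (sym (toℕ-fromℕ< _))))))) (cong (λ z → 𝟙 (z ≡ᵇ 0)) (toℕ-fromℕ< (>-nonZero⁻¹ n)))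
        where
        nonzero : ∀ m → m ≢ 0 → 𝟙 (m ≡ᵇ 0) ≡ 0
        nonzero zero    ne = ⊥-elim (ne refl)
        nonzero (suc m) ne = refl
      split : ∀ k → 𝟙 (does (aut? (toℕ k))) ≡ 𝟙 (toℕ k ≡ᵇ 0) + 𝟙 (nontrivial k)
      split k rewrite isAut≡ k = go (toℕ k)
        where
        go : ∀ K → 𝟙 (does (aut? K)) ≡ 𝟙 (K ≡ᵇ 0) + 𝟙 (not (K ≡ᵇ 0) ∧ does (aut? K))
        go zero    = cong 𝟙 (dec-true (aut? 0) (aut-multiple (n ∣0)))
        go (suc _) = refl

    reversedEdges-double : ∀ k → n ∣ 2 * toℕ k → sum (𝟙 ∘ like τ (toℕ k)) ≡ 2 * reversedEdges w k
    reversedEdges-double k n∣2K = begin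
      sum (𝟙 ∘ like τ K)                                                       ≡⟨ sum-letters (𝟙 ∘ like τ K) k ⟩
      sum (λ a → 𝟙 (like τ K (at a))) + sum (λ a → 𝟙 (like τ K (pos w (a , false) k)))
        ≡⟨ cong₂ _+_ (sum-cong-≗ (λ a → cong 𝟙 (same a))) (trans (sum-cong-≗ (λ a → cong 𝟙 (trans (other a) (same a)))) (sym (+-identityʳ _))) ⟩
      2 * sum (λ a → 𝟙 (φ w K (a , true) k ==L (a , false)))                   ≡⟨ cong (2 *_) (count-allFin (λ a → φ w K (a , true) k ==L (a , false))) ⟨
      2 * reversedEdges w k                                                    ∎
      where
      open ≡-Reasoning
      K = toℕ k
      at : Fin e → Fin n
      at a = pos w (a , true) k
      same : ∀ a → like τ K (at a) ≡ (φ w K (a , true) k ==L (a , false))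
      same a = ≡-by-true
        (λ h → ==L-complete (trans (cong w (sym (does⇒ (_ Fin.≟ _) h))) (trans (w-τ (at a)) (cong inv (w-pos (a , true) k)))))
        (λ h → dec-true (_ Fin.≟ _) (τ-unique (trans (==L-sound h) (cong inv (sym (w-pos (a , true) k))))))
      twice : ∀ x → shift K (shift K x) ≡ x
      twice x = trans (shift-∘ K K x) (shift-multiple (subst (n ∣_) (cong (K +_) (+-identityʳ K)) n∣2K) x)
      -- As n ∣ 2K the shift is its own inverse, so the condition at one letter of an edge carries
      -- over to the other.
      flip : ∀ x → τ x ≡ shift K x → τ (τ x) ≡ shift K (τ x)
      flip x e = trans (τ² x) (trans (sym (twice x)) (cong (shift K) (sym e)))
      other : ∀ a → like τ K (pos w (a , false) k) ≡ like τ K (at a)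
      other a = trans (cong (like τ K) (sym (τ-unique (trans (w-pos (a , false) k) (cong inv (sym (w-pos (a , true) k)))))))
        (does-⇔ (_ Fin.≟ _) (_ Fin.≟ _) (λ h → subst (λ z → τ z ≡ shift K z) (τ² (at a)) (flip (τ (at a)) h)) (flip (at a)))

    private
      Orbit : Fin n → Fin n → Set
      Orbit i j = j ≡ i ⊎ j ≡ ρ i ⊎ j ≡ ρ (ρ i)

      orbit-iter : ∀ i k → Orbit i (iter w k i)
      orbit-iter i zero = inj₁ refl
      orbit-iter i (suc k) with orbit-iter i k
      ... | inj₁ e        = inj₂ (inj₁ (cong ρ e))
      ... | inj₂ (inj₁ e) = inj₂ (inj₂ (cong ρ e))
      ... | inj₂ (inj₂ e) = inj₁ (trans (cong ρ e) (ρ³ i))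

      sameVertex⇒orbit : ∀ {i j} → sameVertex w i j ≡ true → Orbit i j
      sameVertex⇒orbit {i} e with sameVertex⇒ e
      ... | k , refl = orbit-iter i k

      orbit⇒sameVertex : ∀ {i j} → Orbit i j → sameVertex w i j ≡ true
      orbit⇒sameVertex (inj₁ refl)        = ⇒sameVertex 0 (<-trans (s≤s z≤n) 3<n) refl
      orbit⇒sameVertex (inj₂ (inj₁ refl)) = ⇒sameVertex 1 (<-trans (s≤s (s≤s z≤n)) 3<n) refl
      orbit⇒sameVertex (inj₂ (inj₂ refl)) = ⇒sameVertex 2 (<-trans (s≤s (s≤s (s≤s z≤n))) 3<n) refl

      rep-true : ∀ i → rep i ≡ true → toℕ i ≤ toℕ (ρ i) × toℕ i ≤ toℕ (ρ (ρ i))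
      rep-true i e with ∧-true {toℕ i ≤ᵇ toℕ (ρ i)} e
      ... | a , b = ≤ᵇ-sound {toℕ i} a , ≤ᵇ-sound {toℕ i} b

      isVertexRep≡rep : ∀ i → isVertexRep w i ≡ rep i
      isVertexRep≡rep i = ≡-by-true
        (λ h → true-∧ (≤ᵇ-true (least h (inj₂ (inj₁ refl)))) (≤ᵇ-true (least h (inj₂ (inj₂ refl)))))
        (λ h → true-all {xs = allFin n} (λ {j} _ → conclude (rep-true i h) j))
        where
        least : isVertexRep w i ≡ true → ∀ {j} → Orbit i j → toℕ i ≤ toℕ j
        least h {j} o with ∨-true {not (sameVertex w i j)} (all-true {xs = allFin n} h (∈-allFin j))
        ... | inj₁ ns = ⊥-elim (not-true ns (orbit⇒sameVertex o))
        ... | inj₂ le = ≤ᵇ-sound {toℕ i} le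
        conclude : toℕ i ≤ toℕ (ρ i) × toℕ i ≤ toℕ (ρ (ρ i)) → ∀ j → not (sameVertex w i j) ∨ (toℕ i ≤ᵇ toℕ j) ≡ true
        conclude (a , b) j with sameVertex w i j in eq
        ... | false = refl
        ... | true with sameVertex⇒orbit {i} {j} eq
        ...   | inj₁ refl        = ≤ᵇ-true (≤-refl {toℕ i})
        ...   | inj₂ (inj₁ refl) = ≤ᵇ-true a
        ...   | inj₂ (inj₂ refl) = ≤ᵇ-true b

      ρ⁻¹≡ρ² : ∀ x → ρ⁻¹ x ≡ ρ (ρ x)
      ρ⁻¹≡ρ² x = ρ-injective (trans (ρρ⁻¹ x) (sym (ρ³ x)))

      -- The letter that is inverse to the one after p stands at ρ⁻¹ p, and ρ⁻¹ = ρ².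
      previous : ∀ {p q} → (w q ==L inv (w (next p))) ≡ true → q ≡ ρ (ρ p)
      previous {p} {q} e = trans (w-injective (trans (==L-sound e) (sym (w-ρ⁻¹ p)))) (ρ⁻¹≡ρ² p)

      true-previous : ∀ {p q} → q ≡ ρ (ρ p) → (w q ==L inv (w (next p))) ≡ true
      true-previous {p} e = ==L-complete (trans (cong w (trans e (sym (ρ⁻¹≡ρ² p)))) (w-ρ⁻¹ p))

      -- Solving the three equations between letters in the definitions of the signs: at a positive
      -- vertex w meets the corners in the cyclic order opposite to ρ, at a negative one in the
      -- order of ρ.
      descends ascends : Fin n → Bool
      descends i = cycInc w i (ρ (ρ i)) (ρ i)
      ascends i = cycInc w i (ρ i) (ρ (ρ i))

      descends-ρ : ∀ i → descends (ρ i) ≡ descends i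
      descends-ρ i rewrite ρ³ i = cycInc-rotate w (ρ i) i (ρ (ρ i))

      ascends-ρ : ∀ i → ascends (ρ i) ≡ ascends i
      ascends-ρ i rewrite ρ³ i = sym (cycInc-rotate w i (ρ i) (ρ (ρ i)))

      on-orbit : (P : Fin n → Bool) → (∀ i → P (ρ i) ≡ P i) → ∀ {i j} → Orbit i j → P j ≡ P i
      on-orbit P P-ρ (inj₁ refl)            = refl
      on-orbit P P-ρ {i} (inj₂ (inj₁ refl)) = P-ρ i
      on-orbit P P-ρ {i} (inj₂ (inj₂ refl)) = trans (P-ρ (ρ i)) (P-ρ i)

      isPositive≡ : ∀ i → isPositive w i ≡ descends i
      isPositive≡ i = ≡-by-true to from
        where
        to : isPositive w i ≡ true → descends i ≡ true
        to h with triples-true w h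
        ... | p , q , r , h₁ with ∧-true {sameVertex w i p} h₁
        ...   | sp , h₂ with ∧-true {sameVertex w i r} (proj₂ (∧-true {sameVertex w i q} h₂))
        ...     | _ , h₃ with ∧-true {cycInc w p q r} h₃
        ...       | cyc , h₄ with ∧-true {w q ==L inv (w (next p))} h₄
        ...         | hq , h₅ with previous hq | previous (proj₁ (∧-true {w r ==L inv (w (next q))} h₅))
        ...           | refl | refl = trans (sym (on-orbit descends descends-ρ (sameVertex⇒orbit sp)))
                                        (subst (λ z → cycInc w p (ρ (ρ p)) z ≡ true) (cong ρ (ρ³ p)) cyc)
        from : descends i ≡ true → isPositive w i ≡ true
        from h = true-triples w i (ρ (ρ i)) (ρ i) (true-∧ (orbit⇒sameVertex (inj₁ refl)) (true-∧ (orbit⇒sameVertex (inj₂ (inj₂ refl)))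
          (true-∧ (orbit⇒sameVertex (inj₂ (inj₁ refl))) (true-∧ h (true-∧ (true-previous refl)
          (true-∧ (true-previous (sym (cong ρ (ρ³ i)))) (true-previous (sym (ρ³ i)))))))))

      isNegative≡ : ∀ i → isNegative w i ≡ ascends i
      isNegative≡ i = ≡-by-true to from
        where
        following : ∀ {p q} → (w (next q) ==L inv (w p)) ≡ true → q ≡ ρ p
        following {p} {q} e = trans (sym (prev-next q)) (trans (cong prev (w-injective (trans (==L-sound e) (sym (w-next-ρ p))))) (prev-next (ρ p)))
        to : isNegative w i ≡ true → ascends i ≡ true
        to h with triples-true w h
        ... | p , q , r , h₁ with ∧-true {sameVertex w i p} h₁
        ...   | sp , h₂ with ∧-true {sameVertex w i r} (proj₂ (∧-true {sameVertex w i q} h₂))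
        ...     | _ , h₃ with ∧-true {cycInc w p q r} h₃
        ...       | cyc , h₄ with ∧-true {w (next q) ==L inv (w p)} h₄
        ...         | hq , h₅ with following hq | previous (proj₁ (∧-true {w r ==L inv (w (next p))} h₅))
        ...           | refl | refl = trans (sym (on-orbit ascends ascends-ρ (sameVertex⇒orbit sp))) cyc
        from : ascends i ≡ true → isNegative w i ≡ true
        from h = true-triples w i (ρ i) (ρ (ρ i)) (true-∧ (orbit⇒sameVertex (inj₁ refl)) (true-∧ (orbit⇒sameVertex (inj₂ (inj₁ refl)))
          (true-∧ (orbit⇒sameVertex (inj₂ (inj₂ refl))) (true-∧ h (true-∧ (==L-complete (w-next-ρ i))
          (true-∧ (true-previous refl) (true-previous (sym (cong ρ (ρ³ i))))))))))

      -- ρ has no fixed points, so `rep` picks one corner in three.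
      third : (P : Fin n → Bool) → (∀ x → P (ρ x) ≡ P x) → sum (𝟙 ∘ P) ≡ 3 * sum (λ x → 𝟙 (rep x ∧ P x))
      third P P-ρ = begin
        sum (𝟙 ∘ P)                                   ≡⟨ sum-cong-≗ split ⟩
        sum (λ x → F x + (F (ρ x) + F (ρ (ρ x))))     ≡⟨ trans (∑-distrib-+ F _) (cong (sum F +_) (∑-distrib-+ (F ∘ ρ) (F ∘ ρ ∘ ρ))) ⟩
        sum F + (sum (F ∘ ρ) + sum (F ∘ ρ ∘ ρ))       ≡⟨ cong (sum F +_) (cong₂ _+_ (sum-ρ F) (trans (sum-ρ F) (sum-ρ (F ∘ ρ)))) ⟨
        sum F + (sum F + sum F)                       ≡⟨ cong (λ z → sum F + (sum F + z)) (+-identityʳ (sum F)) ⟨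
        3 * sum F                                     ∎
        where
        open ≡-Reasoning
        F : Fin n → ℕ
        F x = 𝟙 (rep x ∧ P x)
        weigh : ∀ a b c p → 𝟙 a + (𝟙 b + 𝟙 c) ≡ 1 → 𝟙 p ≡ 𝟙 (a ∧ p) + (𝟙 (b ∧ p) + 𝟙 (c ∧ p))
        weigh true  false false true  _ = refl
        weigh false true  false true  _ = refl
        weigh false false true  true  _ = refl
        weigh true  true  true  false _ = refl
        weigh true  true  false false _ = refl
        weigh true  false true  false _ = refl
        weigh true  false false false _ = refl
        weigh false true  true  false _ = refl
        weigh false true  false false _ = refl
        weigh false false true  false _ = refl
        weigh false false false false _ = refl
        split : ∀ x → 𝟙 (P x) ≡ F x + (F (ρ x) + F (ρ (ρ x)))
        split x = trans (weigh (rep x) (rep (ρ x)) (rep (ρ (ρ x))) (P x) (rep-nonfixed x (ρ≢ x)))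
          (cong₂ (λ u v → F x + (𝟙 (rep (ρ x) ∧ u) + 𝟙 (rep (ρ (ρ x)) ∧ v))) (sym (P-ρ x)) (sym (trans (P-ρ (ρ x)) (P-ρ x))))

    -- Signs of the vertices fixed by an automorphism of order 3.

    module OrderThree (aut : Aut (2 * M)) where

      private
        s₂ s₄ : Fin n → Fin n
        s₂ = shift (2 * M)
        s₄ = shift (4 * M)

        s₂s₂ : ∀ x → s₂ (s₂ x) ≡ s₄ x
        s₂s₂ x = trans (shift-∘ (2 * M) (2 * M) x) (cong (λ z → shift z x) (sym (*-distribʳ-+ M 2 2)))

        s₂s₄ : ∀ x → s₂ (s₄ x) ≡ x
        s₂s₄ x = trans (shift-∘ (2 * M) (4 * M) x) (shift-multiple (∣-reflexive (trans n≡6M (*-distribʳ-+ M 2 4))) x)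

        s₄s₄ : ∀ x → s₄ (s₄ x) ≡ s₂ x
        s₄s₄ x = trans (sym (s₂s₂ (s₄ x))) (cong s₂ (s₂s₄ x))

        ρs₂ : ∀ x → ρ (s₂ x) ≡ s₂ (ρ x)
        ρs₂ x = trans (cong prev (aut x)) (sym (shift-prev (2 * M) (τ x)))

        ρs₄ : ∀ x → ρ (s₄ x) ≡ s₄ (ρ x)
        ρs₄ x = trans (cong ρ (sym (s₂s₂ x))) (trans (ρs₂ (s₂ x)) (trans (cong s₂ (ρs₂ x)) (s₂s₂ (ρ x))))

        rising² : ∀ {i} → ρ i ≡ s₂ i → ρ (ρ i) ≡ s₄ i
        rising² {i} e = trans (cong ρ e) (trans (ρs₂ i) (trans (cong s₂ e) (s₂s₂ i)))

        falling² : ∀ {i} → ρ i ≡ s₄ i → ρ (ρ i) ≡ s₂ i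
        falling² {i} e = trans (cong ρ e) (trans (ρs₄ i) (trans (cong s₄ e) (s₄s₄ i)))

        like-ρ : ∀ k → (∀ x → ρ (shift k x) ≡ shift k (ρ x)) → ∀ x → like ρ k (ρ x) ≡ like ρ k x
        like-ρ k eqv x = does-⇔ (_ Fin.≟ _) (_ Fin.≟ _)
          (λ h → subst (λ z → ρ z ≡ shift k z) (ρ³ x) (step (ρ (ρ x)) (step (ρ x) h))) (step x)
          where
          step : ∀ x → ρ x ≡ shift k x → ρ (ρ x) ≡ shift k (ρ x)
          step x e = trans (cong ρ e) (eqv x)

        0<2M : 0 < 2 * M
        0<2M = >-nonZero⁻¹ (2 * M) {{m*n≢0 2 M}}

        n≡2M+4M : n ≡ 2 * M + 4 * M
        n≡2M+4M = trans n≡6M (*-distribʳ-+ M 2 4)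

        -- The least of the corners i, i + n/3, i + 2n/3 is less than n/3.
        ordered : ∀ i → toℕ i ≤ toℕ (s₄ i) → toℕ i < toℕ (s₂ i) × toℕ (s₂ i) < toℕ (s₄ i)
        ordered i i≤s₄ = subst (toℕ i <_) (sym e₂) (m<m+n (toℕ i) 0<2M) ,
                subst₂ _<_ (sym e₂) (sym e₄) (+-monoʳ-< (toℕ i) 2M<4M)
          where
          2M<4M : 2 * M < 4 * M
          2M<4M = *-monoˡ-< M {2} {4} (s≤s (s≤s (s≤s z≤n)))
          i<2M : toℕ i < 2 * M
          i<2M = ≰⇒> (λ 2M≤i → <⇒≱ (shift-wraps {n} {4 * M} {2 * M} i n≡2M+4M 0<2M 2M≤i) i≤s₄)
          i+4M<n : toℕ i + 4 * M < n
          i+4M<n = subst (toℕ i + 4 * M <_) (sym n≡2M+4M) (+-monoˡ-< (4 * M) i<2M)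
          e₄ : toℕ (s₄ i) ≡ toℕ i + 4 * M
          e₄ = trans (toℕ-shift (4 * M) i) (m<n⇒m%n≡m i+4M<n)
          e₂ : toℕ (s₂ i) ≡ toℕ i + 2 * M
          e₂ = trans (toℕ-shift (2 * M) i) (m<n⇒m%n≡m (<-trans (+-monoʳ-< (toℕ i) 2M<4M) i+4M<n))

        s₂≢ : ∀ i → s₂ i ≢ i
        s₂≢ i e = <⇒≱ (subst (2 * M <_) (trans (+-comm (4 * M) (2 * M)) (sym n≡2M+4M)) (m<n+m (2 * M) 0<4M))
                      (∣⇒≤ {{>-nonZero 0<2M}} (shift-fixed i e))
          where
          0<4M : 0 < 4 * M
          0<4M = >-nonZero⁻¹ (4 * M) {{m*n≢0 4 M}}

        s₄≢ : ∀ i → s₄ i ≢ i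
        s₄≢ i e = s₂≢ i (trans (cong s₂ (sym e)) (s₂s₄ i))

        ρ⁴ : ∀ i → ρ (ρ (ρ (ρ i))) ≡ ρ i
        ρ⁴ i = cong ρ (ρ³ i)

        -- If the shift agrees with ρ² at i, then ρ = ρ⁴ agrees with its square there, because the
        -- shift commutes with ρ.
        moved : ∀ i K → K ≡ 2 * M ⊎ K ≡ 4 * M → Orbit i (shift K i) → ρ i ≡ s₂ i ⊎ ρ i ≡ s₄ i
        moved i _ (inj₁ refl) (inj₁ e)        = ⊥-elim (s₂≢ i e)
        moved i _ (inj₁ refl) (inj₂ (inj₁ e)) = inj₁ (sym e)
        moved i _ (inj₁ refl) (inj₂ (inj₂ e)) = inj₂ (trans (sym (ρ⁴ i)) (trans (cong (ρ ∘ ρ) (sym e))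
          (trans (cong ρ (ρs₂ i)) (trans (ρs₂ (ρ i)) (trans (cong s₂ (sym e)) (s₂s₂ i))))))
        moved i _ (inj₂ refl) (inj₁ e)        = ⊥-elim (s₄≢ i e)
        moved i _ (inj₂ refl) (inj₂ (inj₁ e)) = inj₂ (sym e)
        moved i _ (inj₂ refl) (inj₂ (inj₂ e)) = inj₁ (trans (sym (ρ⁴ i)) (trans (cong (ρ ∘ ρ) (sym e))
          (trans (cong ρ (ρs₄ i)) (trans (ρs₄ (ρ i)) (trans (cong s₄ (sym e)) (s₄s₄ i))))))

        rising-orbit : ∀ i K → K ≡ 2 * M ⊎ K ≡ 4 * M → ρ i ≡ s₂ i → Orbit i (shift K i)
        rising-orbit i _ (inj₁ refl) e = inj₂ (inj₁ (sym e))
        rising-orbit i _ (inj₂ refl) e = inj₂ (inj₂ (sym (rising² e)))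

        falling-orbit : ∀ i K → K ≡ 2 * M ⊎ K ≡ 4 * M → ρ i ≡ s₄ i → Orbit i (shift K i)
        falling-orbit i _ (inj₁ refl) e = inj₂ (inj₂ (sym (falling² e)))
        falling-orbit i _ (inj₂ refl) e = inj₂ (inj₁ (sym e))

        -- At the least corner of the vertex the shifts by n/3 and 2n/3 do not wrap, so the cyclic
        -- order of the corners can be read from their plain order.
        rising-order : ∀ i → rep i ≡ true → ρ i ≡ s₂ i → ascends i ≡ true × descends i ≡ false
        rising-order i r e = subst₂ (λ u v → cycInc w i u v ≡ true × cycInc w i v u ≡ false) (sym e) (sym (rising² e))
          (cycInc-< w {i} {s₂ i} {s₄ i} (proj₁ o) (proj₂ o))
          where
          o = ordered i (subst (λ z → toℕ i ≤ toℕ z) (rising² e) (proj₂ (rep-true i r)))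

        falling-order : ∀ i → rep i ≡ true → ρ i ≡ s₄ i → descends i ≡ true × ascends i ≡ false
        falling-order i r e = subst₂ (λ u v → cycInc w i u v ≡ true × cycInc w i v u ≡ false) (sym (falling² e)) (sym e)
          (cycInc-< w {i} {s₂ i} {s₄ i} (proj₁ o) (proj₂ o))
          where
          o = ordered i (subst (λ z → toℕ i ≤ toℕ z) e (proj₁ (rep-true i r)))

        fixedVertex-true : ∀ k i → fixedVertex w k i ≡ true → rep i ≡ true × Orbit i (shift (toℕ k) i)
        fixedVertex-true k i h = trans (sym (isVertexRep≡rep i)) (proj₁ (∧-true h)) , sameVertex⇒orbit (proj₂ (∧-true {isVertexRep w i} h))

        true-fixedVertex : ∀ k i → rep i ≡ true → Orbit i (shift (toℕ k) i) → fixedVertex w k i ≡ true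
        true-fixedVertex k i r o = true-∧ (trans (isVertexRep≡rep i) r) (orbit⇒sameVertex o)

      module _ (k : Fin n) (K : toℕ k ≡ 2 * M ⊎ toℕ k ≡ 4 * M) where

        private
          positive≡ : ∀ i → fixedVertex w k i ∧ isPositive w i ≡ rep i ∧ like ρ (4 * M) i
          positive≡ i = ≡-by-true
            (λ h → to (fixedVertex-true k i (proj₁ (∧-true h))) (trans (sym (isPositive≡ i)) (proj₂ (∧-true {fixedVertex w k i} h))))
            (λ h → from (proj₁ (∧-true h)) (does⇒ (ρ i Fin.≟ s₄ i) (proj₂ (∧-true {rep i} h))))
            where
            to : rep i ≡ true × Orbit i (shift (toℕ k) i) → descends i ≡ true → rep i ∧ like ρ (4 * M) i ≡ true
            to (r , o) p = true-∧ r (dec-true (ρ i Fin.≟ s₄ i)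
              ([ (λ e → ⊥-elim (clash p (proj₂ (rising-order i r e)))) , (λ e → e) ]′ (moved i (toℕ k) K o)))
            from : rep i ≡ true → ρ i ≡ s₄ i → fixedVertex w k i ∧ isPositive w i ≡ true
            from r e = true-∧ (true-fixedVertex k i r (falling-orbit i (toℕ k) K e)) (trans (isPositive≡ i) (proj₁ (falling-order i r e)))

          negative≡ : ∀ i → fixedVertex w k i ∧ isNegative w i ≡ rep i ∧ like ρ (2 * M) i
          negative≡ i = ≡-by-true
            (λ h → to (fixedVertex-true k i (proj₁ (∧-true h))) (trans (sym (isNegative≡ i)) (proj₂ (∧-true {fixedVertex w k i} h))))
            (λ h → from (proj₁ (∧-true h)) (does⇒ (ρ i Fin.≟ s₂ i) (proj₂ (∧-true {rep i} h))))
            where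
            to : rep i ≡ true × Orbit i (shift (toℕ k) i) → ascends i ≡ true → rep i ∧ like ρ (2 * M) i ≡ true
            to (r , o) p = true-∧ r (dec-true (ρ i Fin.≟ s₂ i)
              ([ (λ e → e) , (λ e → ⊥-elim (clash p (proj₂ (falling-order i r e)))) ]′ (moved i (toℕ k) K o)))
            from : rep i ≡ true → ρ i ≡ s₂ i → fixedVertex w k i ∧ isNegative w i ≡ true
            from r e = true-∧ (true-fixedVertex k i r (rising-orbit i (toℕ k) K e)) (trans (isNegative≡ i) (proj₁ (rising-order i r e)))

        -- The left-hand side does not mention k: an automorphism of order 3 and its inverse fix
        -- equally many positive vertices.
        falling≡ : falling ≡ 3 * fixedPositive w k
        falling≡ = trans (third (like ρ (4 * M)) (like-ρ (4 * M) ρs₄)) (cong (3 *_)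
          (sym (trans (count-allFin (λ i → fixedVertex w k i ∧ isPositive w i)) (sum-cong-≗ (λ i → cong 𝟙 (positive≡ i))))))

        rising≡ : rising ≡ 3 * fixedNegative w k
        rising≡ = trans (third (like ρ (2 * M)) (like-ρ (2 * M) ρs₂)) (cong (3 *_)
          (sym (trans (count-allFin (λ i → fixedVertex w k i ∧ isNegative w i)) (sum-cong-≗ (λ i → cong 𝟙 (negative≡ i))))))

    -- Membership in the symmetry classes.

    private
      isAut-true : ∀ {k} → isAut w k ≡ true → Aut (toℕ k)
      isAut-true {k} e = does⇒ (aut? (toℕ k)) (trans (sym (isAut≡ k)) e)

      true-isAut : ∀ {k} → Aut (toℕ k) → isAut w k ≡ true
      true-isAut {k} p = trans (isAut≡ k) (dec-true (aut? (toℕ k)) p)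

      n≡2·3M : n ≡ 2 * (3 * M)
      n≡2·3M = trans n≡6M (*-assoc 2 3 M)

      n≡3·2M : n ≡ 3 * (2 * M)
      n≡3·2M = trans n≡6M (*-assoc 3 2 M)

      order-2⇒ : ∀ (k : Fin n) → n ∣ 2 * toℕ k → ¬ (n ∣ toℕ k) → toℕ k ≡ 3 * M
      order-2⇒ k p ¬p with *-cancelˡ-∣ 2 (subst (_∣ 2 * toℕ k) n≡2·3M p)
      ... | divides c eq = go c eq (*-cancelʳ-< (3 * M) c 2 (subst₂ _<_ eq n≡2·3M (toℕ<n k)))
        where
        go : ∀ c → toℕ k ≡ c * (3 * M) → c < 2 → toℕ k ≡ 3 * M
        go 0 e _ = ⊥-elim (¬p (subst (n ∣_) (sym e) (n ∣0)))
        go 1 e _ = trans e (+-identityʳ _)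
        go (suc (suc _)) _ (s≤s (s≤s ()))

      order-3⇒ : ∀ (k : Fin n) → n ∣ 3 * toℕ k → ¬ (n ∣ toℕ k) → toℕ k ≡ 2 * M ⊎ toℕ k ≡ 4 * M
      order-3⇒ k p ¬p with *-cancelˡ-∣ 3 (subst (_∣ 3 * toℕ k) n≡3·2M p)
      ... | divides c eq = go c eq (*-cancelʳ-< (2 * M) c 3 (subst₂ _<_ eq n≡3·2M (toℕ<n k)))
        where
        go : ∀ c → toℕ k ≡ c * (2 * M) → c < 3 → toℕ k ≡ 2 * M ⊎ toℕ k ≡ 4 * M
        go 0 e _ = ⊥-elim (¬p (subst (n ∣_) (sym e) (n ∣0)))
        go 1 e _ = inj₁ (trans e (+-identityʳ _))
        go 2 e _ = inj₂ (trans e (sym (*-assoc 2 2 M)))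
        go (suc (suc (suc _))) _ (s≤s (s≤s (s≤s ())))

      not-multiple : ∀ c → 1 ≤ c → c < 6 → ¬ (n ∣ c * M)
      not-multiple c 1≤c c<6 p = <⇒≱ c<6 (∣⇒≤ {{>-nonZero 1≤c}} (*-cancelʳ-∣ M (subst (_∣ c * M) n≡6M p)))

    -- The only shift of order 2 is by 3M, so r can be recovered from `reversed` alone.
    inW2-true : ∀ {r} → inW2 w r ≡ true → Aut (3 * M) × reversed ≡ 2 * r
    inW2-true {r} h = go (any-true {xs = allFin n} h)
      where
      finish : ∀ k → Aut (toℕ k) → n ∣ 2 * toℕ k × ¬ (n ∣ toℕ k) → reversedEdges w k ≡ r → Aut (3 * M) × reversed ≡ 2 * r
      finish k a (p , ¬p) e = subst Aut k≡ a ,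
        trans (cong (λ z → sum (𝟙 ∘ like τ z)) (sym k≡)) (trans (reversedEdges-double k p) (cong (2 *_) e))
        where
        k≡ : toℕ k ≡ 3 * M
        k≡ = order-2⇒ k p ¬p
      go : (∃ λ k → k ∈ allFin n × isAut w k ∧ hasOrder w k 2 ∧ (reversedEdges w k ≡ᵇ r) ≡ true) → Aut (3 * M) × reversed ≡ 2 * r
      go (k , _ , h₁) = finish k (isAut-true {k} (proj₁ (∧-true h₁))) (hasOrder-true w {k} {2} (s≤s (s≤s z≤n)) (proj₁ (∧-true h₂)))
        (≡ᵇ-sound {reversedEdges w k} {r} (proj₂ (∧-true {hasOrder w k 2} h₂)))
        where
        h₂ : hasOrder w k 2 ∧ (reversedEdges w k ≡ᵇ r) ≡ true
        h₂ = proj₂ (∧-true {isAut w k} h₁)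

    true-inW2 : ∀ {r} → Aut (3 * M) → reversed ≡ 2 * r → inW2 w r ≡ true
    true-inW2 {r} a e = true-any {xs = allFin n} (∈-allFin k) (true-∧ (true-isAut {k} (subst Aut (sym k≡) a))
      (true-∧ (true-hasOrder w {k} {2} (s≤s z≤n) n∣2k below)
        (≡ᵇ-complete (*-cancelˡ-≡ (reversedEdges w k) r 2 (trans (sym (reversedEdges-double k n∣2k)) (trans (cong (λ z → sum (𝟙 ∘ like τ z)) k≡) e))))))
      where
      3M<n : 3 * M < n
      3M<n = subst (3 * M <_) (sym n≡6M) (*-monoˡ-< M {3} {6} (s≤s (s≤s (s≤s (s≤s z≤n)))))
      k : Fin n
      k = Fin.fromℕ< 3M<n
      k≡ : toℕ k ≡ 3 * M
      k≡ = toℕ-fromℕ< 3M<n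
      n∣2k : n ∣ 2 * toℕ k
      n∣2k = ∣-reflexive (trans n≡2·3M (cong (2 *_) (sym k≡)))
      below : ∀ c → 1 ≤ c → c < 2 → ¬ (n ∣ c * toℕ k)
      below 1 _ _ p = not-multiple 3 (s≤s z≤n) (s≤s (s≤s (s≤s (s≤s z≤n)))) (subst (n ∣_) (trans (+-identityʳ _) k≡) p)
      below (suc (suc _)) _ (s≤s (s≤s ()))

    inW3-true : ∀ {s t} → inW3 w s t ≡ true → Aut (2 * M) × falling ≡ 3 * s × rising ≡ 3 * t
    inW3-true {s} {t} h = go (any-true {xs = allFin n} h)
      where
      finish : ∀ k → Aut (toℕ k) → toℕ k ≡ 2 * M ⊎ toℕ k ≡ 4 * M → fixedPositive w k ≡ s → fixedNegative w k ≡ t →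
               Aut (2 * M) × falling ≡ 3 * s × rising ≡ 3 * t
      finish k a K e₁ e₂ = aut , trans (OrderThree.falling≡ aut k K) (cong (3 *_) e₁) , trans (OrderThree.rising≡ aut k K) (cong (3 *_) e₂)
        where
        aut : Aut (2 * M)
        aut = [ (λ e → subst Aut e a) , (λ e → 4M⇒2M (subst Aut e a)) ]′ K
      go : (∃ λ k → k ∈ allFin n × isAut w k ∧ hasOrder w k 3 ∧ (fixedPositive w k ≡ᵇ s) ∧ (fixedNegative w k ≡ᵇ t) ≡ true) →
           Aut (2 * M) × falling ≡ 3 * s × rising ≡ 3 * t
      go (k , _ , h₁) = finish k (isAut-true {k} (proj₁ (∧-true h₁))) (order-3⇒ k (proj₁ o) (proj₂ o))
        (≡ᵇ-sound {fixedPositive w k} {s} (proj₁ (∧-true h₃))) (≡ᵇ-sound {fixedNegative w k} {t} (proj₂ (∧-true {fixedPositive w k ≡ᵇ s} h₃)))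
        where
        h₂ : hasOrder w k 3 ∧ (fixedPositive w k ≡ᵇ s) ∧ (fixedNegative w k ≡ᵇ t) ≡ true
        h₂ = proj₂ (∧-true {isAut w k} h₁)
        h₃ : (fixedPositive w k ≡ᵇ s) ∧ (fixedNegative w k ≡ᵇ t) ≡ true
        h₃ = proj₂ (∧-true {hasOrder w k 3} h₂)
        o : n ∣ 3 * toℕ k × ¬ (n ∣ toℕ k)
        o = hasOrder-true w {k} {3} (s≤s (s≤s z≤n)) (proj₁ (∧-true h₂))

    true-inW3 : ∀ {s t} → Aut (2 * M) → falling ≡ 3 * s → rising ≡ 3 * t → inW3 w s t ≡ true
    true-inW3 {s} {t} a fs rt = true-any {xs = allFin n} (∈-allFin k) (true-∧ (true-isAut {k} (subst Aut (sym k≡) a))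
      (true-∧ (true-hasOrder w {k} {3} (s≤s z≤n) n∣3k below)
        (true-∧ (≡ᵇ-complete (*-cancelˡ-≡ (fixedPositive w k) s 3 (trans (sym (OrderThree.falling≡ a k (inj₁ k≡))) fs)))
                (≡ᵇ-complete (*-cancelˡ-≡ (fixedNegative w k) t 3 (trans (sym (OrderThree.rising≡ a k (inj₁ k≡))) rt))))))
      where
      2M<n : 2 * M < n
      2M<n = subst (2 * M <_) (sym n≡6M) (*-monoˡ-< M {2} {6} (s≤s (s≤s (s≤s z≤n))))
      k : Fin n
      k = Fin.fromℕ< 2M<n
      k≡ : toℕ k ≡ 2 * M
      k≡ = toℕ-fromℕ< 2M<n
      n∣3k : n ∣ 3 * toℕ k
      n∣3k = ∣-reflexive (trans n≡3·2M (cong (3 *_) (sym k≡)))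
      below : ∀ c → 1 ≤ c → c < 3 → ¬ (n ∣ c * toℕ k)
      below 1 _ _ p = not-multiple 2 (s≤s z≤n) (s≤s (s≤s (s≤s z≤n))) (subst (n ∣_) (trans (+-identityʳ _) k≡) p)
      below 2 _ _ p = not-multiple 4 (s≤s z≤n) (s≤s (s≤s (s≤s (s≤s (s≤s z≤n)))))
        (subst (n ∣_) (trans (cong (2 *_) k≡) (sym (*-assoc 2 2 M))) p)
      below (suc (suc (suc _))) _ (s≤s (s≤s (s≤s ())))

module NumericalConstraints where

  open import Data.Nat
  open import Data.Nat.DivMod
  open import Data.Nat.Divisibility
  open import Data.Nat.Properties
  open import Data.Nat.Tactic.RingSolver using (solve-∀)
  open import Data.Integer as ℤ using (ℤ; +_; 0ℤ; 1ℤ)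
  import Data.Integer.Properties as ℤ
  import Data.Integer.Divisibility.Signed as ℤ
  import Data.Integer.Tactic.RingSolver as ℤ
  open OneFaceMaps
  open Coverings
  open WicksForms

  -- Bounds and congruences for the parameters.

  ∣-to-∸ : ∀ {k a b} → b ≤ a → + k ℤ.∣ + a ℤ.- + b → k ∣ a ∸ b
  ∣-to-∸ {k} {a} {b} b≤a p = ℤ.∣⇒∣ᵤ (subst (+ k ℤ.∣_) (trans (ℤ.m-n≡m⊖n a b) (ℤ.⊖-≥ b≤a)) p)

  ∸-to-∣ : ∀ {k a b} → b ≤ a → k ∣ a ∸ b → + k ℤ.∣ + a ℤ.- + b
  ∸-to-∣ {k} {a} {b} b≤a p = subst (+ k ℤ.∣_) (sym (trans (ℤ.m-n≡m⊖n a b) (ℤ.⊖-≥ b≤a))) (ℤ.∣ᵤ⇒∣ p)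

  ∣-to-% : ∀ {k a b} .{{_ : NonZero k}} → + k ℤ.∣ + a ℤ.- + b → a % k ≡ b % k
  ∣-to-% {k} {a} {b} p with ≤-total b a
  ... | inj₁ b≤a = trans (cong (_% k) (sym (m+[n∸m]≡n b≤a))) (%-remove-+ʳ b (∣-to-∸ b≤a p))
  ... | inj₂ a≤b = sym (trans (cong (_% k) (sym (m+[n∸m]≡n a≤b))) (%-remove-+ʳ a (∣-to-∸ a≤b
      (subst (+ k ℤ.∣_) (lem (+ a) (+ b)) (ℤ.∣m⇒∣-m p)))))
    where
    lem : ∀ a b → ℤ.- (a ℤ.- b) ≡ b ℤ.- a
    lem = ℤ.solve-∀

  -- This and the next two conditions repeat the filters of `m₂tot`, `m₃tot` and `m₆tot` literally,
  -- so that those sums unfold to sums over them.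
  cond₂ : ℕ → ℕ → Bool
  cond₂ g r = (r ≤ᵇ 2 * g + 1) ∧ does (4 ∣? (2 * g + 1 ∸ r))

  cond₃ : ℕ → ℕ → ℕ → Bool
  cond₃ g s t = (s + t ≤ᵇ g + 1) ∧ does (3 ∣? (g + 1 ∸ (s + t))) ∧ (s % 3 ≡ᵇ (2 * g + 1) % 3)

  cond₆ : ℕ → ℕ → ℕ → ℕ → Bool
  cond₆ g r s t = (3 * r + 4 * s + 4 * t ≤ᵇ 2 * g + 5) ∧ does (12 ∣? (2 * g + 5 ∸ (3 * r + 4 * s + 4 * t)))
                  ∧ ((2 * s) % 3 ≡ᵇ (2 * g + 1) % 3)

  -- Here b says that an automorphism of the given order exists, P i that the form lies in the class
  -- with parameters i, and C i that i occurs in the sum. Summed over the admissible i, a form then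
  -- counts once if b holds and never otherwise.
  record Selects {I : Set} (b : Bool) (P : I → Bool) (C : I → Set) : Set where
    field
      none : b ≡ false → ∀ i → P i ≡ false
      some : b ≡ true → ∃ λ i₀ → P i₀ ≡ true × (∀ i → P i ≡ true → i ≡ i₀) × C i₀

  record Symmetry (g : ℕ) (w : MWord g) : Set where
    field
      two three : Bool
      order : autOrder w ≡ 1 + 2 * 𝟙 three + 𝟙 two + 2 * 𝟙 (three ∧ two)
      reversals : Selects two (inW2 w) (λ r → r < 2 * g + 2 × cond₂ g r ≡ true)
      signs : Selects {ℕ × ℕ} three (uncurry (inW3 w)) (λ (s , t) → s < g + 2 × t < g + 2 × cond₃ g s t ≡ true)
      both : Selects {ℕ × ℕ × ℕ} (three ∧ two) (λ (r , s , t) → inW6 w r s t)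
               (λ (r , s , t) → r < 2 * g + 6 × s < 2 * g + 6 × t < 2 * g + 6 × cond₆ g r s t ≡ true)

  module Genus (h : ℕ) (w : MWord (suc h)) (maximal : IsMaxWicks (suc h) w) where

    g M : ℕ
    g = suc h
    M = 2 * g ∸ 1

    private
      M≡ : M ≡ 2 * h + 1
      M≡ = lem h
        where
        lem : ∀ h → h + suc (h + 0) ≡ 2 * h + 1
        lem = solve-∀

      instance
        M≢0 : NonZero M
        M≢0 = ≢-nonZero (λ e → 1+n≢0 {2 * h} (trans (+-comm 1 (2 * h)) (trans (sym M≡) e)))

      n≡6M : len g ≡ 6 * M
      n≡6M = lem M
        where
        lem : ∀ M → 3 * M + 3 * M ≡ 6 * M
        lem = solve-∀

      instance
        n≢0 : NonZero (len g)
        n≢0 = subst NonZero (sym n≡6M) (m*n≢0 6 M)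

      flags : isWicks w ∧ hasGenus w g ≡ true
      flags = Equivalence.to T-≡ maximal

      wicks : isWicks w ≡ true
      wicks = proj₁ (∧-true flags)

      -- Euler's formula with one face and 3M edges: the number of vertices is 3M + 1 - 2g, where 2g
      -- = M + 1.
      V≡ : numVertices w ≡ 2 * M
      V≡ = +-cancelˡ-≡ (2 * g) _ _ (trans (≡ᵇ-sound {2 * g + numVertices w} {edges g + 1} (proj₂ (∧-true {isWicks w} flags)))
        (trans (cong (λ z → 3 * z + 1) M≡) (trans (lem h) (cong (λ z → 2 * g + 2 * z) (sym M≡)))))
        where
        lem : ∀ h → 3 * (2 * h + 1) + 1 ≡ 2 * suc h + 2 * (2 * h + 1)
        lem = solve-∀

      3V≡n : 3 * numVertices w ≡ len g
      3V≡n = trans (cong (3 *_) V≡) (trans (lem M) (sym n≡6M))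
        where
        lem : ∀ M → 3 * (2 * M) ≡ 6 * M
        lem = solve-∀

    open MaximalForm w wicks M n≡6M 3V≡n

    private
      2g+1≡ : 2 * g + 1 ≡ M + 2
      2g+1≡ = trans (lem h) (cong (_+ 2) (sym M≡))
        where
        lem : ∀ h → 2 * suc h + 1 ≡ 2 * h + 1 + 2
        lem = solve-∀

      ⌜2g+1⌝ : + (2 * g + 1) ≡ + 2 ℤ.* + h ℤ.+ + 3
      ⌜2g+1⌝ = trans (cong +_ (lem h)) (cong (ℤ._+ + 3) (ℤ.pos-* 2 h))
        where
        lem : ∀ h → 2 * suc h + 1 ≡ 2 * h + 3
        lem = solve-∀

      ⌜M⌝ : + M ≡ + 2 ℤ.* + h ℤ.+ 1ℤ
      ⌜M⌝ = trans (cong +_ M≡) (cong (ℤ._+ 1ℤ) (ℤ.pos-* 2 h))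

      ⌜g+1⌝ : + (g + 1) ≡ + h ℤ.+ + 2
      ⌜g+1⌝ = cong +_ (lem h)
        where
        lem : ∀ h → suc h + 1 ≡ h + 2
        lem = solve-∀

      halves : Aut (3 * M) → ∃ λ r → reversed ≡ 2 * r × r ≤ 2 * g + 1 × 4 ∣ 2 * g + 1 ∸ r
      halves a = go (order-2 h M≡ a)
        where
        go : (∃ λ r → reversed ≡ 2 * r × r ≤ M + 2 × (∃ λ k → 3 * M ≡ 4 * k + r)) →
             ∃ λ r → reversed ≡ 2 * r × r ≤ 2 * g + 1 × 4 ∣ 2 * g + 1 ∸ r
        -- 3M exceeds 2g + 1 by 4h, so the remainder of 3M modulo 4 is also that of 2g + 1.
        go (r , e , r≤ , k , 3M≡) = r , e , r≤′ , ∣m+n∣n⇒∣m {n = 4 * h} (divides k eq) (m∣m*n h)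
          where
          open ≡-Reasoning
          r≤′ : r ≤ 2 * g + 1
          r≤′ = subst (r ≤_) (sym 2g+1≡) r≤
          q = 2 * g + 1 ∸ r
          lem₁ : ∀ q h r → q + 4 * h + r ≡ (r + q) + 4 * h
          lem₁ = solve-∀
          lem₂ : ∀ h → 2 * suc h + 1 + 4 * h ≡ 3 * (2 * h + 1)
          lem₂ = solve-∀
          eq : q + 4 * h ≡ k * 4
          eq = +-cancelʳ-≡ r _ _ (begin
            q + 4 * h + r            ≡⟨ lem₁ q h r ⟩
            (r + q) + 4 * h          ≡⟨ cong (_+ 4 * h) (m+[n∸m]≡n r≤′) ⟩
            2 * g + 1 + 4 * h        ≡⟨ lem₂ h ⟩
            3 * (2 * h + 1)          ≡⟨ cong (3 *_) M≡ ⟨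
            3 * M                    ≡⟨ 3M≡ ⟩
            4 * k + r                ≡⟨ cong (_+ r) (*-comm 4 k) ⟩
            k * 4 + r                ∎)

      thirds : Aut (2 * M) → ∃ λ s → ∃ λ t → falling ≡ 3 * s × rising ≡ 3 * t × s + t ≤ g + 1
               × + 3 ℤ.∣ + (g + 1) ℤ.- + (s + t) × s % 3 ≡ (2 * g + 1) % 3
      thirds a = go (order-3 a)
        where
        go : (∃ λ s → ∃ λ t → falling ≡ 3 * s × rising ≡ 3 * t × 4 * (s + t) ≤ 2 * M + 6
               × + 3 ℤ.∣ + 2 ℤ.* (+ M ℤ.+ (+ s ℤ.+ + t)) × + 3 ℤ.∣ + 2 ℤ.* (+ t ℤ.- + s ℤ.+ 1ℤ)) →
             ∃ λ s → ∃ λ t → falling ≡ 3 * s × rising ≡ 3 * t × s + t ≤ g + 1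
               × + 3 ℤ.∣ + (g + 1) ℤ.- + (s + t) × s % 3 ≡ (2 * g + 1) % 3
        go (s , t , e₁ , e₂ , bound , p , r) = s , t , e₁ , e₂ ,
            -- In terms of h, the bound 2M + 6 is 4 (g + 1).
            *-cancelˡ-≤ 4 (≤-trans bound (≤-reflexive (trans (cong (λ z → 2 * z + 6) M≡) (lem h)))) ,
            subst (+ 3 ℤ.∣_) eq₁ (ℤ.∣m∣n⇒∣m-n p (ℤ.∣m⇒∣m*n (+ h ℤ.+ (+ s ℤ.+ + t)) (ℤ.∣-refl {+ 3}))) ,
            -- Subtracting the two congruences eliminates t and leaves 4s + 4h ≡ 0 modulo 3; the
            -- explicit multiple of 3 reduces this to s - (2g + 1).
            ∣-to-% {3} {s} {2 * g + 1} (subst (+ 3 ℤ.∣_) eq₂ (ℤ.∣m∣n⇒∣m-n (ℤ.∣m∣n⇒∣m-n p r) (ℤ.∣m⇒∣m*n (+ 2 ℤ.* + h ℤ.+ + s ℤ.+ 1ℤ) (ℤ.∣-refl {+ 3}))))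
          where
          lem : ∀ h → 2 * (2 * h + 1) + 6 ≡ 4 * (suc h + 1)
          lem = solve-∀
          lem₁ : ∀ h s t → + 2 ℤ.* (+ 2 ℤ.* h ℤ.+ 1ℤ ℤ.+ (s ℤ.+ t)) ℤ.- + 3 ℤ.* (h ℤ.+ (s ℤ.+ t)) ≡ h ℤ.+ + 2 ℤ.- (s ℤ.+ t)
          lem₁ = ℤ.solve-∀
          eq₁ : + 2 ℤ.* (+ M ℤ.+ (+ s ℤ.+ + t)) ℤ.- + 3 ℤ.* (+ h ℤ.+ (+ s ℤ.+ + t)) ≡ + (g + 1) ℤ.- + (s + t)
          eq₁ = trans (cong (λ z → + 2 ℤ.* (z ℤ.+ (+ s ℤ.+ + t)) ℤ.- + 3 ℤ.* (+ h ℤ.+ (+ s ℤ.+ + t))) ⌜M⌝)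
            (trans (lem₁ (+ h) (+ s) (+ t)) (cong (λ z → z ℤ.- (+ s ℤ.+ + t)) (sym ⌜g+1⌝)))
          lem₂ : ∀ h s t → + 2 ℤ.* (+ 2 ℤ.* h ℤ.+ 1ℤ ℤ.+ (s ℤ.+ t)) ℤ.- + 2 ℤ.* (t ℤ.- s ℤ.+ 1ℤ) ℤ.- + 3 ℤ.* (+ 2 ℤ.* h ℤ.+ s ℤ.+ 1ℤ)
                 ≡ s ℤ.- (+ 2 ℤ.* h ℤ.+ + 3)
          lem₂ = ℤ.solve-∀
          eq₂ : + 2 ℤ.* (+ M ℤ.+ (+ s ℤ.+ + t)) ℤ.- + 2 ℤ.* (+ t ℤ.- + s ℤ.+ 1ℤ) ℤ.- + 3 ℤ.* (+ 2 ℤ.* + h ℤ.+ + s ℤ.+ 1ℤ)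
                ≡ + s ℤ.- + (2 * g + 1)
          eq₂ = trans (cong (λ z → + 2 ℤ.* (z ℤ.+ (+ s ℤ.+ + t)) ℤ.- + 2 ℤ.* (+ t ℤ.- + s ℤ.+ 1ℤ) ℤ.- + 3 ℤ.* (+ 2 ℤ.* + h ℤ.+ + s ℤ.+ 1ℤ)) ⌜M⌝)
            (trans (lem₂ (+ h) (+ s) (+ t)) (cong (λ z → + s ℤ.- z) (sym ⌜2g+1⌝)))

      false-of : ∀ {b} → b ≢ true → b ≡ false
      false-of {true}  ne = ⊥-elim (ne refl)
      false-of {false} _  = refl

      no-aut : ∀ {k} → does (aut? k) ≡ false → ¬ Aut k
      no-aut {k} e a = clash (dec-true (aut? k) a) e

      reversal : Selects (does (aut? (3 * M))) (inW2 w) (λ r → r < 2 * g + 2 × cond₂ g r ≡ true)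
      reversal = record
        { none = λ e r → false-of (λ p → no-aut e (proj₁ (inW2-true {r} p)))
        ; some = λ e → go (does⇒ (aut? (3 * M)) e) (halves (does⇒ (aut? (3 * M)) e)) }
        where
        go : Aut (3 * M) → (∃ λ r → reversed ≡ 2 * r × r ≤ 2 * g + 1 × 4 ∣ 2 * g + 1 ∸ r) →
             ∃ λ r₀ → inW2 w r₀ ≡ true × (∀ r → inW2 w r ≡ true → r ≡ r₀) × r₀ < 2 * g + 2 × cond₂ g r₀ ≡ true
        go a (r , e , r≤ , 4∣) = r , true-inW2 a e , (λ r′ p → *-cancelˡ-≡ r′ r 2 (trans (sym (proj₂ (inW2-true {r′} p))) e)) ,
          subst (r <_) (sym (+-suc (2 * g) 1)) (s≤s r≤) , true-∧ (≤ᵇ-true r≤) (dec-true (4 ∣? (2 * g + 1 ∸ r)) 4∣)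

      signed : Selects {ℕ × ℕ} (does (aut? (2 * M))) (uncurry (inW3 w)) (λ (s , t) → s < g + 2 × t < g + 2 × cond₃ g s t ≡ true)
      signed = record
        { none = λ e (s , t) → false-of (λ p → no-aut e (proj₁ (inW3-true {s} {t} p)))
        ; some = λ e → go (does⇒ (aut? (2 * M)) e) (thirds (does⇒ (aut? (2 * M)) e)) }
        where
        go : Aut (2 * M) → (∃ λ s → ∃ λ t → falling ≡ 3 * s × rising ≡ 3 * t × s + t ≤ g + 1
               × + 3 ℤ.∣ + (g + 1) ℤ.- + (s + t) × s % 3 ≡ (2 * g + 1) % 3) →
             ∃ λ (i₀ : ℕ × ℕ) → uncurry (inW3 w) i₀ ≡ true × (∀ i → uncurry (inW3 w) i ≡ true → i ≡ i₀) ×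
               proj₁ i₀ < g + 2 × proj₂ i₀ < g + 2 × cond₃ g (proj₁ i₀) (proj₂ i₀) ≡ true
        go a (s , t , e₁ , e₂ , le , 3∣ , s%3) = (s , t) , true-inW3 a e₁ e₂ , unique ,
            below (≤-trans (m≤m+n s t) le) , below (≤-trans (m≤n+m t s) le) ,
            true-∧ (≤ᵇ-true le) (true-∧ (dec-true (3 ∣? (g + 1 ∸ (s + t))) (∣-to-∸ le 3∣)) (≡ᵇ-complete s%3))
          where
          below : ∀ {x} → x ≤ g + 1 → x < g + 2
          below {x} p = subst (x <_) (sym (+-suc g 1)) (s≤s p)
          unique : ∀ i → uncurry (inW3 w) i ≡ true → i ≡ (s , t)
          unique (s′ , t′) p = cong₂ _,_ (*-cancelˡ-≡ s′ s 3 (trans (sym (proj₁ (proj₂ (inW3-true {s′} {t′} p)))) e₁))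
                                         (*-cancelˡ-≡ t′ t 3 (trans (sym (proj₂ (proj₂ (inW3-true {s′} {t′} p)))) e₂))

      sixth : Selects {ℕ × ℕ × ℕ} (does (aut? (2 * M)) ∧ does (aut? (3 * M))) (λ (r , s , t) → inW6 w r s t)
                (λ (r , s , t) → r < 2 * g + 6 × s < 2 * g + 6 × t < 2 * g + 6 × cond₆ g r s t ≡ true)
      sixth = record
        { none = λ e (r , s , t) → false-of (λ p → clash
            (true-∧ (dec-true (aut? (2 * M)) (proj₁ (inW3-true {2 * s} {2 * t} (proj₂ (∧-true {inW2 w (3 * r)} p)))))
                    (dec-true (aut? (3 * M)) (proj₁ (inW2-true {3 * r} (proj₁ (∧-true p)))))) e)
        ; some = λ e → some (does⇒ (aut? (2 * M)) (proj₁ (∧-true e))) (does⇒ (aut? (3 * M)) (proj₂ (∧-true {does (aut? (2 * M))} e))) }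
        where
        some : Aut (2 * M) → Aut (3 * M) → ∃ λ (i₀ : ℕ × ℕ × ℕ) → (let (r , s , t) = i₀ in inW6 w r s t ≡ true) ×
               (∀ i → (let (r , s , t) = i in inW6 w r s t ≡ true) → i ≡ i₀) ×
               (let (r , s , t) = i₀ in r < 2 * g + 6 × s < 2 * g + 6 × t < 2 * g + 6 × cond₆ g r s t ≡ true)
        some a₂ a₃ = go (order-6 (aut-M a₂ a₃)) (halves a₃) (thirds a₂)
          where
          go : (∃ λ r → ∃ λ s → ∃ λ u → reversed ≡ 6 * r × falling ≡ 6 * s × rising ≡ 6 * u × 4 * (s + u) + 3 * r ≤ M + 6) →
               (∃ λ r → reversed ≡ 2 * r × r ≤ 2 * g + 1 × 4 ∣ 2 * g + 1 ∸ r) →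
               (∃ λ s → ∃ λ t → falling ≡ 3 * s × rising ≡ 3 * t × s + t ≤ g + 1
                 × + 3 ℤ.∣ + (g + 1) ℤ.- + (s + t) × s % 3 ≡ (2 * g + 1) % 3) →
               ∃ λ (i₀ : ℕ × ℕ × ℕ) → (let (r , s , t) = i₀ in inW6 w r s t ≡ true) ×
               (∀ i → (let (r , s , t) = i in inW6 w r s t ≡ true) → i ≡ i₀) ×
               (let (r , s , t) = i₀ in r < 2 * g + 6 × s < 2 * g + 6 × t < 2 * g + 6 × cond₆ g r s t ≡ true)
          go (r , s , t , er , es , et , le) (r′ , er′ , r′≤ , 4∣) (s′ , t′ , es′ , et′ , _ , 3∣ , s%3) =
              (r , s , t) , true-∧ (true-inW2 a₃ (trans er (*-assoc 2 3 r)))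
                                   (true-inW3 a₂ (trans es (*-assoc 3 2 s)) (trans et (*-assoc 3 2 t))) ,
              unique , below r≤ , below s≤ , below t≤ ,
              true-∧ (≤ᵇ-true le′) (true-∧ (dec-true (12 ∣? (2 * g + 5 ∸ N)) (∣-to-∸ le′ 12∣))
                (≡ᵇ-complete (subst (λ z → z % 3 ≡ (2 * g + 1) % 3) s′≡ s%3)))
            where
            N = 3 * r + 4 * s + 4 * t
            le′ : N ≤ 2 * g + 5
            le′ = ≤-trans (≤-reflexive (lem₁ r s t)) (≤-trans le (≤-reflexive (trans (cong (_+ 6) M≡) (lem₂ h))))
              where
              lem₁ : ∀ r s t → 3 * r + 4 * s + 4 * t ≡ 4 * (s + t) + 3 * r
              lem₁ = solve-∀
              lem₂ : ∀ h → 2 * h + 1 + 6 ≡ 2 * suc h + 5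
              lem₂ = solve-∀
            below : ∀ {x} → x ≤ N → x < 2 * g + 6
            below {x} p = subst (x <_) (sym (+-suc (2 * g) 5)) (s≤s (≤-trans p le′))
            r≤ : r ≤ N
            r≤ = ≤-trans (m≤n*m r 3) (≤-trans (m≤m+n (3 * r) (4 * s)) (m≤m+n (3 * r + 4 * s) (4 * t)))
            s≤ : s ≤ N
            s≤ = ≤-trans (m≤n*m s 4) (≤-trans (m≤n+m (4 * s) (3 * r)) (m≤m+n (3 * r + 4 * s) (4 * t)))
            t≤ : t ≤ N
            t≤ = ≤-trans (m≤n*m t 4) (m≤n+m (4 * t) (3 * r + 4 * s))
            -- `halves` and `thirds` count the same letters and corners as `order-6`, so their
            -- congruences can be transferred to 3r, 2s and 2t.
            r′≡ : r′ ≡ 3 * r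
            r′≡ = *-cancelˡ-≡ r′ (3 * r) 2 (trans (sym er′) (trans er (*-assoc 2 3 r)))
            s′≡ : s′ ≡ 2 * s
            s′≡ = *-cancelˡ-≡ s′ (2 * s) 3 (trans (sym es′) (trans es (*-assoc 3 2 s)))
            t′≡ : t′ ≡ 2 * t
            t′≡ = *-cancelˡ-≡ t′ (2 * t) 3 (trans (sym et′) (trans et (*-assoc 3 2 t)))
            X : ℤ
            X = + (2 * g + 5) ℤ.- + N
            ⌜X⌝ : X ≡ + 2 ℤ.* + h ℤ.+ + 7 ℤ.- (+ 3 ℤ.* + r ℤ.+ + 4 ℤ.* + s ℤ.+ + 4 ℤ.* + t)
            ⌜X⌝ = cong₂ ℤ._-_ (trans (cong +_ (lem h)) (cong (ℤ._+ + 7) (ℤ.pos-* 2 h)))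
              (cong₂ ℤ._+_ (cong₂ ℤ._+_ (ℤ.pos-* 3 r) (ℤ.pos-* 4 s)) (ℤ.pos-* 4 t))
              where
              lem : ∀ h → 2 * suc h + 5 ≡ 2 * h + 7
              lem = solve-∀
            -- X differs from (2g + 1) - 3r by the multiple 4 (1 - s - t).
            4∣X : + 4 ℤ.∣ X
            4∣X = subst (+ 4 ℤ.∣_) eq (ℤ.∣m∣n⇒∣m+n (∸-to-∣ (subst (_≤ 2 * g + 1) r′≡ r′≤) (subst (λ z → 4 ∣ 2 * g + 1 ∸ z) r′≡ 4∣))
                    (ℤ.∣m⇒∣m*n (1ℤ ℤ.- + s ℤ.- + t) (ℤ.∣-refl {+ 4})))
              where
              lem : ∀ h r s t → (+ 2 ℤ.* h ℤ.+ + 3 ℤ.- + 3 ℤ.* r) ℤ.+ + 4 ℤ.* (1ℤ ℤ.- s ℤ.- t) ≡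
                    + 2 ℤ.* h ℤ.+ + 7 ℤ.- (+ 3 ℤ.* r ℤ.+ + 4 ℤ.* s ℤ.+ + 4 ℤ.* t)
              lem = ℤ.solve-∀
              eq : (+ (2 * g + 1) ℤ.- + (3 * r)) ℤ.+ + 4 ℤ.* (1ℤ ℤ.- + s ℤ.- + t) ≡ X
              eq = trans (cong₂ (λ u v → (u ℤ.- v) ℤ.+ + 4 ℤ.* (1ℤ ℤ.- + s ℤ.- + t)) ⌜2g+1⌝ (ℤ.pos-* 3 r))
                     (trans (lem (+ h) (+ r) (+ s) (+ t)) (sym ⌜X⌝))
            -- X is twice (g + 1) - (2s + 2t), up to the multiple 3 (1 - r).
            3∣X : + 3 ℤ.∣ X
            3∣X = subst (+ 3 ℤ.∣_) eq (ℤ.∣m∣n⇒∣m+n (ℤ.∣n⇒∣m*n (+ 2) (subst (λ z → + 3 ℤ.∣ + (g + 1) ℤ.- + z) (cong₂ _+_ s′≡ t′≡) 3∣))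
                    (ℤ.∣m⇒∣m*n (1ℤ ℤ.- + r) (ℤ.∣-refl {+ 3})))
              where
              lem : ∀ h r s t → + 2 ℤ.* (h ℤ.+ + 2 ℤ.- (+ 2 ℤ.* s ℤ.+ + 2 ℤ.* t)) ℤ.+ + 3 ℤ.* (1ℤ ℤ.- r) ≡
                    + 2 ℤ.* h ℤ.+ + 7 ℤ.- (+ 3 ℤ.* r ℤ.+ + 4 ℤ.* s ℤ.+ + 4 ℤ.* t)
              lem = ℤ.solve-∀
              eq : + 2 ℤ.* (+ (g + 1) ℤ.- + (2 * s + 2 * t)) ℤ.+ + 3 ℤ.* (1ℤ ℤ.- + r) ≡ X
              eq = trans (cong₂ (λ u v → + 2 ℤ.* (u ℤ.- v) ℤ.+ + 3 ℤ.* (1ℤ ℤ.- + r)) ⌜g+1⌝ (cong₂ ℤ._+_ (ℤ.pos-* 2 s) (ℤ.pos-* 2 t)))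
                     (trans (lem (+ h) (+ r) (+ s) (+ t)) (sym ⌜X⌝))
            -- 12 divides both 4X and 3X, hence their difference.
            12∣ : + 12 ℤ.∣ X
            12∣ = subst (+ 12 ℤ.∣_) (lem X) (ℤ.∣m∣n⇒∣m-n (ℤ.*-monoʳ-∣ (+ 4) 3∣X) (ℤ.*-monoʳ-∣ (+ 3) 4∣X))
              where
              lem : ∀ x → + 4 ℤ.* x ℤ.- + 3 ℤ.* x ≡ x
              lem = ℤ.solve-∀
            unique : ∀ i → (let (r , s , t) = i in inW6 w r s t ≡ true) → i ≡ (r , s , t)
            unique (r₁ , s₁ , t₁) p = cong₂ _,_
              (*-cancelˡ-≡ r₁ r 6 (trans (*-assoc 2 3 r₁) (trans (sym (proj₂ (inW2-true {3 * r₁} (proj₁ (∧-true p))))) er)))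
              (cong₂ _,_ (*-cancelˡ-≡ s₁ s 6 (trans (*-assoc 3 2 s₁) (trans (sym (proj₁ (proj₂ p₃))) es)))
                         (*-cancelˡ-≡ t₁ t 6 (trans (*-assoc 3 2 t₁) (trans (sym (proj₂ (proj₂ p₃))) et))))
              where
              p₃ : Aut (2 * M) × falling ≡ 3 * (2 * s₁) × rising ≡ 3 * (2 * t₁)
              p₃ = inW3-true {2 * s₁} {2 * t₁} (proj₂ (∧-true {inW2 w (3 * r₁)} p))

    symmetry : Symmetry (suc h) w
    symmetry = record
      { two = does (aut? (3 * M)) ; three = does (aut? (2 * M)) ; order = autOrder≡
      ; reversals = reversal ; signs = signed ; both = sixth }

module Masses where

  open import Data.Integer as ℤ using (+_)
  import Data.Integer.Tactic.RingSolver as ℤ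
  open import Data.Nat as ℕ using (ℕ; suc; NonZero)
  open import Data.Nat.Divisibility using (_∣_; _∣?_; divides; ∣-trans)
  open import Data.Rational using (ℚ; 0ℚ; 1ℚ; _+_; _*_; _/_; toℚᵘ)
  open import Data.Rational.Properties
  open import Data.Rational.Solver using (module +-*-Solver)
  import Data.Rational.Unnormalised as ℚᵘ
  import Data.Rational.Unnormalised.Properties as ℚᵘ
  open OneFaceMaps using (𝟙)
  open NumericalConstraints using (cond₂; cond₃; cond₆; Selects; Symmetry; module Genus)

  -- Masses and counts over a list of forms.

  private variable
    A : Set

  ∑ : (A → ℚ) → List A → ℚ
  ∑ f xs = sumQ (map f xs)

  sumQ-++ : ∀ xs ys → sumQ (xs ++ ys) ≡ sumQ xs + sumQ ys
  sumQ-++ []       ys = sym (+-identityˡ _)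
  sumQ-++ (x ∷ xs) ys = trans (cong (λ z → x + z) (sumQ-++ xs ys)) (sym (+-assoc x _ _))

  sumQ-concatMap : (f : A → List ℚ) → ∀ xs → sumQ (concatMap f xs) ≡ ∑ (sumQ ∘ f) xs
  sumQ-concatMap f []       = refl
  sumQ-concatMap f (x ∷ xs) = trans (sumQ-++ (f x) _) (cong (λ z → sumQ (f x) + z) (sumQ-concatMap f xs))

  ∑-cong : {f f′ : A → ℚ} → (∀ x → f x ≡ f′ x) → ∀ xs → ∑ f xs ≡ ∑ f′ xs
  ∑-cong e []       = refl
  ∑-cong e (x ∷ xs) = cong₂ _+_ (e x) (∑-cong e xs)

  ∑-+ : (f f′ : A → ℚ) → ∀ xs → ∑ (λ x → f x + f′ x) xs ≡ ∑ f xs + ∑ f′ xs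
  ∑-+ f f′ []       = refl
  ∑-+ f f′ (x ∷ xs) = trans (cong (λ z → f x + f′ x + z) (∑-+ f f′ xs))
    (solve 4 (λ a b c d → (a :+ b) :+ (c :+ d) := (a :+ c) :+ (b :+ d)) refl (f x) (f′ x) (∑ f xs) (∑ f′ xs))
    where open +-*-Solver

  ∑-zero : {f : A → ℚ} → ∀ xs → (∀ {x} → x ∈ xs → f x ≡ 0ℚ) → ∑ f xs ≡ 0ℚ
  ∑-zero []       e = refl
  ∑-zero (x ∷ xs) e = cong₂ _+_ (e (here refl)) (∑-zero xs (e ∘ there))

  ∑-single : {f : A → ℚ} → ∀ {xs x₀} → Unique xs → x₀ ∈ xs → (∀ x → x ≢ x₀ → f x ≡ 0ℚ) → ∑ f xs ≡ f x₀
  ∑-single {f = f} {_ ∷ xs} {x₀} (x₀≢ ∷ _) (here refl) e =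
    trans (cong (λ z → f x₀ + z) (∑-zero xs (λ {y} y∈ → e y (λ { refl → All.lookup x₀≢ y∈ refl })))) (+-identityʳ _)
  ∑-single {f = f} {x ∷ xs} {x₀} (x≢ ∷ u) (there x₀∈) e =
    trans (cong₂ _+_ (e x (All.lookup x≢ x₀∈)) (∑-single u x₀∈ e)) (+-identityˡ _)

  pick : Bool → ℚ → ℚ
  pick true  x = x
  pick false x = 0ℚ

  ∑-filterᵇ-∷ : (P : A → Bool) (f : A → ℚ) → ∀ x xs → ∑ f (filterᵇ P (x ∷ xs)) ≡ pick (P x) (f x) + ∑ f (filterᵇ P xs)
  ∑-filterᵇ-∷ P f x xs with P x
  ... | true  = refl
  ... | false = sym (+-identityˡ _)

  count-∷ : (P : A → Bool) → ∀ x xs → count P (x ∷ xs) ≡ 𝟙 (P x) ℕ.+ count P xs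
  count-∷ P x xs with P x
  ... | true  = refl
  ... | false = refl

  upToWhere : (ℕ → Bool) → ℕ → List ℕ
  upToWhere c N = filterᵇ c (upTo N)

  ∈-upToWhere : ∀ {c N i} → i ℕ.< N → c i ≡ true → i ∈ upToWhere c N
  ∈-upToWhere {c} i<N ci = ∈-filter⁺ (T? ∘ c) (∈-upTo⁺ i<N) (Equivalence.from T-≡ ci)

  upToWhere-unique : ∀ c N → Unique (upToWhere c N)
  upToWhere-unique c N = filter⁺ (T? ∘ c) (upTo⁺ N)

  module _ (x : ℚ) where

    pick-false : {I : Set} {P : I → Bool} {i₀ : I} → (∀ i → P i ≡ true → i ≡ i₀) → ∀ i → i ≢ i₀ → pick (P i) x ≡ 0ℚ
    pick-false {P = P} u i i≢ with P i in e
    ... | true  = ⊥-elim (i≢ (u i e))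
    ... | false = refl

    none-picked : {I : Set} {P : I → Bool} → (∀ i → P i ≡ false) → ∀ i → pick (P i) x ≡ 0ℚ
    none-picked n i = cong (λ b → pick b x) (n i)

    open Selects

    -- The whole sum over r collapses to its single nonzero term; this and the next two lemmas
    -- remove the parameters from the masses.
    selects₁ : ∀ {b} {P : ℕ → Bool} {c : ℕ → Bool} {N : ℕ} → Selects b P (λ r → r ℕ.< N × c r ≡ true) →
               ∑ (λ r → pick (P r) x) (upToWhere c N) ≡ pick b x
    selects₁ {false} {P} {c} {N} sel = ∑-zero (upToWhere c N) (λ {i} _ → none-picked {P = P} (none sel refl) i)
    selects₁ {true} {P} {c} {N} sel with some sel refl
    ... | r₀ , p , u , r₀< , cr = trans (∑-single (upToWhere-unique c N) (∈-upToWhere r₀< cr) (pick-false {P = P} u))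
                                      (cong (λ z → pick z x) p)

    selects₂ : ∀ {b} {P : ℕ × ℕ → Bool} {c : ℕ → ℕ → Bool} {N : ℕ} →
               Selects b P (λ (s , t) → s ℕ.< N × t ℕ.< N × c s t ≡ true) →
               ∑ (λ s → ∑ (λ t → pick (P (s , t)) x) (upToWhere (c s) N)) (upTo N) ≡ pick b x
    selects₂ {false} {P} {c} {N} sel = ∑-zero (upTo N) (λ {s} _ → ∑-zero (upToWhere (c s) N) (λ {t} _ → none-picked {P = P} (none sel refl) (s , t)))
    selects₂ {true} {P} {c} {N} sel with some sel refl
    ... | (s₀ , t₀) , p , u , s₀< , t₀< , cst = trans
              (∑-single (upTo⁺ N) (∈-upTo⁺ s₀<) (λ s s≢ → ∑-zero (upToWhere (c s) N)
                (λ {t} _ → pick-false {P = P} u (s , t) (λ { refl → s≢ refl }))))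
              (trans (∑-single (upToWhere-unique (c s₀) N) (∈-upToWhere t₀< cst)
                (λ t t≢ → pick-false {P = P} u (s₀ , t) (λ { refl → t≢ refl })))
              (cong (λ z → pick z x) p))

    selects₃ : ∀ {b} {P : ℕ × ℕ × ℕ → Bool} {c : ℕ → ℕ → ℕ → Bool} {N : ℕ} →
               Selects b P (λ (r , s , t) → r ℕ.< N × s ℕ.< N × t ℕ.< N × c r s t ≡ true) →
               ∑ (λ r → ∑ (λ s → ∑ (λ t → pick (P (r , s , t)) x) (upToWhere (c r s) N)) (upTo N)) (upTo N) ≡ pick b x
    selects₃ {false} {P} {c} {N} sel = ∑-zero (upTo N) (λ {r} _ → ∑-zero (upTo N) (λ {s} _ → ∑-zero (upToWhere (c r s) N)
                    (λ {t} _ → none-picked {P = P} (none sel refl) (r , s , t))))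
    selects₃ {true} {P} {c} {N} sel with some sel refl
    ... | (r₀ , s₀ , t₀) , p , u , r₀< , s₀< , t₀< , crst = trans
              (∑-single (upTo⁺ N) (∈-upTo⁺ r₀<) (λ r r≢ → ∑-zero (upTo N) (λ {s} _ → ∑-zero (upToWhere (c r s) N)
                (λ {t} _ → pick-false {P = P} u (r , s , t) (λ { refl → r≢ refl })))))
              (trans (∑-single (upTo⁺ N) (∈-upTo⁺ s₀<) (λ s s≢ → ∑-zero (upToWhere (c r₀ s) N)
                (λ {t} _ → pick-false {P = P} u (r₀ , s , t) (λ { refl → s≢ refl }))))
              (trans (∑-single (upToWhere-unique (c r₀ s₀) N) (∈-upToWhere t₀< crst)
                (λ t t≢ → pick-false {P = P} u (r₀ , s₀ , t) (λ { refl → t≢ refl })))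
              (cong (λ z → pick z x) p)))

  module _ (g : ℕ) where

    weight : MWord g → ℚ
    weight w = + 1 / autOrder w

    mass-∷ : ∀ P w L → mass g P (w ∷ L) ≡ pick (P w) (weight w) + mass g P L
    mass-∷ P = ∑-filterᵇ-∷ P weight

    m₃tot-∑ : ∀ L → m₃tot g L ≡ ∑ (λ s → ∑ (λ t → m₃ g s t L) (upToWhere (cond₃ g s) (g ℕ.+ 2))) (upTo (g ℕ.+ 2))
    m₃tot-∑ L = sumQ-concatMap _ (upTo (g ℕ.+ 2))

    m₆tot-∑ : ∀ L → m₆tot g L ≡ ∑ (λ r → ∑ (λ s → ∑ (λ t → m₆ g r s t L) (upToWhere (cond₆ g r s) (2 ℕ.* g ℕ.+ 6)))
                (upTo (2 ℕ.* g ℕ.+ 6))) (upTo (2 ℕ.* g ℕ.+ 6))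
    m₆tot-∑ L = trans (sumQ-concatMap _ (upTo (2 ℕ.* g ℕ.+ 6)))
      (∑-cong (λ r → sumQ-concatMap (λ s → map (λ t → m₆ g r s t L) (upToWhere (cond₆ g r s) (2 ℕ.* g ℕ.+ 6))) (upTo (2 ℕ.* g ℕ.+ 6))) (upTo (2 ℕ.* g ℕ.+ 6)))

    module _ {w : MWord g} (sy : Symmetry g w) (L : List (MWord g)) where
      open Symmetry sy
      private x = weight w

      m₂tot-∷ : m₂tot g (w ∷ L) ≡ pick two x + m₂tot g L
      m₂tot-∷ = trans (∑-cong (λ r → mass-∷ (λ w → inW2 w r) w L) I) (trans (∑-+ (λ r → pick (inW2 w r) x) (λ r → m₂ g r L) I)
        (cong (_+ m₂tot g L) (selects₁ x {c = cond₂ g} reversals)))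
        where I = upToWhere (cond₂ g) (2 ℕ.* g ℕ.+ 2)

      m₃tot-∷ : m₃tot g (w ∷ L) ≡ pick three x + m₃tot g L
      m₃tot-∷ = trans (m₃tot-∑ (w ∷ L)) (trans
        (∑-cong (λ s → trans (∑-cong (λ t → mass-∷ (λ w → inW3 w s t) w L) (I s)) (∑-+ (λ t → pick (inW3 w s t) x) (λ t → m₃ g s t L) (I s))) N)
        (trans (∑-+ (λ s → ∑ (λ t → pick (inW3 w s t) x) (I s)) (λ s → ∑ (λ t → m₃ g s t L) (I s)) N)
        (cong₂ _+_ (selects₂ x {c = cond₃ g} signs) (sym (m₃tot-∑ L)))))
        where
        N = upTo (g ℕ.+ 2)
        I = λ s → upToWhere (cond₃ g s) (g ℕ.+ 2)

      m₆tot-∷ : m₆tot g (w ∷ L) ≡ pick (three ∧ two) x + m₆tot g L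
      m₆tot-∷ = trans (m₆tot-∑ (w ∷ L)) (trans
        (∑-cong (λ r → trans (∑-cong (λ s → trans (∑-cong (λ t → mass-∷ (λ w → inW6 w r s t) w L) (I r s))
            (∑-+ (λ t → pick (inW6 w r s t) x) (λ t → m₆ g r s t L) (I r s))) N)
            (∑-+ (λ s → ∑ (λ t → pick (inW6 w r s t) x) (I r s)) (λ s → ∑ (λ t → m₆ g r s t L) (I r s)) N)) N)
        (trans (∑-+ (λ r → ∑ (λ s → ∑ (λ t → pick (inW6 w r s t) x) (I r s)) N) (λ r → ∑ (λ s → ∑ (λ t → m₆ g r s t L) (I r s)) N) N)
        (cong₂ _+_ (selects₃ x {c = cond₆ g} both) (sym (m₆tot-∑ L)))))
        where
        N = upTo (2 ℕ.* g ℕ.+ 6)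
        I = λ r s → upToWhere (cond₆ g r s) (2 ℕ.* g ℕ.+ 6)

    m₂tot-[] : m₂tot g [] ≡ 0ℚ
    m₂tot-[] = ∑-zero (upToWhere (cond₂ g) (2 ℕ.* g ℕ.+ 2)) (λ _ → refl)

    m₃tot-[] : m₃tot g [] ≡ 0ℚ
    m₃tot-[] = trans (m₃tot-∑ []) (∑-zero (upTo (g ℕ.+ 2)) (λ {s} _ → ∑-zero (upToWhere (cond₃ g s) (g ℕ.+ 2)) (λ _ → refl)))

    m₆tot-[] : m₆tot g [] ≡ 0ℚ
    m₆tot-[] = trans (m₆tot-∑ []) (∑-zero (upTo N) (λ {r} _ → ∑-zero (upTo N) (λ {s} _ → ∑-zero (upToWhere (cond₆ g r s) N) (λ _ → refl))))
      where N = 2 ℕ.* g ℕ.+ 6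

  -- `+ m / 1` is normalised by a gcd and does not compute for a variable m, so the identity is
  -- checked in the unnormalised rationals.
  ℕtoℚ-suc : ∀ m → ℕtoℚ (suc m) ≡ 1ℚ + ℕtoℚ m
  ℕtoℚ-suc m = toℚᵘ-injective (begin
    toℚᵘ (ℕtoℚ (suc m))                        ≈⟨ toℚᵘ-fromℚᵘ (ℚᵘ.mkℚᵘ (+ suc m) 0) ⟩
    ℚᵘ.mkℚᵘ (+ suc m) 0                        ≈⟨ ℚᵘ.*≡* (lem (+ m)) ⟩
    ℚᵘ.1ℚᵘ ℚᵘ.+ ℚᵘ.mkℚᵘ (+ m) 0                ≈⟨ ℚᵘ.+-congʳ ℚᵘ.1ℚᵘ (toℚᵘ-fromℚᵘ (ℚᵘ.mkℚᵘ (+ m) 0)) ⟨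
    toℚᵘ 1ℚ ℚᵘ.+ toℚᵘ (ℕtoℚ m)                 ≈⟨ toℚᵘ-homo-+ 1ℚ (ℕtoℚ m) ⟨
    toℚᵘ (1ℚ + ℕtoℚ m)                         ∎)
    where
    open ℚᵘ.≃-Reasoning
    lem : ∀ m → (+ 1 ℤ.+ m) ℤ.* + 1 ≡ (+ 1 ℤ.* + 1 ℤ.+ m ℤ.* + 1) ℤ.* + 1
    lem = ℤ.solve-∀

  ℕtoℚ-count-∷ : (P : A → Bool) → ∀ x xs → ℕtoℚ (count P (x ∷ xs)) ≡ pick (P x) 1ℚ + ℕtoℚ (count P xs)
  ℕtoℚ-count-∷ P x xs = trans (cong ℕtoℚ (count-∷ P x xs)) (go (P x) (count P xs))
    where
    go : ∀ b m → ℕtoℚ (𝟙 b ℕ.+ m) ≡ pick b 1ℚ + ℕtoℚ m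
    go true  m = ℕtoℚ-suc m
    go false m = sym (+-identityˡ _)

  -- The order a is kept as a variable so that matching on `refl` replaces it by 6, 2, 3 or 1; all
  -- fractions and divisibility tests then evaluate.
  weights : ∀ {a} .{{_ : NonZero a}} two three → a ≡ 1 ℕ.+ 2 ℕ.* 𝟙 three ℕ.+ 𝟙 two ℕ.+ 2 ℕ.* 𝟙 (three ∧ two) →
    let x = + 1 / a in
    pick (does (1 ∣? a)) 1ℚ ≡ x + pick two x + (+ 2 / 1) * pick three x + (+ 2 / 1) * pick (three ∧ two) x
    × pick (does (2 ∣? a)) 1ℚ ≡ (+ 2 / 1) * pick two x + (+ 4 / 1) * pick (three ∧ two) x
    × pick (does (3 ∣? a)) 1ℚ ≡ (+ 3 / 1) * pick three x + (+ 3 / 1) * pick (three ∧ two) x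
    × pick (does (6 ∣? a)) 1ℚ ≡ (+ 6 / 1) * pick (three ∧ two) x
    × a ∣ 6
  weights true  true  refl = refl , refl , refl , refl , divides 1 refl
  weights true  false refl = refl , refl , refl , refl , divides 3 refl
  weights false true  refl = refl , refl , refl , refl , divides 2 refl
  weights false false refl = refl , refl , refl , refl , divides 6 refl

  Counts : (g : ℕ) → List (MWord g) → Set
  Counts g L =
    (ℕtoℚ (Mcount g 1 L) ≡ m₁ g L + m₂tot g L + (+ 2 / 1) * m₃tot g L + (+ 2 / 1) * m₆tot g L)
    × (ℕtoℚ (Mcount g 2 L) ≡ (+ 2 / 1) * m₂tot g L + (+ 4 / 1) * m₆tot g L)
    × (ℕtoℚ (Mcount g 3 L) ≡ (+ 3 / 1) * m₃tot g L + (+ 3 / 1) * m₆tot g L)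
    × (ℕtoℚ (Mcount g 6 L) ≡ (+ 6 / 1) * m₆tot g L)
    × ((d : ℕ) → 1 ℕ.≤ d → ¬ (d ∣ 6) → Mcount g d L ≡ 0)

  counts-[] : ∀ g → Counts g []
  counts-[] g = go (m₂tot-[] g) (m₃tot-[] g) (m₆tot-[] g)
    where
    go : ∀ {a b c} → a ≡ 0ℚ → b ≡ 0ℚ → c ≡ 0ℚ →
         (0ℚ ≡ 0ℚ + a + (+ 2 / 1) * b + (+ 2 / 1) * c) × (0ℚ ≡ (+ 2 / 1) * a + (+ 4 / 1) * c)
         × (0ℚ ≡ (+ 3 / 1) * b + (+ 3 / 1) * c) × (0ℚ ≡ (+ 6 / 1) * c) × ((d : ℕ) → 1 ℕ.≤ d → ¬ (d ∣ 6) → 0 ≡ 0)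
    go refl refl refl = refl , refl , refl , refl , (λ _ _ _ → refl)

  private
    open +-*-Solver

    -- The masses enter as variables, so that the ring solver does not have to unfold them.
    join₄ : ∀ c p₁ p₂ p₃ p₆ q₁ q₂ q₃ q₆ {k l m r₂ r₃ r₆} → m ≡ k + l → k ≡ p₁ + p₂ + c * p₃ + c * p₆ → l ≡ q₁ + q₂ + c * q₃ + c * q₆ →
            r₂ ≡ p₂ + q₂ → r₃ ≡ p₃ + q₃ → r₆ ≡ p₆ + q₆ → m ≡ (p₁ + q₁) + r₂ + c * r₃ + c * r₆
    join₄ c p₁ p₂ p₃ p₆ q₁ q₂ q₃ q₆ refl refl refl refl refl refl =
      solve 9 (λ c p₁ p₂ p₃ p₆ q₁ q₂ q₃ q₆ →
        (p₁ :+ p₂ :+ c :* p₃ :+ c :* p₆) :+ (q₁ :+ q₂ :+ c :* q₃ :+ c :* q₆) :=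
        (p₁ :+ q₁) :+ (p₂ :+ q₂) :+ c :* (p₃ :+ q₃) :+ c :* (p₆ :+ q₆)) refl c p₁ p₂ p₃ p₆ q₁ q₂ q₃ q₆

    join₂ : ∀ c d p q p₆ q₆ {k l m r r₆} → m ≡ k + l → k ≡ c * p + d * p₆ → l ≡ c * q + d * q₆ →
            r ≡ p + q → r₆ ≡ p₆ + q₆ → m ≡ c * r + d * r₆
    join₂ c d p q p₆ q₆ refl refl refl refl refl =
      solve 6 (λ c d p q p₆ q₆ → (c :* p :+ d :* p₆) :+ (c :* q :+ d :* q₆) := c :* (p :+ q) :+ d :* (p₆ :+ q₆)) refl c d p q p₆ q₆

    join₁ : ∀ c p q {k l m r} → m ≡ k + l → k ≡ c * p → l ≡ c * q → r ≡ p + q → m ≡ c * r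
    join₁ c p q refl refl refl refl = sym (*-distribˡ-+ c p q)

    vanish : ∀ {d a b} → a ∣ 6 → ¬ (d ∣ 6) → b ≡ 0 → 𝟙 (does (d ∣? a)) ℕ.+ b ≡ 0
    vanish {d} {a} a∣6 d∤6 refl = cong (λ z → 𝟙 z ℕ.+ 0) (dec-false (d ∣? a) (λ d∣a → d∤6 (∣-trans d∣a a∣6)))

  counts-∷ : ∀ {g w L} → Symmetry g w → Counts g L → Counts g (w ∷ L)
  counts-∷ {g} {w} {L} sy (e₁ , e₂ , e₃ , e₆ , e₀) = extend (weights two three order)
    where
    open Symmetry sy
    x = weight g w
    a = autOrder w
    tally : ∀ d → ℕtoℚ (Mcount g d (w ∷ L)) ≡ pick (does (d ∣? a)) 1ℚ + ℕtoℚ (Mcount g d L)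
    tally d = ℕtoℚ-count-∷ (λ w → does (d ∣? autOrder w)) w L
    extend : (pick (does (1 ∣? a)) 1ℚ ≡ x + pick two x + (+ 2 / 1) * pick three x + (+ 2 / 1) * pick (three ∧ two) x
      × pick (does (2 ∣? a)) 1ℚ ≡ (+ 2 / 1) * pick two x + (+ 4 / 1) * pick (three ∧ two) x
      × pick (does (3 ∣? a)) 1ℚ ≡ (+ 3 / 1) * pick three x + (+ 3 / 1) * pick (three ∧ two) x
      × pick (does (6 ∣? a)) 1ℚ ≡ (+ 6 / 1) * pick (three ∧ two) x
      × a ∣ 6) → Counts g (w ∷ L)
    extend (h₁ , h₂ , h₃ , h₆ , a∣6) =
        join₄ (+ 2 / 1) x (pick two x) (pick three x) (pick (three ∧ two) x) (m₁ g L) (m₂tot g L) (m₃tot g L) (m₆tot g L) (tally 1) h₁ e₁ (m₂tot-∷ g sy L) (m₃tot-∷ g sy L) (m₆tot-∷ g sy L)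
      , join₂ (+ 2 / 1) (+ 4 / 1) (pick two x) (m₂tot g L) (pick (three ∧ two) x) (m₆tot g L) (tally 2) h₂ e₂ (m₂tot-∷ g sy L) (m₆tot-∷ g sy L)
      , join₂ (+ 3 / 1) (+ 3 / 1) (pick three x) (m₃tot g L) (pick (three ∧ two) x) (m₆tot g L) (tally 3) h₃ e₃ (m₃tot-∷ g sy L) (m₆tot-∷ g sy L)
      , join₁ (+ 6 / 1) (pick (three ∧ two) x) (m₆tot g L) (tally 6) h₆ e₆ (m₆tot-∷ g sy L)
      , λ d 1≤d d∤6 → trans (count-∷ (λ w → does (d ∣? autOrder w)) w L) (vanish a∣6 d∤6 (e₀ d 1≤d d∤6))

  counts : ∀ h L → All (IsMaxWicks (suc h)) L → Counts (suc h) L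
  counts h []      []       = counts-[] (suc h)
  counts h (w ∷ L) (m ∷ ms) = counts-∷ {suc h} {w} {L} (Genus.symmetry h w m) (counts h L ms)

open import Data.Nat using (ℕ; suc; _≤_)
open import Data.Nat.Divisibility using (_∣_)
open import Data.Product using (_×_; _,_)
open import Data.List using (List)
open import Data.Integer using (+_)
open import Data.Rational using (ℚ; _+_; _*_; _/_)
open import Relation.Nullary using (¬_)
open import Relation.Binary.PropositionalEquality using (_≡_)

theorem1p2 : (g : ℕ) → 1 ≤ g → (L : List (MWord g)) → IsTransversal g L →
    (ℕtoℚ (Mcount g 1 L) ≡ m₁ g L + m₂tot g L + (+ 2 / 1) * m₃tot g L + (+ 2 / 1) * m₆tot g L)
    × (ℕtoℚ (Mcount g 2 L) ≡ (+ 2 / 1) * m₂tot g L + (+ 4 / 1) * m₆tot g L)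
    × (ℕtoℚ (Mcount g 3 L) ≡ (+ 3 / 1) * m₃tot g L + (+ 3 / 1) * m₆tot g L)
    × (ℕtoℚ (Mcount g 6 L) ≡ (+ 6 / 1) * m₆tot g L)
    × ((d : ℕ) → 1 ≤ d → ¬ (d ∣ 6) → Mcount g d L ≡ 0)
theorem1p2 (suc h) _ L (maximal , _) = Masses.counts h L maximal
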